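{- Let $n,m,b,k\in\mathbb{Z}$ with $n\ge 3$, $|m|\ge 2$, $b\ge 2$ and $k\ge 2$. Assume that $\gcd(b,m)=1$, that $b$ is squarefree, and that $m\equiv 0\pmod{\mathrm{rad}(k)}$. Let $$\mathcal{D}:=\frac{n^n(1-bm^{2n})^{n+1}+bm^{2n}(n+1)^{n+1}}{(1+bm^{2n}n)^2}\in\mathbb{Z},$$ and assume that $$d:=\frac{|\mathcal{D}|}{\prod_{p\text{ prime},\ p\mid bm}p^{\nu_p(\mathcal{D})}}$$ is squarefree. Assume further that, for every prime divisor $p$ of $k$, the polynomial $$g_p(x):=x^{nk/p^{\nu_p(k)}}+b$$ is irreducible in $\mathbb{F}_p[x]$. Let $$\mathcal{F}_{n,b,m,k}(x):=x^{nk}+b\sum_{j=1}^{n}(m^2x^k)^{n-j}.$$ Then $\mathcal{F}_{n,b,m,k}(x)$ is monogenic if and only if both of the following hold: (1) no odd prime divisor of $k\gcd(n,m)$ is a base-$b$ Wieferich prime; and (2) if $k\gcd(n,m)\equiv 0\pmod 2$, then $b\equiv 1\pmod 4$ (equivalently, $2$ is a base-$b$ Wieferich prime).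
   Context: For an integer $b\ge 2$, a prime $p\ge 2$ is called a base-$b$ Wieferich prime if $b^{p-1}\equiv 1\pmod{p^2}$. A monic polynomial $f(x)\in\mathbb{Z}[x]$ is called monogenic if $f(x)$ is irreducible over $\mathbb{Q}$ and $\{1,\theta,\theta^2,\ldots,\theta^{\deg(f)-1}\}$ is a basis (over $\mathbb{Z}$) for the ring of integers of $\mathbb{Q}(\theta)$, where $f(\theta)=0$. Here $\mathrm{rad}(k)$ is the product of the distinct prime divisors of $k$, and $\nu_p(z)$ denotes the $p$-adic valuation of the integer $z$. The quantity $\mathcal{D}$ is always an integer. In the sum, the term $j=n$ is $(m^2x^k)^0=1$. -}

module Defs where

open import Algebra.Bundles.Raw using (RawRing)
import Algebra.Definitions.RawMonoid as RawMonoidDefs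
import Algebra.Definitions.RawSemiring as RawSemiringDefs
open import Data.Fin.Base using (Fin; toℕ)
open import Data.Integer.Base as ℤ using (ℤ; +_; 0ℤ; 1ℤ; ∣_∣)
import Data.Integer.Divisibility as ℤDiv
import Data.Integer.DivMod as ℤDivMod
import Data.Integer.Properties as ℤP
open import Data.Integer.Tactic.RingSolver using (solve-∀)
open import Data.List.Base as List using (List; []; _∷_; filter; upTo)
open import Data.List.Relation.Unary.All as All using (All)
open import Data.List.Relation.Unary.All.Properties using (all-filter; map⁺)
open import Data.Nat.Base as ℕ using (ℕ; zero; suc; _<_; _∸_)
import Data.Nat.Divisibility as ℕDiv
open import Data.Nat.DivMod using () renaming (_/_ to _/ℕ_)
open import Data.Nat.ListAction using (product)
open import Data.Nat.ListAction.Properties using (product≢0)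
open import Data.Nat.Primality using (Prime; prime?; prime⇒nonZero)
import Data.Nat.Properties as ℕP
open import Data.Product.Base using (Σ-syntax; ∃; ∃-syntax; _×_; _,_; proj₁; proj₂)
open import Data.Rational.Base as ℚ using (ℚ)
open import Level using (0ℓ)
open import Relation.Binary.PropositionalEquality
open import Relation.Nullary using (yes; no; contradiction)
open import Relation.Nullary.Decidable using (_×-dec_)

infix 4 _≡_[mod_]

_≡_[mod_] : ℤ → ℤ → ℕ → Set
x ≡ y [mod n ] = + n ℤDiv.∣ (x ℤ.- y)

Squarefree : ℕ → Set
Squarefree n = ∀ c → (c ℕ.* c) ℕDiv.∣ n → c ≡ 1

-- Complete for n ≠ 0, since then every divisor of n is at most n.
primeDivisors : ℕ → List ℕ
primeDivisors n = filter (λ p → prime? p ×-dec (p ℕDiv.∣? n)) (upTo (suc n))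

rad : ℕ → ℕ
rad n = product (primeDivisors n)

-- The largest e ≤ bound with p ^ e ∣ z.
ν≤ : (bound p z : ℕ) → ℕ
ν≤ zero    p z = 0
ν≤ (suc e) p z with (p ℕ.^ suc e) ℕDiv.∣? z
... | yes _ = suc e
... | no  _ = ν≤ e p z

-- The p-adic valuation of z, for p ≥ 2 and z ≠ 0: p ^ e ∣ z forces
-- e < p ^ e ≤ ∣ z ∣, so ∣ z ∣ is a sufficient bound.
ν : ℕ → ℤ → ℕ
ν p z = ν≤ (∣ z ∣) p (∣ z ∣)

-- p is assumed to be prime.
Wieferich : (b p : ℕ) → Set
Wieferich b p = (+ b) ℤ.^ (p ∸ 1) ≡ 1ℤ [mod p ℕ.^ 2 ]

primaryPart : ℤ → ℤ → ℕ
primaryPart N z = product (List.map (λ p → p ℕ.^ ν p z) (primeDivisors ∣ N ∣))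

primaryPart-nonZero : ∀ N z → ℕ.NonZero (primaryPart N z)
primaryPart-nonZero N z = product≢0 (map⁺ (All.map
  (λ {p} (pr , _) → ℕP.m^n≢0 p (ν p z) {{prime⇒nonZero pr}})
  (all-filter (λ p → prime? p ×-dec (p ℕDiv.∣? ∣ N ∣)) (upTo (suc ∣ N ∣)))))

module _ (n : ℕ) (m : ℤ) (b : ℕ) where
  open import Data.Integer.Base using (_+_; _*_; _-_; _^_)

  𝒟-num : ℤ
  𝒟-num = (+ n) ^ n * (1ℤ - + b * m ^ (2 ℕ.* n)) ^ suc n
        + + b * m ^ (2 ℕ.* n) * (+ n + 1ℤ) ^ suc n

  𝒟-den : ℤ
  𝒟-den = (1ℤ + + b * m ^ (2 ℕ.* n) * + n) ^ 2

module 𝒟-Exactness where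
  open import Data.Integer.Base using (_+_; _*_; _-_; _^_)

  square≥0 : ∀ i → ∃[ c ] i ^ 2 ≡ + c
  square≥0 (+ k)       = _ , trans (cong (+ k *_) (ℤP.*-identityʳ (+ k))) (sym (ℤP.pos-* k k))
  square≥0 ℤ.-[1+ k ]  = _ , cong (ℤ.-[1+ k ] *_) (ℤP.*-identityʳ ℤ.-[1+ k ])

  pow≥0 : ∀ c n → ∃[ e ] (+ c) ^ n ≡ + e
  pow≥0 c zero    = 1 , refl
  pow≥0 c (suc n) with e , eq ← pow≥0 c n =
    c ℕ.* e , trans (cong (+ c *_) eq) (sym (ℤP.pos-* c e))

  even-pow≥0 : ∀ i n → ∃[ e ] i ^ (2 ℕ.* n) ≡ + e
  even-pow≥0 i n with c , eq ← square≥0 i with e , eq′ ← pow≥0 c n =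
    e , trans (sym (ℤP.^-*-assoc i 2 n)) (trans (cong (_^ n) eq) eq′)

  root>0 : ∀ n m b → ∃[ w ] 1ℤ + + b * m ^ (2 ℕ.* n) * + n ≡ + suc w
  root>0 n m b = b ℕ.* e ℕ.* n , cong (λ z → 1ℤ + z) (trans
    (cong (λ z → + b * z * + n) (proj₂ (even-pow≥0 m n)))
    (trans (cong (_* + n) (sym (ℤP.pos-* b e))) (sym (ℤP.pos-* (b ℕ.* e) n))))
    where
    e : ℕ
    e = proj₁ (even-pow≥0 m n)

  -- (u - t) ^ (N + 1) ≡ u ^ (N + 1) - (N + 1) t u ^ N  modulo t²
  binomial : ∀ u t N → ∃[ r ]
    (u - t) ^ suc N ≡ u ^ suc N - + suc N * (t * u ^ N) + r * (t * t)
  binomial u t zero = 0ℤ , lem u t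
    where
    lem : ∀ u t → (u - t) * 1ℤ ≡ u * 1ℤ - 1ℤ * (t * 1ℤ) + 0ℤ * (t * t)
    lem = solve-∀
  binomial u t (suc N) with r , eq ← binomial u t N =
    (u - t) * r + + suc N * u ^ N , trans (cong ((u - t) *_) eq) (lem u t (u ^ N) (+ suc N) r)
    where
    lem : ∀ u t v c r →
      (u - t) * (u * v - c * (t * v) + r * (t * t)) ≡
      u * (u * v) - (1ℤ + c) * (t * (u * v)) + ((u - t) * r + c * v) * (t * t)
    lem = solve-∀

  pow-distrib : ∀ x y N → x ^ N * y ^ N ≡ (x * y) ^ N
  pow-distrib x y zero    = refl
  pow-distrib x y (suc N) = trans (lem x y (x ^ N) (y ^ N)) (cong (x * y *_) (pow-distrib x y N))
    where
    lem : ∀ x y v w → x * v * (y * w) ≡ x * y * (v * w)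
    lem = solve-∀

  den∣num : ∀ n m b → ∃[ q ] 𝒟-num n m b ≡ q * 𝒟-den n m b
  den∣num n m b =
    num - + 2 * t * a * r + a * a * N * r , lem₃ N num a r scaled
    where
    N a t u num : ℤ
    N = + n
    a = + b * m ^ (2 ℕ.* n)
    t = 1ℤ + a * N
    u = N + 1ℤ
    num = N ^ n * (1ℤ - a) ^ suc n + a * u ^ suc n
    r : ℤ
    r = proj₁ (binomial u t n)

    lem₁ : ∀ N a v w x → N * (v * w + a * x) ≡ N * v * w + N * a * x
    lem₁ = solve-∀

    base : ∀ N a → N * (1ℤ - a) ≡ (N + 1ℤ) - (1ℤ + a * N)
    base = solve-∀

    lem₂ : ∀ N a v r → let t = 1ℤ + a * N ; u = N + 1ℤ in
      u * v - (1ℤ + N) * (t * v) + r * (t * t) + N * a * (u * v) ≡ r * (t * t)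
    lem₂ = solve-∀

    scaled : N * num ≡ r * (t * t)
    scaled = begin
      N * num
        ≡⟨ lem₁ N a (N ^ n) ((1ℤ - a) ^ suc n) (u ^ suc n) ⟩
      N ^ suc n * (1ℤ - a) ^ suc n + N * a * u ^ suc n
        ≡⟨ cong (_+ N * a * u ^ suc n) (pow-distrib N (1ℤ - a) (suc n)) ⟩
      (N * (1ℤ - a)) ^ suc n + N * a * u ^ suc n
        ≡⟨ cong (λ z → z ^ suc n + N * a * u ^ suc n) (base N a) ⟩
      (u - t) ^ suc n + N * a * u ^ suc n
        ≡⟨ cong (_+ N * a * u ^ suc n) (proj₂ (binomial u t n)) ⟩
      u ^ suc n - + suc n * (t * u ^ n) + r * (t * t) + N * a * u ^ suc n
        ≡⟨ lem₂ N a (u ^ n) r ⟩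
      r * (t * t) ∎
      where open ≡-Reasoning

    -- 1 = (t - a N)², so num = t² num - 2 t a (N num) + a² N (N num).
    lem₃ : ∀ N num a r → N * num ≡ r * ((1ℤ + a * N) * (1ℤ + a * N)) →
      num ≡ (num - + 2 * (1ℤ + a * N) * a * r + a * a * N * r) * (1ℤ + a * N) ^ 2
    lem₃ N num a r eq = trans (e₁ N num a)
      (trans (cong (λ z → num * (t′ * t′) - + 2 * t′ * a * z + a * a * N * z) eq)
             (e₂ num (1ℤ + a * N) a r N))
      where
      t′ : ℤ
      t′ = 1ℤ + a * N
      e₁ : ∀ N num a → let t = 1ℤ + a * N in
        num ≡ num * (t * t) - + 2 * t * a * (N * num) + a * a * N * (N * num)
      e₁ = solve-∀
      e₂ : ∀ num t a r N →
        num * (t * t) - + 2 * t * a * (r * (t * t)) + a * a * N * (r * (t * t)) ≡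
        (num - + 2 * t * a * r + a * a * N * r) * (t * (t * 1ℤ))
      e₂ = solve-∀

  exact : ∀ a d .{{_ : ℤ.NonZero d}} q → a ≡ q * d → (a ℤDivMod./ d) * d ≡ a
  exact a d q eq = sym (trans a≡r+s (trans (cong (λ r → + r + s) r≡0) (ℤP.+-identityˡ s)))
    where
    s : ℤ
    s = (a ℤDivMod./ d) * d
    a≡r+s : a ≡ + (a ℤDivMod.% d) + s
    a≡r+s = ℤDivMod.a≡a%n+[a/n]*n a d
    lem : ∀ r s → r ≡ (r + s) - s
    lem = solve-∀
    factor : ∀ q c d → q * d - c * d ≡ (q - c) * d
    factor = solve-∀
    r≡ : + (a ℤDivMod.% d) ≡ (q - a ℤDivMod./ d) * d
    r≡ = trans (lem _ s) (trans (cong (_- s) (trans (sym a≡r+s) eq)) (factor q _ d))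
    d∣r : ∣ d ∣ ℕDiv.∣ (a ℤDivMod.% d)
    d∣r = ℕDiv.divides ∣ q - a ℤDivMod./ d ∣ (trans (cong ∣_∣ r≡) (ℤP.abs-* (q - a ℤDivMod./ d) d))
    r≡0 : a ℤDivMod.% d ≡ 0
    r≡0 with a ℤDivMod.% d | ℤDivMod.n%d<d a d | d∣r
    ... | zero  | _  | _ = refl
    ... | suc r | lt | v = contradiction v (ℕDiv.>⇒∤ lt)

open 𝒟-Exactness

𝒟-den-nonZero : ∀ n m b → ℤ.NonZero (𝒟-den n m b)
𝒟-den-nonZero n m b = subst (λ t → ℤ.NonZero (t ℤ.^ 2)) (sym (proj₂ (root>0 n m b))) _

-- The quotient is exact, by 𝒟-exact.
𝒟 : ℕ → ℤ → ℕ → ℤ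
𝒟 n m b = 𝒟-num n m b ℤDivMod./ 𝒟-den n m b
  where instance _ = 𝒟-den-nonZero n m b

𝒟-exact : ∀ n m b → 𝒟 n m b ℤ.* 𝒟-den n m b ≡ 𝒟-num n m b
𝒟-exact n m b = exact (𝒟-num n m b) (𝒟-den n m b) {{𝒟-den-nonZero n m b}}
  (proj₁ (den∣num n m b)) (proj₂ (den∣num n m b))

-- An exact quotient: the p ^ ν p 𝒟 are pairwise coprime divisors of 𝒟.
𝒹 : ℕ → ℤ → ℕ → ℕ
𝒹 n m b = ∣ 𝒟 n m b ∣ /ℕ primaryPart (+ b ℤ.* m) (𝒟 n m b)
  where instance _ = primaryPart-nonZero (+ b ℤ.* m) (𝒟 n m b)

-- Coefficient lists, constant term first.  Trailing zeros are allowed,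
-- so equality is equality of all coefficients.
module Polynomial {c ℓ} (R : RawRing c ℓ) where
  open RawRing R renaming (Carrier to A)

  Poly : Set c
  Poly = List A

  coeff : Poly → ℕ → A
  coeff []      _       = 0#
  coeff (a ∷ f) zero    = a
  coeff (a ∷ f) (suc i) = coeff f i

  infix 4 _≈ₚ_
  _≈ₚ_ : Poly → Poly → Set ℓ
  f ≈ₚ g = ∀ i → coeff f i ≈ coeff g i

  infixl 6 _+ₚ_
  _+ₚ_ : Poly → Poly → Poly
  []      +ₚ g       = g
  (a ∷ f) +ₚ []      = a ∷ f
  (a ∷ f) +ₚ (b ∷ g) = (a + b) ∷ (f +ₚ g)

  infixl 7 _*ₚ_
  _*ₚ_ : Poly → Poly → Poly
  []      *ₚ g = []
  (a ∷ f) *ₚ g = List.map (a *_) g +ₚ (0# ∷ (f *ₚ g))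

  C : A → Poly
  C a = a ∷ []

  X : Poly
  X = 0# ∷ 1# ∷ []

  MonicOfDegree : Poly → ℕ → Set ℓ
  MonicOfDegree f d = coeff f d ≈ 1# × (∀ i → d < i → coeff f i ≈ 0#)

  polyRing : RawRing c ℓ
  polyRing = record
    { Carrier = Poly
    ; _≈_     = _≈ₚ_
    ; _+_     = _+ₚ_
    ; _*_     = _*ₚ_
    ; -_      = List.map (-_)
    ; 0#      = []
    ; 1#      = C 1#
    }

  open RawSemiringDefs (RawRing.rawSemiring polyRing) public
    using (Irreducible; sum) renaming (_^_ to _^ₚ_)

-- ℤ/p, with the integers as representatives.
𝔽 : ℕ → RawRing 0ℓ 0ℓ
𝔽 p = record
  { Carrier = ℤ
  ; _≈_     = λ x y → x ≡ y [mod p ]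
  ; _+_     = ℤ._+_
  ; _*_     = ℤ._*_
  ; -_      = ℤ.-_
  ; 0#      = 0ℤ
  ; 1#      = 1ℤ
  }

module ℤ[x] = Polynomial ℤ.+-*-rawRing
module ℚ[x] = Polynomial ℚ.+-*-rawRing
module 𝔽[x] (p : ℕ) = Polynomial (𝔽 p)

ℤ[x]→ℚ[x] : ℤ[x].Poly → ℚ[x].Poly
ℤ[x]→ℚ[x] = List.map (λ z → z ℚ./ 1)

-- ℚ(θ) with f(θ) = 0, realised as ℚ[x]/(f) with θ the class of x; this
-- is a field when f is irreducible over ℚ.
module NumberField (f : ℤ[x].Poly) where

  private
    module P = RawRing ℚ[x].polyRing

  open RawMonoidDefs P.*-rawMonoid using (_∣_)

  K : RawRing 0ℓ 0ℓ
  K = record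
    { Carrier = P.Carrier
    ; _≈_     = λ α β → ℤ[x]→ℚ[x] f ∣ (α P.+ (P.- β))
    ; _+_     = P._+_
    ; _*_     = P._*_
    ; -_      = P.-_
    ; 0#      = P.0#
    ; 1#      = P.1#
    }

  open RawRing K
  open RawSemiringDefs rawSemiring using (sum; _^_)

  ι : ℤ → Carrier
  ι z = ℚ[x].C (z ℚ./ 1)

  θ : Carrier
  θ = ℚ[x].X

  eval : ℤ[x].Poly → Carrier → Carrier
  eval g α = List.foldr (λ c acc → ι c + α * acc) 0# g

  Integral : Carrier → Set
  Integral α = Σ[ g ∈ ℤ[x].Poly ] (∃[ e ] ℤ[x].MonicOfDegree g e) × eval g α ≈ 0#

  combination : ∀ {N} → (Fin N → ℤ) → (Fin N → Carrier) → Carrier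
  combination c ω = sum (λ i → ι (c i) * ω i)

  -- The ring of integers of K is the subset Integral.
  record IsIntegralBasis {N : ℕ} (ω : Fin N → Carrier) : Set where
    field
      integral    : ∀ i → Integral (ω i)
      spanning    : ∀ α → Integral α → ∃[ c ] α ≈ combination c ω
      independent : ∀ c → combination c ω ≈ 0# → ∀ i → c i ≡ 0ℤ

  powers : ∀ N → Fin N → Carrier
  powers N i = θ ^ toℕ i

record Monogenic (f : ℤ[x].Poly) : Set where
  field
    degree      : ℕ
    monic       : ℤ[x].MonicOfDegree f degree
    irreducible : ℚ[x].Irreducible (ℤ[x]→ℚ[x] f)
    powerBasis  : NumberField.IsIntegralBasis f (NumberField.powers f degree)

g : (n b k p : ℕ) → Prime p → 𝔽[x].Poly p
g n b k p pr = X ^ₚ ((n ℕ.* k) /ℕ (p ℕ.^ ν p (+ k))) +ₚ C (+ b)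
  where
  open 𝔽[x] p
  instance _ = ℕP.m^n≢0 p (ν p (+ k)) {{prime⇒nonZero pr}}

-- The index i of the sum, 0 ≤ i < n, stands for j = i + 1.
ℱ : (n b : ℕ) (m : ℤ) (k : ℕ) → ℤ[x].Poly
ℱ n b m k =
  X ^ₚ (n ℕ.* k) +ₚ
  C (+ b) *ₚ sum {n} (λ i → (C (m ℤ.^ 2) *ₚ X ^ₚ k) ^ₚ (n ∸ suc (toℕ i)))
  where open ℤ[x]

{-# OPTIONS --safe #-}
-- Let θ be a root of F = ℱ n b m k.  If N α = φ(θ) with α integral, then the powers
-- of φ(θ) / N have a common denominator; so ℤ[θ] is the ring of integers as soon as,
-- for every prime p, an element of ℤ[θ] whose powers divided by those of p have bounded
-- denominator is a multiple of p.  This holds if F is squarefree mod p, and otherwise by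
-- Dedekind's criterion if F = h u - p r up to a factor prime to p, where mod p some power
-- of h is a multiple of F, h is squarefree and r is a unit.
--  ∙ p ∣ b: F is Eisenstein at p, and h = x.
--  ∙ p ∣ m: F ≡ x^(nk) + b mod p².  If q is the p-part of nk, then h = x^(nk/q) + b and
--    r ≡ - ((-b)^q + b) / p; for q > 1 this vanishes mod p exactly if p² ∣ (-b)^p + b,
--    which is the Wieferich condition.
--  ∙ p ∤ bm: F is, up to m^(2n), a polynomial P in z = m²x^k with
--    (z - 1) P = z^(n+1) - (1 - a) z^n - a, a = b m^(2n).  The derivation x d/dx, for which
--    z is an eigenvector, turns the right side into k z^n L with L = (n+1) z - n (1 - a).
--    L has a single root, so the only possible multiple root of P in z is that of L; it is
--    at most double, and if it is not z = 1 then the value of P there is, up to powers of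
--    n + 1, equal to (1 + n a) 𝒟.  Now use p² ∤ 𝒟.
-- F is irreducible, being Eisenstein at a prime divisor of b.
-- Conversely, if p² ∣ (-b)^p + b for some p ∣ m and p ∣ nk, the element u(θ) / p
-- is integral but not in ℤ[θ].
module Submission where

open import Algebra.Bundles using (CommutativeRing; RawRing)
import Algebra.Properties.CommutativeSemigroup as CommutativeSemigroupProperties
import Algebra.Properties.CommutativeSemigroup.Divisibility as SemigroupDivisibility
import Algebra.Properties.CommutativeSemiring.Binomial as BinomialTheorem
import Algebra.Properties.CommutativeSemiring.Exp as Exponentiation
import Algebra.Properties.Group as GroupProperties
import Algebra.Properties.Ring as RingProperties
import Algebra.Properties.Semiring.Divisibility as SemiringDivisibility
import Algebra.Properties.Semiring.Exp as SemiringExp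
import Algebra.Properties.Semiring.Mult as Multiples
import Algebra.Properties.Semiring.Mult.TCOptimised as NaturalMultiples
import Algebra.Properties.Semiring.Sum as Sums
import Algebra.Definitions.RawMagma as RawMagmaDefinitions
import Algebra.Definitions.RawSemiring as RawSemiringDefinitions
open import Data.Bool.Base using (Bool; true; false; if_then_else_)
open import Data.Empty using (⊥)
open import Data.Fin.Base as Fin using (Fin; toℕ)
import Data.Fin.Properties as FinP
open import Data.Integer.Base as ℤ using (ℤ; +_; -[1+_]; _⊖_; 0ℤ; 1ℤ; ∣_∣)
import Data.Integer.Divisibility.Signed as ℤDivS
import Data.Integer.Properties as ℤP
open import Data.List.Base as List using (List; []; _∷_)
import Data.List.Properties as ListP
open import Data.List.Membership.Propositional.Properties using (∈-filter⁺; ∈-upTo⁺)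
open import Data.List.Relation.Unary.All as All using (All; []; _∷_)
open import Data.List.Relation.Unary.All.Properties using (all-filter)
open import Data.List.Relation.Unary.AllPairs.Core using ([]; _∷_)
open import Data.List.Relation.Unary.Unique.Propositional using (Unique)
open import Data.List.Relation.Unary.Unique.Propositional.Properties using (filter⁺; upTo⁺)
open import Data.Nat.Base as ℕ using (ℕ; zero; suc; z≤n; s≤s; _∸_)
import Data.Nat.Combinatorics as Combinatorics
import Data.Nat.Coprimality as Coprimality
import Data.Nat.Divisibility as ℕDiv
import Data.Nat.DivMod as ℕDivMod
import Data.Nat.GCD as GCD
import Data.Nat.Induction as ℕInduction
open import Data.Nat.ListAction using (product)
open import Data.Nat.ListAction.Properties using (∈⇒∣product)
open import Data.Nat.Primality using (Prime; prime?; euclidsLemma; prime⇒nonZero; prime⇒nonTrivial; prime⇒irreducible; ¬prime[1])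
open import Data.Nat.Primality.Factorisation using (factorise; PrimeFactorisation)
import Data.Nat.Properties as ℕP
open import Data.Product.Base using (∃-syntax; _×_; _,_; proj₁; proj₂)
open import Data.Rational.Base as ℚ using (ℚ)
import Data.Rational.Properties as ℚP
open import Data.Rational.Unnormalised.Base as ℚᵘ using (ℚᵘ; mkℚᵘ; *≡*)
import Data.Rational.Unnormalised.Properties as ℚᵘP
open import Data.Sum.Base as Sum using (_⊎_; inj₁; inj₂; [_,_]′)
open import Data.Vec.Base as Vec using (Vec; []; _∷_)
open import Function.Base using (_∘_; id)
open import Function.Bundles using (_⇔_; mk⇔)
open import Level using (0ℓ)
import Relation.Binary.Reflection as Reflection
open import Relation.Binary.PropositionalEquality as ≡ using (_≡_; _≢_)
open import Relation.Nullary using (¬_; Dec; yes; no; contradiction)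
open import Relation.Nullary.Decidable as Dec using (_×-dec_)
open import Defs

-- Dedekind's criterion is phrased through almost integrality because that condition speaks only of
-- divisibility in ℤ[θ]: overorders, norms and field discriminants never enter. The rings ℤ[x],
-- ℤ[x]/(F) and 𝔽_p[x] share one carrier and differ only in their equality. That p divides a modulo
-- F and that F divides a modulo p both mean a ∈ (p, F), so everything the criterion asks is checked
-- in 𝔽_p[x]. A coefficient list over ℤ does not show its degree modulo p. Hence coprimality always
-- means an explicit Bézout identity, gcds are computed from the constant term upwards, and
-- squarefreeness is coprimality to the derivative instead of a statement about irreducible factors.
-- The derivation x d/dx loses nothing here: away from the primes dividing b, the constant term b
-- makes x invertible modulo F. The sign in (-b)^p + b unites the two conditions of the theorem: for
-- odd p not dividing b, p² divides it exactly when p is a Wieferich prime, and for p = 2 and b odd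
-- exactly when b ≡ 3 mod 4.

module RingKit (R : CommutativeRing 0ℓ 0ℓ) where

  open CommutativeRing R public hiding (_-_)
  open SemiringExp semiring public
  open Exponentiation commutativeSemiring public using (^-distrib-*)
  open SemiringDivisibility semiring public using (∣ʳ-refl; _∣0; 0∣x⇒x≈0)
  open SemigroupDivisibility *-commutativeSemigroup public
    using (_∣_; _,_; ∣ʳ-trans; ∣ʳ-respʳ-≈; ∣ʳ-respˡ-≈; ∙-cong-∣; x∣ʳy⇒x∣ʳzy)
  open RingProperties ring public using (-‿distribˡ-*; -‿distribʳ-*; -0#≈0#; -‿involutive)
  open import Relation.Binary.Reasoning.Setoid setoid public
  private
    module N = NaturalMultiples semiring
    module G = GroupProperties +-group
  open N using () renaming (_×_ to _·_)

  -- With these optimised multiples `ι 0ℤ` and `ι 1ℤ` reduce to `0#` and `1#`, so `con 0ℤ` and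
  -- `con 1ℤ` in solver calls match the ring constants definitionally.
  ι : ℤ → Carrier
  ι (+ n)    = n · 1#
  ι -[1+ n ] = - (suc n · 1#)

  private
    0+ : ∀ n → suc n · 1# ≈ 1# + n · 1#
    0+ n = N.×-homo-+ 1# 1 n

    cancel : ∀ a b c → (c + a) + - (c + b) ≈ a + - b
    cancel a b c = begin
      (c + a) + - (c + b)       ≈⟨ +-cong (+-comm c a) (G.⁻¹-anti-homo-∙ c b) ⟩
      (a + c) + (- b + - c)     ≈⟨ +-congˡ (+-comm (- b) (- c)) ⟩
      (a + c) + (- c + - b)     ≈⟨ +-assoc a c _ ⟩
      a + (c + (- c + - b))     ≈⟨ +-congˡ (+-assoc c (- c) (- b)) ⟨
      a + ((c + - c) + - b)     ≈⟨ +-congˡ (+-congʳ (-‿inverseʳ c)) ⟩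
      a + (0# + - b)            ≈⟨ +-congˡ (+-identityˡ (- b)) ⟩
      a + - b                   ∎

    ι-⊖ : ∀ m n → ι (m ⊖ n) ≈ m · 1# + - (n · 1#)
    ι-⊖ zero    zero    = sym (-‿inverseʳ 0#)
    ι-⊖ zero    (suc n) = sym (+-identityˡ _)
    ι-⊖ (suc m) zero    = sym (trans (+-congˡ -0#≈0#) (+-identityʳ _))
    ι-⊖ (suc m) (suc n) = begin
      ι (suc m ⊖ suc n)                        ≡⟨ ≡.cong ι (ℤP.[1+m]⊖[1+n]≡m⊖n m n) ⟩
      ι (m ⊖ n)                                ≈⟨ ι-⊖ m n ⟩
      m · 1# + - (n · 1#)                      ≈⟨ cancel _ _ 1# ⟨
      (1# + m · 1#) + - (1# + n · 1#)          ≈⟨ +-cong (0+ m) (-‿cong (0+ n)) ⟨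
      suc m · 1# + - (suc n · 1#)              ∎

  ι-neg : ∀ x → ι (ℤ.- x) ≈ - ι x
  ι-neg (+ zero)  = sym -0#≈0#
  ι-neg (+ suc n) = refl
  ι-neg -[1+ n ]  = sym (-‿involutive _)

  ι-+ : ∀ x y → ι (x ℤ.+ y) ≈ ι x + ι y
  ι-+ (+ m)    (+ n)    = N.×-homo-+ 1# m n
  ι-+ (+ m)    -[1+ n ] = ι-⊖ m (suc n)
  ι-+ -[1+ m ] (+ n)    = trans (ι-⊖ n (suc m)) (+-comm _ _)
  ι-+ -[1+ m ] -[1+ n ] = begin
    - (suc (suc (m ℕ.+ n)) · 1#)           ≡⟨ ≡.cong (λ z → - (suc z · 1#)) (ℕP.+-suc m n) ⟨
    - ((suc m ℕ.+ suc n) · 1#)             ≈⟨ -‿cong (N.×-homo-+ 1# (suc m) (suc n)) ⟩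
    - (suc m · 1# + suc n · 1#)            ≈⟨ G.⁻¹-anti-homo-∙ _ _ ⟩
    - (suc n · 1#) + - (suc m · 1#)        ≈⟨ +-comm _ _ ⟩
    - (suc m · 1#) + - (suc n · 1#)        ∎

  private
    ι-*-nonneg : ∀ m y → ι (+ m ℤ.* y) ≈ ι (+ m) * ι y
    ι-*-nonneg m (+ n)    = trans (reflexive (≡.cong ι (≡.sym (ℤP.pos-* m n)))) (N.×1-homo-* m n)
    ι-*-nonneg m -[1+ n ] = begin
      ι (+ m ℤ.* -[1+ n ])          ≡⟨ ≡.cong ι (ℤP.neg-distribʳ-* (+ m) (+ suc n)) ⟨
      ι (ℤ.- (+ m ℤ.* + suc n))     ≈⟨ ι-neg (+ m ℤ.* + suc n) ⟩
      - ι (+ m ℤ.* + suc n)         ≈⟨ -‿cong (ι-*-nonneg m (+ suc n)) ⟩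
      - (ι (+ m) * ι (+ suc n))     ≈⟨ -‿distribʳ-* _ _ ⟩
      ι (+ m) * - ι (+ suc n)       ∎

  ι-* : ∀ x y → ι (x ℤ.* y) ≈ ι x * ι y
  ι-* (+ m)    y = ι-*-nonneg m y
  ι-* -[1+ m ] y = begin
    ι (-[1+ m ] ℤ.* y)           ≡⟨ ≡.cong ι (ℤP.neg-distribˡ-* (+ suc m) y) ⟨
    ι (ℤ.- (+ suc m ℤ.* y))      ≈⟨ ι-neg (+ suc m ℤ.* y) ⟩
    - ι (+ suc m ℤ.* y)          ≈⟨ -‿cong (ι-*-nonneg (suc m) y) ⟩
    - (ι (+ suc m) * ι y)        ≈⟨ -‿distribˡ-* _ _ ⟩
    - ι (+ suc m) * ι y          ∎

  -- A normalising solver for identities in commutative rings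

  infixl 6 _:+_ _:-_
  infixl 7 _:*_
  infix 8 :-_
  infixr 9 _:^_
  data Expr (n : ℕ) : Set where
    var       : Fin n → Expr n
    con       : ℤ → Expr n
    _:+_ _:*_ : Expr n → Expr n → Expr n
    :-_       : Expr n → Expr n
    _:^_      : Expr n → ℕ → Expr n

  _:-_ : ∀ {n} → Expr n → Expr n → Expr n
  e :- f = e :+ :- f

  private
    Monomial : Set
    Monomial = List ℕ

    -- Kept sorted by `_<ᴹ_`, with like terms merged and zero coefficients dropped. The coefficients
    -- are integers, so cancellation is decided even where equality in the ring is not.
    Normal : Set
    Normal = List (Monomial × ℤ)

    infixl 7 _⊗_ _⊠_
    _⊗_ : Monomial → Monomial → Monomial
    []       ⊗ f       = f
    (i ∷ e)  ⊗ []      = i ∷ e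
    (i ∷ e)  ⊗ (j ∷ f) = i ℕ.+ j ∷ e ⊗ f

    _<ᴹ_ : Monomial → Monomial → Bool
    []      <ᴹ []      = false
    []      <ᴹ (_ ∷ _) = true
    (_ ∷ _) <ᴹ []      = false
    (i ∷ e) <ᴹ (j ∷ f) = if i ℕ.<ᵇ j then true else (if j ℕ.<ᵇ i then false else e <ᴹ f)

    insert : Monomial → ℤ → Normal → Normal
    insert e c [] = (e , c) ∷ []
    insert e c ((f , d) ∷ p) with ListP.≡-dec ℕP._≟_ e f
    ... | no _ = if e <ᴹ f then (e , c) ∷ (f , d) ∷ p else (f , d) ∷ insert e c p
    ... | yes _ with c ℤ.+ d ℤP.≟ 0ℤ
    ...   | yes _ = p
    ...   | no  _ = (f , c ℤ.+ d) ∷ p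

    infixl 6 _⊞_
    _⊞_ : Normal → Normal → Normal
    []            ⊞ q = q
    ((e , c) ∷ p) ⊞ q = insert e c (p ⊞ q)

    scale : Monomial → ℤ → Normal → Normal
    scale e c []            = []
    scale e c ((f , d) ∷ p) = insert (e ⊗ f) (c ℤ.* d) (scale e c p)

    _⊠_ : Normal → Normal → Normal
    []            ⊠ q = []
    ((e , c) ∷ p) ⊠ q = scale e c q ⊞ p ⊠ q

    constant : ℤ → Normal
    constant c with c ℤP.≟ 0ℤ
    ... | yes _ = []
    ... | no  _ = ([] , c) ∷ []

    _⊠^_ : Normal → ℕ → Normal
    p ⊠^ zero  = constant 1ℤ
    p ⊠^ suc n = p ⊠ (p ⊠^ n)

    normalise : ∀ {n} → Expr n → Normal
    normalise (var i)  = (List.replicate (toℕ i) 0 List.++ (1 ∷ []) , 1ℤ) ∷ []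
    normalise (con c)  = constant c
    normalise (e :+ f) = normalise e ⊞ normalise f
    normalise (e :* f) = normalise e ⊠ normalise f
    normalise (:- e)   = scale [] ℤ.-1ℤ (normalise e)
    normalise (e :^ n) = normalise e ⊠^ n

    ⟦_⟧ᴹ : ∀ {n} → Monomial → Vec Carrier n → Carrier
    ⟦ []    ⟧ᴹ ρ       = 1#
    -- A monomial longer than the environment never comes out of `normalise`; the value `1#` keeps
    -- the interpretation multiplicative.
    ⟦ i ∷ e ⟧ᴹ []      = 1#
    ⟦ i ∷ e ⟧ᴹ (x ∷ ρ) = x ^ i * ⟦ e ⟧ᴹ ρ

    ⟦_⟧ᴺ : ∀ {n} → Normal → Vec Carrier n → Carrier
    ⟦ []          ⟧ᴺ ρ = 0#
    ⟦ (e , c) ∷ p ⟧ᴺ ρ = ι c * ⟦ e ⟧ᴹ ρ + ⟦ p ⟧ᴺ ρ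

    ⟦_⟧ : ∀ {n} → Expr n → Vec Carrier n → Carrier
    ⟦ var i  ⟧ ρ = Vec.lookup ρ i
    ⟦ con c  ⟧ ρ = ι c
    ⟦ e :+ f ⟧ ρ = ⟦ e ⟧ ρ + ⟦ f ⟧ ρ
    ⟦ e :* f ⟧ ρ = ⟦ e ⟧ ρ * ⟦ f ⟧ ρ
    ⟦ :- e   ⟧ ρ = - ⟦ e ⟧ ρ
    ⟦ e :^ n ⟧ ρ = ⟦ e ⟧ ρ ^ n

    open CommutativeSemigroupProperties *-commutativeSemigroup using () renaming (interchange to *-interchange)
    open CommutativeSemigroupProperties +-commutativeSemigroup using () renaming (x∙yz≈y∙xz to x+[y+z]≈y+[x+z])

    ⊗-correct : ∀ {n} e f (ρ : Vec Carrier n) → ⟦ e ⊗ f ⟧ᴹ ρ ≈ ⟦ e ⟧ᴹ ρ * ⟦ f ⟧ᴹ ρ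
    ⊗-correct []      f       ρ       = sym (*-identityˡ _)
    ⊗-correct (i ∷ e) []      ρ       = sym (*-identityʳ _)
    ⊗-correct (i ∷ e) (j ∷ f) []      = sym (*-identityʳ _)
    ⊗-correct (i ∷ e) (j ∷ f) (x ∷ ρ) =
      trans (*-cong (^-homo-* x i j) (⊗-correct e f ρ)) (*-interchange _ _ _ _)

    insert-correct : ∀ {n} e c p (ρ : Vec Carrier n) → ⟦ insert e c p ⟧ᴺ ρ ≈ ι c * ⟦ e ⟧ᴹ ρ + ⟦ p ⟧ᴺ ρ
    insert-correct e c [] ρ = refl
    insert-correct e c ((f , d) ∷ p) ρ with ListP.≡-dec ℕP._≟_ e f
    ... | no _ with e <ᴹ f
    ...   | true  = refl
    ...   | false = trans (+-congˡ (insert-correct e c p ρ)) (x+[y+z]≈y+[x+z] _ _ _)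
    insert-correct e c ((f , d) ∷ p) ρ | yes ≡.refl with c ℤ.+ d ℤP.≟ 0ℤ
    ...   | no _     = trans (+-congʳ (trans (*-congʳ (ι-+ c d)) (distribʳ _ _ _))) (+-assoc _ _ _)
    ...   | yes c+d≡0 = sym (trans (sym (+-assoc _ _ _)) (trans (+-congʳ (trans (sym (distribʳ _ _ _))
      (trans (*-congʳ (trans (sym (ι-+ c d)) (reflexive (≡.cong ι c+d≡0)))) (zeroˡ _)))) (+-identityˡ _)))

    ⊞-correct : ∀ {n} p q (ρ : Vec Carrier n) → ⟦ p ⊞ q ⟧ᴺ ρ ≈ ⟦ p ⟧ᴺ ρ + ⟦ q ⟧ᴺ ρ
    ⊞-correct []            q ρ = sym (+-identityˡ _)
    ⊞-correct ((e , c) ∷ p) q ρ =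
      trans (insert-correct e c (p ⊞ q) ρ) (trans (+-congˡ (⊞-correct p q ρ)) (sym (+-assoc _ _ _)))

    scale-correct : ∀ {n} e c p (ρ : Vec Carrier n) → ⟦ scale e c p ⟧ᴺ ρ ≈ (ι c * ⟦ e ⟧ᴹ ρ) * ⟦ p ⟧ᴺ ρ
    scale-correct e c []            ρ = sym (zeroʳ _)
    scale-correct e c ((f , d) ∷ p) ρ = trans (insert-correct (e ⊗ f) (c ℤ.* d) (scale e c p) ρ) (trans
      (+-cong (trans (*-cong (ι-* c d) (⊗-correct e f ρ)) (*-interchange _ _ _ _)) (scale-correct e c p ρ))
      (sym (distribˡ _ _ _)))

    ⊠-correct : ∀ {n} p q (ρ : Vec Carrier n) → ⟦ p ⊠ q ⟧ᴺ ρ ≈ ⟦ p ⟧ᴺ ρ * ⟦ q ⟧ᴺ ρ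
    ⊠-correct []            q ρ = sym (zeroˡ _)
    ⊠-correct ((e , c) ∷ p) q ρ = trans (⊞-correct (scale e c q) (p ⊠ q) ρ)
      (trans (+-cong (scale-correct e c q ρ) (⊠-correct p q ρ)) (sym (distribʳ _ _ _)))

    constant-correct : ∀ {n} c (ρ : Vec Carrier n) → ⟦ constant c ⟧ᴺ ρ ≈ ι c
    constant-correct c ρ with c ℤP.≟ 0ℤ
    ... | yes ≡.refl = refl
    ... | no  _      = trans (+-identityʳ _) (*-identityʳ _)

    ⊠^-correct : ∀ {n} p i (ρ : Vec Carrier n) → ⟦ p ⊠^ i ⟧ᴺ ρ ≈ ⟦ p ⟧ᴺ ρ ^ i
    ⊠^-correct p zero    ρ = constant-correct 1ℤ ρ
    ⊠^-correct p (suc i) ρ = trans (⊠-correct p (p ⊠^ i) ρ) (*-congˡ (⊠^-correct p i ρ))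

    var-correct : ∀ {n} (i : Fin n) ρ → ⟦ List.replicate (toℕ i) 0 List.++ (1 ∷ []) ⟧ᴹ ρ ≈ Vec.lookup ρ i
    var-correct Fin.zero    (x ∷ ρ) = trans (*-identityʳ _) (*-identityʳ x)
    var-correct (Fin.suc i) (x ∷ ρ) = trans (*-identityˡ _) (var-correct i ρ)

    correct : ∀ {n} (e : Expr n) ρ → ⟦ normalise e ⟧ᴺ ρ ≈ ⟦ e ⟧ ρ
    correct (var i)  ρ = trans (+-identityʳ _) (trans (*-identityˡ _) (var-correct i ρ))
    correct (con c)  ρ = constant-correct c ρ
    correct (e :+ f) ρ = trans (⊞-correct (normalise e) (normalise f) ρ) (+-cong (correct e ρ) (correct f ρ))
    correct (e :* f) ρ = trans (⊠-correct (normalise e) (normalise f) ρ) (*-cong (correct e ρ) (correct f ρ))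
    correct (:- e)   ρ = trans (scale-correct [] ℤ.-1ℤ (normalise e) ρ)
      (trans (*-congʳ (*-identityʳ _)) (trans (sym (-‿distribˡ-* 1# _)) (-‿cong (trans (*-identityˡ _) (correct e ρ)))))
    correct (e :^ n) ρ = trans (⊠^-correct (normalise e) n ρ) (^-congˡ n (correct e ρ))

  open Reflection setoid var ⟦_⟧ (λ e → ⟦ normalise e ⟧ᴺ) correct public using (solve)
    renaming (_⊜_ to _:=_)

  -- Linear deductions, divisibility and Bézout coprimality

  x-y≈0⇒x≈y : ∀ {x y} → x + - y ≈ 0# → x ≈ y
  x-y≈0⇒x≈y {x} {y} e = begin
    x               ≈⟨ solve 2 (λ x y → x := (x :+ :- y) :+ y) refl x y ⟩
    (x + - y) + y   ≈⟨ +-congʳ e ⟩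
    0# + y          ≈⟨ +-identityˡ y ⟩
    y               ∎

  +-cancel : ∀ {x y c d} → x + c ≈ y + d → c ≈ d → x ≈ y
  +-cancel {x} {y} {c} {d} e c≈d = begin
    x               ≈⟨ solve 2 (λ x c → x := (x :+ c) :+ :- c) refl x c ⟩
    (x + c) + - c   ≈⟨ +-cong e (-‿cong c≈d) ⟩
    (y + d) + - d   ≈⟨ solve 2 (λ x c → (x :+ c) :+ :- c := x) refl y d ⟩
    y               ∎

  -- To deduce l ≈ r from equations aᵢ ≈ bᵢ it suffices to give multipliers kᵢ
  -- and check the ring identity l + Σ kᵢ bᵢ ≈ r + Σ kᵢ aᵢ.
  lin₁ : ∀ {a b l r} k → a ≈ b → l + k * b ≈ r + k * a → l ≈ r
  lin₁ k e s = +-cancel s (*-congˡ (sym e))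

  lin₂ : ∀ {a b c d l r} j k → a ≈ b → c ≈ d →
         l + (j * b + k * d) ≈ r + (j * a + k * c) → l ≈ r
  lin₂ j k e f s = +-cancel s (+-cong (*-congˡ (sym e)) (*-congˡ (sym f)))

  lin₃ : ∀ {a b c d a′ b′ l r} i j k → a ≈ b → c ≈ d → a′ ≈ b′ →
         l + (i * b + (j * d + k * b′)) ≈ r + (i * a + (j * c + k * a′)) → l ≈ r
  lin₃ i j k e f g s =
    +-cancel s (+-cong (*-congˡ (sym e)) (+-cong (*-congˡ (sym f)) (*-congˡ (sym g))))

  ∣⇒∃ : ∀ {x y} → x ∣ y → ∃[ q ] q * x ≈ y
  ∣⇒∃ (q , e) = q , e

  ≈⇒∣ : ∀ {x y} → x ≈ y → x ∣ y
  ≈⇒∣ e = 1# , trans (*-identityˡ _) e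

  x∣x*y : ∀ x y → x ∣ x * y
  x∣x*y x y = y , *-comm y x

  ∣-*ˡ : ∀ {x y} z → x ∣ y → x ∣ z * y
  ∣-*ˡ z x∣y = x∣ʳy⇒x∣ʳzy z x∣y

  ∣-*ʳ : ∀ {x y} z → x ∣ y → x ∣ y * z
  ∣-*ʳ {x} {y} z x∣y = ∣ʳ-respʳ-≈ (*-comm z y) (∣-*ˡ z x∣y)

  ∣-+ : ∀ {x y z} → x ∣ y → x ∣ z → x ∣ y + z
  ∣-+ {x} (q , e) (r , f) = q + r , trans (distribʳ x q r) (+-cong e f)

  ∣-neg : ∀ {x y} → x ∣ y → x ∣ - y
  ∣-neg {x} (q , e) = - q , trans (sym (-‿distribˡ-* q x)) (-‿cong e)

  ∣-swap : ∀ {x} y z → x ∣ y + - z → x ∣ z + - y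
  ∣-swap y z d = ∣ʳ-respʳ-≈ (solve 2 (λ y z → :- (y :+ :- z) := z :+ :- y) refl y z) (∣-neg d)

  ^-mono-∣ : ∀ x {i j} → i ℕ.≤ j → x ^ i ∣ x ^ j
  ^-mono-∣ x {i} {j} i≤j = x ^ (j ∸ i) ,
    trans (sym (^-homo-* x (j ∸ i) i)) (reflexive (≡.cong (x ^_) (ℕP.m∸n+n≡m i≤j)))

  NonZeroDivisor : Carrier → Set
  NonZeroDivisor a = ∀ x → a * x ≈ 0# → x ≈ 0#

  cancelˡ : ∀ {a x y} → NonZeroDivisor a → a * x ≈ a * y → x ≈ y
  cancelˡ {a} {x} {y} nz e = x-y≈0⇒x≈y (nz (x + - y) (lin₁ 1# e
    (solve 3 (λ a x y → a :* (x :+ :- y) :+ con 1ℤ :* (a :* y) := con 0ℤ :+ con 1ℤ :* (a :* x)) refl a x y)))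

  nonZeroDivisor-∣ : ∀ {a c} → a ∣ c → NonZeroDivisor c → NonZeroDivisor a
  nonZeroDivisor-∣ {a} {c} (q , e) nz x ax≈0 = nz x (begin
    c * x         ≈⟨ *-congʳ e ⟨
    (q * a) * x   ≈⟨ *-assoc q a x ⟩
    q * (a * x)   ≈⟨ *-congˡ ax≈0 ⟩
    q * 0#        ≈⟨ zeroʳ q ⟩
    0#            ∎)

  nonZeroDivisor-^ : ∀ {a} → NonZeroDivisor a → ∀ n → NonZeroDivisor (a ^ n)
  nonZeroDivisor-^ nz zero    x e = trans (sym (*-identityˡ x)) e
  nonZeroDivisor-^ nz (suc n) x e = nonZeroDivisor-^ nz n x (nz _ (trans (sym (*-assoc _ _ x)) e))

  Coprime : Carrier → Carrier → Set
  Coprime x y = ∃[ u ] ∃[ v ] u * x + v * y ≈ 1#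

  coprime-sym : ∀ {x y} → Coprime x y → Coprime y x
  coprime-sym (u , v , e) = v , u , trans (+-comm _ _) e

  coprime-resp : ∀ {x y x′ y′} → x ≈ x′ → y ≈ y′ → Coprime x y → Coprime x′ y′
  coprime-resp e f (u , v , g) = u , v , trans (+-cong (*-congˡ (sym e)) (*-congˡ (sym f))) g

  coprime-∣ʳ : ∀ {x y z} → z ∣ y → Coprime x y → Coprime x z
  coprime-∣ʳ {x} {y} {z} (q , e) (u , v , f) = u , v * q , (begin
    u * x + v * q * z      ≈⟨ +-congˡ (*-assoc v q z) ⟩
    u * x + v * (q * z)    ≈⟨ +-congˡ (*-congˡ e) ⟩
    u * x + v * y          ≈⟨ f ⟩
    1#                     ∎)

  coprime-*ʳ : ∀ {x y z} → Coprime x y → Coprime x z → Coprime x (y * z)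
  coprime-*ʳ {x} {y} {z} (u , v , e) (u′ , v′ , f) =
    u * (u′ * x + v′ * z) + v * y * u′ , v * v′ , trans
      (solve 7 (λ x y z u v u′ v′ →
        (u :* (u′ :* x :+ v′ :* z) :+ v :* y :* u′) :* x :+ v :* v′ :* (y :* z)
          := (u :* x :+ v :* y) :* (u′ :* x :+ v′ :* z)) refl x y z u v u′ v′)
      (trans (*-cong e f) (*-identityˡ 1#))

  coprime-1 : ∀ x → Coprime x 1#
  coprime-1 x = 0# , 1# , trans (+-cong (zeroˡ x) (*-identityˡ 1#)) (+-identityˡ 1#)

  coprime-^ʳ : ∀ {x y} n → Coprime x y → Coprime x (y ^ n)
  coprime-^ʳ zero    c = coprime-1 _
  coprime-^ʳ (suc n) c = coprime-*ʳ c (coprime-^ʳ n c)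

  coprime-^ˡ : ∀ {x y} n → Coprime x y → Coprime (x ^ n) y
  coprime-^ˡ n c = coprime-sym (coprime-^ʳ n (coprime-sym c))

  coprime-mod : ∀ {x y y′} → x ∣ y + - y′ → Coprime x y → Coprime x y′
  coprime-mod {x} {y} {y′} (q , e) (u , v , f) = u + v * q , v , lin₂ v 1# e f
    (solve 6 (λ x y y′ q u v →
      ((u :+ v :* q) :* x :+ v :* y′) :+ (v :* (y :+ :- y′) :+ con 1ℤ :* con 1ℤ)
        := con 1ℤ :+ (v :* (q :* x) :+ con 1ℤ :* (u :* x :+ v :* y))) refl x y y′ q u v)

  coprime-unit : ∀ {x y} → y ∣ 1# → Coprime x y
  coprime-unit (q , e) = 0# , q , trans (+-cong (zeroˡ _) e) (+-identityˡ 1#)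

  coprime⇒∣ : ∀ {x y z} → Coprime x y → x ∣ y * z → x ∣ z
  coprime⇒∣ {x} {y} {z} (u , v , e) (q , f) = u * z + v * q , lin₂ v z f e
    (solve 6 (λ x y z q u v →
      ((u :* z :+ v :* q) :* x) :+ (v :* (y :* z) :+ z :* con 1ℤ)
        := z :+ (v :* (q :* x) :+ z :* (u :* x :+ v :* y))) refl x y z q u v)

  -- Modulo x the identity reads u y ≡ g, so y inherits invertibility from g. An explicit
  -- combination thus certifies coprimality as soon as its value is known to be harmless.
  coprime-solve : ∀ {x y g} u v → Coprime x g → u * y + v * x ≈ g → Coprime x y
  coprime-solve {x} {y} {g} u v c e = coprime-∣ʳ (u , refl) (coprime-mod
    (v , lin₁ 1# e (solve 5 (λ u v x y g → v :* x :+ con 1ℤ :* g := (g :+ :- (u :* y)) :+ con 1ℤ :* (u :* y :+ v :* x)) refl u v x y g)) c)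

  unit-* : ∀ {x y} → x ∣ 1# → y ∣ 1# → x * y ∣ 1#
  unit-* d e = ∣ʳ-respʳ-≈ (*-identityˡ 1#) (∙-cong-∣ d e)

  -- In a Bézout domain this is the decomposition f = gcd f g · f₁, g = gcd f g · g₁.
  CoprimeCofactors : Carrier → Carrier → Set
  CoprimeCofactors f g = ∃[ d ] ∃[ f₁ ] ∃[ g₁ ] f ≈ d * f₁ × g ≈ d * g₁ × Coprime f₁ g₁

  coprimeCofactors-sym : ∀ {f g} → CoprimeCofactors f g → CoprimeCofactors g f
  coprimeCofactors-sym (d , f₁ , g₁ , ef , eg , c) = d , g₁ , f₁ , eg , ef , coprime-sym c

  coprimeCofactors-0 : ∀ f → CoprimeCofactors f 0#
  coprimeCofactors-0 f = f , 1# , 0# , sym (*-identityʳ f) , sym (zeroʳ f) , coprime-sym (coprime-1 0#)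

  -- One Euclidean step: since x is invertible modulo f, passing from e to c f + x e changes neither
  -- the common factor d nor the coprimality of the cofactors.
  coprimeCofactors-step : ∀ {f e g x} c → Coprime f x → g ≈ c * f + x * e →
                          CoprimeCofactors f e → CoprimeCofactors f g
  coprimeCofactors-step {f} {e} {g} {x} c f⊥x eg (d , f₁ , e₁ , ef , ee , f₁⊥e₁) =
    d , f₁ , c * f₁ + x * e₁ , ef ,
    (begin
      g                             ≈⟨ eg ⟩
      c * f + x * e                 ≈⟨ +-cong (*-congˡ ef) (*-congˡ ee) ⟩
      c * (d * f₁) + x * (d * e₁)   ≈⟨ solve 5 (λ c d f x e → c :* (d :* f) :+ x :* (d :* e) := d :* (c :* f :+ x :* e)) refl c d f₁ x e₁ ⟩
      d * (c * f₁ + x * e₁)         ∎) ,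
    coprime-mod (- c , solve 4 (λ c f x e → :- c :* f := x :* e :+ :- (c :* f :+ x :* e)) refl c f₁ x e₁)
      (coprime-*ʳ (coprime-sym (coprime-∣ʳ (d , sym ef) (coprime-sym f⊥x))) f₁⊥e₁)


module Quotient (R : CommutativeRing 0ℓ 0ℓ) (a : CommutativeRing.Carrier R) where
  open RingKit R

  -- A record rather than a synonym, so that x and y can be inferred.
  infix 4 _≈/_
  record _≈/_ (x y : Carrier) : Set where
    constructor mod
    field difference : a ∣ (x + - y)
  open _≈/_ public

  ≈⇒≈/ : ∀ {x y} → x ≈ y → x ≈/ y
  ≈⇒≈/ {x} {y} e = mod (0# , sym (trans (+-congʳ e) (trans (-‿inverseʳ y) (sym (zeroˡ a)))))

  ≈/-sym : ∀ {x y} → x ≈/ y → y ≈/ x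
  ≈/-sym {x} {y} (mod d) = mod (∣-swap x y d)

  ≈/-trans : ∀ {x y z} → x ≈/ y → y ≈/ z → x ≈/ z
  ≈/-trans {x} {y} {z} (mod d) (mod e) =
    mod (∣ʳ-respʳ-≈ (solve 3 (λ x y z → (x :+ :- y) :+ (y :+ :- z) := x :+ :- z) refl x y z) (∣-+ d e))

  +-cong/ : ∀ {x y u v} → x ≈/ y → u ≈/ v → x + u ≈/ y + v
  +-cong/ {x} {y} {u} {v} (mod d) (mod e) =
    mod (∣ʳ-respʳ-≈ (solve 4 (λ x y u v → (x :+ :- y) :+ (u :+ :- v) := (x :+ u) :+ :- (y :+ v)) refl x y u v) (∣-+ d e))

  *-cong/ : ∀ {x y u v} → x ≈/ y → u ≈/ v → x * u ≈/ y * v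
  *-cong/ {x} {y} {u} {v} (mod d) (mod e) =
    mod (∣ʳ-respʳ-≈ (solve 4 (λ x y u v → u :* (x :+ :- y) :+ y :* (u :+ :- v) := x :* u :+ :- (y :* v)) refl x y u v)
      (∣-+ (∣-*ˡ u d) (∣-*ˡ y e)))

  neg-cong/ : ∀ {x y} → x ≈/ y → - x ≈/ - y
  neg-cong/ {x} {y} (mod d) =
    mod (∣ʳ-respʳ-≈ (solve 2 (λ x y → :- (x :+ :- y) := :- x :+ :- (:- y)) refl x y) (∣-neg d))

  ≈0⇒∣ : ∀ {x} → x ≈/ 0# → a ∣ x
  ≈0⇒∣ {x} (mod d) = ∣ʳ-respʳ-≈ (trans (+-congˡ -0#≈0#) (+-identityʳ x)) d

  ∣⇒≈0 : ∀ {x} → a ∣ x → x ≈/ 0#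
  ∣⇒≈0 {x} d = mod (∣ʳ-respʳ-≈ (sym (trans (+-congˡ -0#≈0#) (+-identityʳ x))) d)

  -- Only the equality is coarsened. Elements, polynomials and derivations therefore pass between a
  -- ring and its quotients without coercion.
  ring/ : CommutativeRing 0ℓ 0ℓ
  ring/ = record
    { Carrier = Carrier ; _≈_ = _≈/_ ; _+_ = _+_ ; _*_ = _*_ ; -_ = -_ ; 0# = 0# ; 1# = 1#
    ; isCommutativeRing = record
      { isRing = record
        { +-isAbelianGroup = record
          { isGroup = record
            { isMonoid = record
              { isSemigroup = record
                { isMagma = record
                  { isEquivalence = record { refl = ≈⇒≈/ refl ; sym = ≈/-sym ; trans = ≈/-trans }
                  ; ∙-cong = +-cong/ }
                ; assoc = λ x y z → ≈⇒≈/ (+-assoc x y z) }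
              ; identity = (λ x → ≈⇒≈/ (+-identityˡ x)) , (λ x → ≈⇒≈/ (+-identityʳ x)) }
            ; inverse = (λ x → ≈⇒≈/ (-‿inverseˡ x)) , (λ x → ≈⇒≈/ (-‿inverseʳ x))
            ; ⁻¹-cong = neg-cong/ }
          ; comm = λ x y → ≈⇒≈/ (+-comm x y) }
        ; *-cong = *-cong/
        ; *-assoc = λ x y z → ≈⇒≈/ (*-assoc x y z)
        ; *-identity = (λ x → ≈⇒≈/ (*-identityˡ x)) , (λ x → ≈⇒≈/ (*-identityʳ x))
        ; distrib = (λ x y z → ≈⇒≈/ (distribˡ x y z)) , (λ x y z → ≈⇒≈/ (distribʳ x y z)) }
      ; *-comm = λ x y → ≈⇒≈/ (*-comm x y) } }

-- The commutative ring of coefficient lists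

module PolynomialRing (A : CommutativeRing 0ℓ 0ℓ) where
  open Polynomial (CommutativeRing.rawRing A) public
  private
    module A = RingKit A

  -- Unlike the function type f ≈ₚ g, this record determines f and g.
  infix 4 _≋_
  record _≋_ (f g : Poly) : Set where
    constructor coeffwise
    field at : f ≈ₚ g
  open _≋_ public

  coeff-+ : ∀ f g i → coeff (f +ₚ g) i A.≈ coeff f i A.+ coeff g i
  coeff-+ []      g       i       = A.sym (A.+-identityˡ _)
  coeff-+ (a ∷ f) []      i       = A.sym (A.+-identityʳ _)
  coeff-+ (a ∷ f) (b ∷ g) zero    = A.refl
  coeff-+ (a ∷ f) (b ∷ g) (suc i) = coeff-+ f g i

  infixr 7 _∙ₚ_
  _∙ₚ_ : A.Carrier → Poly → Poly
  a ∙ₚ f = List.map (a A.*_) f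

  coeff-∙ : ∀ a f i → coeff (a ∙ₚ f) i A.≈ a A.* coeff f i
  coeff-∙ a []      i       = A.sym (A.zeroʳ a)
  coeff-∙ a (b ∷ f) zero    = A.refl
  coeff-∙ a (b ∷ f) (suc i) = coeff-∙ a f i

  infix 8 -ₚ_
  -ₚ_ : Poly → Poly
  -ₚ_ = List.map (A.-_)

  coeff-neg : ∀ f i → coeff (-ₚ f) i A.≈ A.- coeff f i
  coeff-neg []      i       = A.sym A.-0#≈0#
  coeff-neg (b ∷ f) zero    = A.refl
  coeff-neg (b ∷ f) (suc i) = coeff-neg f i

  ≋-refl : ∀ {f} → f ≋ f
  ≋-refl = coeffwise λ i → A.refl

  ≋-sym : ∀ {f g} → f ≋ g → g ≋ f
  ≋-sym e = coeffwise λ i → A.sym (at e i)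

  ≋-trans : ∀ {f g h} → f ≋ g → g ≋ h → f ≋ h
  ≋-trans e e′ = coeffwise λ i → A.trans (at e i) (at e′ i)

  tail-≈ : ∀ {a b f g} → (a ∷ f) ≋ (b ∷ g) → f ≋ g
  tail-≈ e = coeffwise λ i → at e (suc i)

  ∷-cong : ∀ {a b f g} → a A.≈ b → f ≋ g → (a ∷ f) ≋ (b ∷ g)
  ∷-cong e e′ = coeffwise λ { zero → e ; (suc i) → at e′ i }

  ∷-zero : ∀ {a f} → a A.≈ A.0# → f ≋ [] → (a ∷ f) ≋ []
  ∷-zero e e′ = coeffwise λ { zero → e ; (suc i) → at e′ i }

  +ₚ-cong : ∀ {f f′ g g′} → f ≋ f′ → g ≋ g′ → f +ₚ g ≋ f′ +ₚ g′
  +ₚ-cong {f} {f′} {g} {g′} e e′ = coeffwise λ i →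
    A.trans (coeff-+ f g i) (A.trans (A.+-cong (at e i) (at e′ i)) (A.sym (coeff-+ f′ g′ i)))

  +ₚ-assoc : ∀ f g h → (f +ₚ g) +ₚ h ≋ f +ₚ (g +ₚ h)
  +ₚ-assoc f g h = coeffwise λ i → begin
    coeff ((f +ₚ g) +ₚ h) i                         ≈⟨ coeff-+ (f +ₚ g) h i ⟩
    coeff (f +ₚ g) i A.+ coeff h i                  ≈⟨ A.+-congʳ (coeff-+ f g i) ⟩
    (coeff f i A.+ coeff g i) A.+ coeff h i         ≈⟨ A.+-assoc _ _ _ ⟩
    coeff f i A.+ (coeff g i A.+ coeff h i)         ≈⟨ A.+-congˡ (coeff-+ g h i) ⟨
    coeff f i A.+ coeff (g +ₚ h) i                  ≈⟨ coeff-+ f (g +ₚ h) i ⟨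
    coeff (f +ₚ (g +ₚ h)) i                         ∎
    where open A using (begin_; step-≈-⟩; step-≈-⟨; _∎)

  +ₚ-comm : ∀ f g → f +ₚ g ≋ g +ₚ f
  +ₚ-comm f g = coeffwise λ i → A.trans (coeff-+ f g i) (A.trans (A.+-comm _ _) (A.sym (coeff-+ g f i)))

  +ₚ-identityʳ : ∀ f → f +ₚ [] ≋ f
  +ₚ-identityʳ []      = ≋-refl
  +ₚ-identityʳ (a ∷ f) = ≋-refl

  -ₚ-inverseʳ : ∀ f → f +ₚ -ₚ f ≋ []
  -ₚ-inverseʳ f = coeffwise λ i → A.trans (coeff-+ f (-ₚ f) i) (A.trans (A.+-congˡ (coeff-neg f i)) (A.-‿inverseʳ _))

  -ₚ-cong : ∀ {f g} → f ≋ g → -ₚ f ≋ -ₚ g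
  -ₚ-cong {f} {g} e = coeffwise λ i → A.trans (coeff-neg f i) (A.trans (A.-‿cong (at e i)) (A.sym (coeff-neg g i)))

  ∙ₚ-cong : ∀ {a b f g} → a A.≈ b → f ≋ g → a ∙ₚ f ≋ b ∙ₚ g
  ∙ₚ-cong {a} {b} {f} {g} e e′ = coeffwise λ i →
    A.trans (coeff-∙ a f i) (A.trans (A.*-cong e (at e′ i)) (A.sym (coeff-∙ b g i)))

  +ₚ-interchange : ∀ f g h k → (f +ₚ g) +ₚ (h +ₚ k) ≋ (f +ₚ h) +ₚ (g +ₚ k)
  +ₚ-interchange f g h k = coeffwise λ i → begin
    coeff ((f +ₚ g) +ₚ (h +ₚ k)) i
      ≈⟨ A.trans (coeff-+ (f +ₚ g) (h +ₚ k) i) (A.+-cong (coeff-+ f g i) (coeff-+ h k i)) ⟩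
    (coeff f i A.+ coeff g i) A.+ (coeff h i A.+ coeff k i)
      ≈⟨ CommutativeSemigroupProperties.interchange A.+-commutativeSemigroup _ _ _ _ ⟩
    (coeff f i A.+ coeff h i) A.+ (coeff g i A.+ coeff k i)
      ≈⟨ A.trans (coeff-+ (f +ₚ h) (g +ₚ k) i) (A.+-cong (coeff-+ f h i) (coeff-+ g k i)) ⟨
    coeff ((f +ₚ h) +ₚ (g +ₚ k)) i  ∎
    where open A using (begin_; step-≈-⟩; step-≈-⟨; _∎)

  ∙ₚ-distrib-+ : ∀ a f g → a ∙ₚ (f +ₚ g) ≋ a ∙ₚ f +ₚ a ∙ₚ g
  ∙ₚ-distrib-+ a f g = coeffwise λ i → begin
    coeff (a ∙ₚ (f +ₚ g)) i                    ≈⟨ coeff-∙ a (f +ₚ g) i ⟩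
    a A.* coeff (f +ₚ g) i                     ≈⟨ A.*-congˡ (coeff-+ f g i) ⟩
    a A.* (coeff f i A.+ coeff g i)            ≈⟨ A.distribˡ _ _ _ ⟩
    a A.* coeff f i A.+ a A.* coeff g i        ≈⟨ A.+-cong (coeff-∙ a f i) (coeff-∙ a g i) ⟨
    coeff (a ∙ₚ f) i A.+ coeff (a ∙ₚ g) i      ≈⟨ coeff-+ (a ∙ₚ f) (a ∙ₚ g) i ⟨
    coeff (a ∙ₚ f +ₚ a ∙ₚ g) i                 ∎
    where open A using (begin_; step-≈-⟩; step-≈-⟨; _∎)

  +-distrib-∙ₚ : ∀ a b f → (a A.+ b) ∙ₚ f ≋ a ∙ₚ f +ₚ b ∙ₚ f
  +-distrib-∙ₚ a b f = coeffwise λ i → begin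
    coeff ((a A.+ b) ∙ₚ f) i                   ≈⟨ coeff-∙ (a A.+ b) f i ⟩
    (a A.+ b) A.* coeff f i                    ≈⟨ A.distribʳ _ _ _ ⟩
    a A.* coeff f i A.+ b A.* coeff f i        ≈⟨ A.+-cong (coeff-∙ a f i) (coeff-∙ b f i) ⟨
    coeff (a ∙ₚ f) i A.+ coeff (b ∙ₚ f) i      ≈⟨ coeff-+ (a ∙ₚ f) (b ∙ₚ f) i ⟨
    coeff (a ∙ₚ f +ₚ b ∙ₚ f) i                 ∎
    where open A using (begin_; step-≈-⟩; step-≈-⟨; _∎)

  ∙ₚ-∙ₚ : ∀ a b f → a ∙ₚ (b ∙ₚ f) ≋ (a A.* b) ∙ₚ f
  ∙ₚ-∙ₚ a b f = coeffwise λ i → begin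
    coeff (a ∙ₚ (b ∙ₚ f)) i       ≈⟨ coeff-∙ a (b ∙ₚ f) i ⟩
    a A.* coeff (b ∙ₚ f) i        ≈⟨ A.*-congˡ (coeff-∙ b f i) ⟩
    a A.* (b A.* coeff f i)       ≈⟨ A.*-assoc a b _ ⟨
    (a A.* b) A.* coeff f i       ≈⟨ coeff-∙ (a A.* b) f i ⟨
    coeff ((a A.* b) ∙ₚ f) i      ∎
    where open A using (begin_; step-≈-⟩; step-≈-⟨; _∎)

  0∙ₚ : ∀ {a} f → a A.≈ A.0# → a ∙ₚ f ≋ []
  0∙ₚ {a} f e = coeffwise λ i → A.trans (coeff-∙ a f i) (A.trans (A.*-congʳ e) (A.zeroˡ _))

  1∙ₚ : ∀ f → A.1# ∙ₚ f ≋ f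
  1∙ₚ f = coeffwise λ i → A.trans (coeff-∙ A.1# f i) (A.*-identityˡ _)

  shift-+ : ∀ f g → (A.0# ∷ f) +ₚ (A.0# ∷ g) ≋ A.0# ∷ (f +ₚ g)
  shift-+ f g = ∷-cong (A.+-identityˡ _) ≋-refl

  zero-*ₚ : ∀ {f} g → f ≋ [] → f *ₚ g ≋ []
  zero-*ₚ {[]}    g e = ≋-refl
  zero-*ₚ {a ∷ f} g e = +ₚ-cong {f′ = []} (0∙ₚ g (at e 0)) (∷-zero A.refl (zero-*ₚ {f} g (coeffwise λ i → at e (suc i))))

  *ₚ-congˡ : ∀ f {g g′} → g ≋ g′ → f *ₚ g ≋ f *ₚ g′
  *ₚ-congˡ []      e = ≋-refl
  *ₚ-congˡ (a ∷ f) {g} {g′} e = +ₚ-cong (∙ₚ-cong A.refl e) (∷-cong A.refl (*ₚ-congˡ f e))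

  *ₚ-congʳ : ∀ {f f′} g → f ≋ f′ → f *ₚ g ≋ f′ *ₚ g
  *ₚ-congʳ {[]}    {f′}     g e = ≋-sym (zero-*ₚ g (≋-sym e))
  *ₚ-congʳ {a ∷ f} {[]}     g e = zero-*ₚ g e
  *ₚ-congʳ {a ∷ f} {b ∷ f′} g e =
    +ₚ-cong (∙ₚ-cong {f = g} (at e 0) ≋-refl) (∷-cong A.refl (*ₚ-congʳ g (tail-≈ {a} {b} {f} {f′} e)))

  *ₚ-distribʳ : ∀ h f g → (f +ₚ g) *ₚ h ≋ f *ₚ h +ₚ g *ₚ h
  *ₚ-distribʳ h []      g       = ≋-refl
  *ₚ-distribʳ h (a ∷ f) []      = ≋-sym (+ₚ-identityʳ ((a ∷ f) *ₚ h))
  *ₚ-distribʳ h (a ∷ f) (b ∷ g) = ≋-trans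
    (+ₚ-cong (+-distrib-∙ₚ a b h)
      (≋-trans (∷-cong A.refl (*ₚ-distribʳ h f g)) (≋-sym (shift-+ (f *ₚ h) (g *ₚ h)))))
    (+ₚ-interchange (a ∙ₚ h) (b ∙ₚ h) (A.0# ∷ (f *ₚ h)) (A.0# ∷ (g *ₚ h)))

  *ₚ-zeroʳ : ∀ f → f *ₚ [] ≋ []
  *ₚ-zeroʳ []      = ≋-refl
  *ₚ-zeroʳ (a ∷ f) = ∷-zero A.refl (*ₚ-zeroʳ f)

  *ₚ-∷ : ∀ f b g → f *ₚ (b ∷ g) ≋ b ∙ₚ f +ₚ (A.0# ∷ (f *ₚ g))
  *ₚ-∷ []      b g = ≋-sym (∷-zero A.refl ≋-refl)
  *ₚ-∷ (a ∷ f) b g = ∷-cong (A.+-congʳ (A.*-comm a b)) (≋-trans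
    (+ₚ-cong (≋-refl {a ∙ₚ g}) (*ₚ-∷ f b g))
    (≋-trans (≋-sym (+ₚ-assoc (a ∙ₚ g) (b ∙ₚ f) (A.0# ∷ (f *ₚ g))))
    (≋-trans (+ₚ-cong (+ₚ-comm (a ∙ₚ g) (b ∙ₚ f)) (≋-refl {A.0# ∷ (f *ₚ g)}))
              (+ₚ-assoc (b ∙ₚ f) (a ∙ₚ g) (A.0# ∷ (f *ₚ g))))))

  *ₚ-comm : ∀ f g → f *ₚ g ≋ g *ₚ f
  *ₚ-comm []      g = ≋-sym (*ₚ-zeroʳ g)
  *ₚ-comm (a ∷ f) g = ≋-trans
    (+ₚ-cong (≋-refl {a ∙ₚ g}) (∷-cong A.refl (*ₚ-comm f g)))
    (≋-sym (*ₚ-∷ g a f))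

  ∙ₚ-*ₚ : ∀ a f g → (a ∙ₚ f) *ₚ g ≋ a ∙ₚ (f *ₚ g)
  ∙ₚ-*ₚ a []      g = ≋-refl
  ∙ₚ-*ₚ a (b ∷ f) g = ≋-trans
    (+ₚ-cong (≋-sym (∙ₚ-∙ₚ a b g)) (∷-cong (A.sym (A.zeroʳ a)) (∙ₚ-*ₚ a f g)))
    (≋-sym (∙ₚ-distrib-+ a (b ∙ₚ g) (A.0# ∷ (f *ₚ g))))

  shift-*ₚ : ∀ f g → (A.0# ∷ f) *ₚ g ≋ A.0# ∷ (f *ₚ g)
  shift-*ₚ f g = +ₚ-cong {f′ = []} (0∙ₚ g A.refl) ≋-refl

  *ₚ-assoc : ∀ f g h → (f *ₚ g) *ₚ h ≋ f *ₚ (g *ₚ h)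
  *ₚ-assoc []      g h = ≋-refl
  *ₚ-assoc (a ∷ f) g h = ≋-trans (*ₚ-distribʳ h (a ∙ₚ g) (A.0# ∷ (f *ₚ g)))
    (+ₚ-cong (∙ₚ-*ₚ a g h) (≋-trans (shift-*ₚ (f *ₚ g) h) (∷-cong A.refl (*ₚ-assoc f g h))))

  *ₚ-identityˡ : ∀ f → C A.1# *ₚ f ≋ f
  *ₚ-identityˡ f = ≋-trans
    (+ₚ-cong (1∙ₚ f) (∷-zero {f = []} A.refl ≋-refl)) (+ₚ-identityʳ f)

  commutativeRing : CommutativeRing 0ℓ 0ℓ
  commutativeRing = record
    { Carrier = Poly ; _≈_ = _≋_ ; _+_ = _+ₚ_ ; _*_ = _*ₚ_ ; -_ = -ₚ_ ; 0# = [] ; 1# = C A.1#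
    ; isCommutativeRing = record
      { isRing = record
        { +-isAbelianGroup = record
          { isGroup = record
            { isMonoid = record
              { isSemigroup = record
                { isMagma = record
                  { isEquivalence = record
                    { refl = ≋-refl ; sym = ≋-sym ; trans = ≋-trans }
                  ; ∙-cong = +ₚ-cong }
                ; assoc = +ₚ-assoc }
              ; identity = (λ f → ≋-refl) , +ₚ-identityʳ }
            ; inverse = (λ f → ≋-trans (+ₚ-comm (-ₚ f) f) (-ₚ-inverseʳ f)) , -ₚ-inverseʳ
            ; ⁻¹-cong = -ₚ-cong }
          ; comm = +ₚ-comm }
        ; *-cong = λ {f} {f′} {g} {g′} e e′ → ≋-trans (*ₚ-congʳ g e) (*ₚ-congˡ f′ e′)
        ; *-assoc = *ₚ-assoc
        ; *-identity = *ₚ-identityˡ , (λ f → ≋-trans (*ₚ-comm f (C A.1#)) (*ₚ-identityˡ f))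
        ; distrib = (λ f g h → ≋-trans (*ₚ-comm f (g +ₚ h)) (≋-trans (*ₚ-distribʳ f g h) (+ₚ-cong (*ₚ-comm g f) (*ₚ-comm h f))))
                  , *ₚ-distribʳ }
      ; *-comm = *ₚ-comm } }


-- Dedekind's criterion in an abstract ring

module DedekindCriterion (R : CommutativeRing 0ℓ 0ℓ) (p : CommutativeRing.Carrier R)
                         (p-nzd : RingKit.NonZeroDivisor R p) where
  open RingKit R
  open CommutativeSemigroupProperties *-commutativeSemigroup using (x∙yz≈xy∙z; xy∙z≈xz∙y)

  -- For p-torsion-free R this says that the powers of b / p have bounded denominator.
  AlmostIntegral : Carrier → Set
  AlmostIntegral b = ∃[ s ] ∀ i → p ^ i ∣ b ^ (s ℕ.+ i)

  almostIntegral-* : ∀ c {b} → AlmostIntegral b → AlmostIntegral (c * b)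
  almostIntegral-* c (s , d) = s , λ i →
    ∣ʳ-respʳ-≈ (sym (^-distrib-* c _ (s ℕ.+ i))) (∣-*ˡ (c ^ (s ℕ.+ i)) (d i))

  Ideal : Carrier → Carrier → Set
  Ideal u x = ∃[ c ] ∃[ d ] x ≈ c * p + d * u

  private
    ideal-+ : ∀ {u x y} → Ideal u x → Ideal u y → Ideal u (x + y)
    ideal-+ {u} (c , d , e) (c′ , d′ , e′) = c + c′ , d + d′ , trans (+-cong e e′)
      (solve 6 (λ p u c d c′ d′ → (c :* p :+ d :* u) :+ (c′ :* p :+ d′ :* u)
        := (c :+ c′) :* p :+ (d :+ d′) :* u) refl p u c d c′ d′)

    ideal-* : ∀ {u x} y → Ideal u x → Ideal u (y * x)
    ideal-* {u} y (c , d , e) = y * c , y * d , trans (*-congˡ e)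
      (solve 5 (λ p u c d y → y :* (c :* p :+ d :* u) := y :* c :* p :+ y :* d :* u) refl p u c d y)

    ideal-p : ∀ {u} y → Ideal u (y * p)
    ideal-p {u} y = y , 0# , sym (trans (+-congˡ (zeroˡ u)) (+-identityʳ _))

    ideal-resp : ∀ {u x y} → x ≈ y → Ideal u x → Ideal u y
    ideal-resp x≈y (c , d , e) = c , d , trans (sym x≈y) e

  -- Here J = (p, h) contains everything nilpotent modulo p, whatever annihilates h modulo p lies in
  -- (p, u), and `bezout` makes r invertible modulo p. An almost integral b / p turns out to map J
  -- into itself, and the relation h u = p r then forces it into R.
  module _ {h u r : Carrier} (hu≈pr : h * u ≈ p * r)
           (radical : ∀ b j → p ∣ b ^ j → Ideal h b)
           (annihilator : ∀ x → p ∣ h * x → Ideal u x)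
           (γ κ : Carrier) (bezout : γ * r + κ * p ≈ 1#)
           (N : ℕ) (nilpotent : p ∣ h ^ N) where

    private
      -- Put β = b / p, so that e = h β. The power β^M costs at most p^s in the denominator while
      -- h^M supplies p^(s+1), so e^M keeps one factor p.
      colon-nilpotent : ∀ b e → AlmostIntegral b → h * b ≈ e * p → ∃[ M ] p ∣ e ^ M
      colon-nilpotent b e (s , d) hb≈ep = M , (η * κ′) , sym (cancelˡ (nonZeroDivisor-^ p-nzd M) (begin
        p ^ M * e ^ M                           ≈⟨ *-comm _ _ ⟩
        e ^ M * p ^ M                           ≈⟨ ^-distrib-* e p M ⟨
        (e * p) ^ M                             ≈⟨ ^-congˡ M hb≈ep ⟨
        (h * b) ^ M                             ≈⟨ ^-distrib-* h b M ⟩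
        h ^ M * b ^ M                           ≈⟨ *-cong eη eκ ⟨
        (η * p ^ suc s) * (κ′ * p ^ i)          ≈⟨ solve 5 (λ η p q κ r → (η :* (p :* q)) :* (κ :* r) := (q :* r) :* (η :* κ :* p)) refl η p (p ^ s) κ′ (p ^ i) ⟩
        (p ^ s * p ^ i) * (η * κ′ * p)          ≈⟨ *-congʳ (^-homo-* p s i) ⟨
        p ^ M * (η * κ′ * p)                    ∎))
        where
        i = N ℕ.* suc s
        M = s ℕ.+ i
        κ′ = proj₁ (∣⇒∃ (d i))
        eκ : κ′ * p ^ i ≈ b ^ M
        eκ = proj₂ (∣⇒∃ (d i))
        h∣ : p ^ suc s ∣ h ^ M
        h∣ = ∣ʳ-trans (^-∣ (suc s)) (∣ʳ-trans (∣ʳ-respʳ-≈ (^-assocʳ h N (suc s)) ∣ʳ-refl) (^-mono-∣ h (ℕP.m≤n+m i s)))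
          where
          ^-∣ : ∀ j → p ^ j ∣ (h ^ N) ^ j
          ^-∣ zero    = ∣ʳ-refl
          ^-∣ (suc j) = ∙-cong-∣ nilpotent (^-∣ j)
        η = proj₁ (∣⇒∃ h∣)
        eη : η * p ^ suc s ≈ h ^ M
        eη = proj₂ (∣⇒∃ h∣)

      -- With β = b / p, both p β = b and h β = e are nilpotent modulo p and hence lie in (p, h).
      -- Comparing the two expansions puts the h-coefficient y of b into (p, u), and since p divides
      -- h u it then divides b = x p + y h.
      descend : ∀ b → AlmostIntegral b → p ∣ h * b → p ∣ b
      descend b ai@(s , d) (e , ep≈hb) =
        let x , y , eb = radical b (s ℕ.+ 1) (∣ʳ-trans (x∣x*y p 1#) (d 1))
            M , nil    = colon-nilpotent b e ai (sym ep≈hb)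
            z , v , ee = radical e M nil
        in  combine b e x y z v eb ee ep≈hb
        where
        combine : ∀ b e x y z v → b ≈ x * p + y * h → e ≈ z * p + v * h → e * p ≈ h * b → p ∣ b
        combine b e x y z v eb ee ep≈hb =
          let a , c , ey = y∈ in (x + h * a + c * r) , sym (begin
            b                                      ≈⟨ eb ⟩
            x * p + y * h                          ≈⟨ +-congˡ (*-congʳ ey) ⟩
            x * p + (a * p + c * u) * h            ≈⟨ lin₁ c hu≈pr (solve 7 (λ p h u r x a c →
                (x :* p :+ (a :* p :+ c :* u) :* h) :+ c :* (p :* r)
                  := (x :+ h :* a :+ c :* r) :* p :+ c :* (h :* u)) refl p h u r x a c) ⟩
            (x + h * a + c * r) * p                ∎)
          where
          expand : h * (x * p + y * h) ≈ (z * p + v * h) * p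
          expand = begin
            h * (x * p + y * h)    ≈⟨ *-congˡ eb ⟨
            h * b                  ≈⟨ ep≈hb ⟨
            e * p                  ≈⟨ *-congʳ ee ⟩
            (z * p + v * h) * p    ∎
          -- Multiply `expand` by u and replace h u by p r: one factor p cancels, and h r y is left
          -- as a multiple of p.
          d₁ : p ∣ h * (r * y)
          d₁ = (u * z + - (r * (x + - v))) , cancelˡ p-nzd
            (lin₂ (- u) (h * y + p * (x + - v)) expand hu≈pr
              (solve 8 (λ p h u r x y z v →
                p :* ((u :* z :+ :- (r :* (x :+ :- v))) :* p)
                  :+ ((:- u) :* ((z :* p :+ v :* h) :* p) :+ (h :* y :+ p :* (x :+ :- v)) :* (p :* r))
                := p :* (h :* (r :* y))
                  :+ ((:- u) :* (h :* (x :* p :+ y :* h)) :+ (h :* y :+ p :* (x :+ :- v)) :* (h :* u)))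
                refl p h u r x y z v))
          y≈ : γ * (r * y) + (κ * y) * p ≈ y
          y≈ = begin
            γ * (r * y) + (κ * y) * p    ≈⟨ +-cong (x∙yz≈xy∙z γ r y) (xy∙z≈xz∙y κ y p) ⟩
            γ * r * y + κ * p * y        ≈⟨ distribʳ y _ _ ⟨
            (γ * r + κ * p) * y          ≈⟨ *-congʳ bezout ⟩
            1# * y                       ≈⟨ *-identityˡ y ⟩
            y                            ∎
          y∈ : Ideal u y
          y∈ = ideal-resp y≈ (ideal-+ (ideal-* γ (annihilator (r * y) d₁)) (ideal-p (κ * y)))

    -- p divides h^N b, and the factors h come off one at a time because every h^j b is again almost
    -- integral.
    almostIntegral⇒∣ : ∀ b → AlmostIntegral b → p ∣ b
    almostIntegral⇒∣ b ai = strip N (∣ʳ-trans nilpotent (x∣x*y (h ^ N) b))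
      where
      strip : ∀ j → p ∣ h ^ j * b → p ∣ b
      strip zero    d = ∣ʳ-respʳ-≈ (*-identityˡ b) d
      strip (suc j) d = strip j (descend (h ^ j * b) (almostIntegral-* (h ^ j) ai)
        (∣ʳ-respʳ-≈ (*-assoc h (h ^ j) b) d))

  almostIntegral⇒nilpotent : ∀ b → AlmostIntegral b → ∃[ j ] p ∣ b ^ j
  almostIntegral⇒nilpotent b (s , d) =
    s ℕ.+ 1 , ∣ʳ-trans (x∣x*y p 1#) (d 1)


-- Derivations and separable elements

record IsDerivation (E : CommutativeRing 0ℓ 0ℓ) (δ : CommutativeRing.Carrier E → CommutativeRing.Carrier E) : Set where
  open CommutativeRing E
  field
    δ-cong : ∀ {x y} → x ≈ y → δ x ≈ δ y
    δ-+    : ∀ x y → δ (x + y) ≈ δ x + δ y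
    δ-*    : ∀ x y → δ (x * y) ≈ δ x * y + x * δ y

module Derivation (E : CommutativeRing 0ℓ 0ℓ) (δ : CommutativeRing.Carrier E → CommutativeRing.Carrier E)
                  (isDerivation : IsDerivation E δ) where
  open RingKit E
  open IsDerivation isDerivation

  Separable : Carrier → Set
  Separable h = Coprime h (δ h)

  separable-* : ∀ {f g} → Coprime f g → Separable f → Separable g → Separable (f * g)
  separable-* {f} {g} c sf sg = coprime-sym (coprime-*ʳ
    (coprime-sym (coprime-mod (- δ g , lem₁) (coprime-*ʳ sf c)))
    (coprime-sym (coprime-mod (- δ f , lem₂) (coprime-*ʳ (coprime-sym c) sg))))
    where
    lem₁ : - δ g * f ≈ δ f * g + - δ (f * g)
    lem₁ = sym (trans (+-congˡ (-‿cong (δ-* f g)))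
      (solve 4 (λ f g f′ g′ → f′ :* g :+ :- (f′ :* g :+ f :* g′) := :- g′ :* f) refl f g (δ f) (δ g)))
    lem₂ : - δ f * g ≈ f * δ g + - δ (f * g)
    lem₂ = sym (trans (+-congˡ (-‿cong (δ-* f g)))
      (solve 4 (λ f g f′ g′ → f :* g′ :+ :- (f′ :* g :+ f :* g′) := :- f′ :* g) refl f g (δ f) (δ g)))

  separable⇒coprimeFactors : ∀ {h f g} → h ≈ f * g → Separable h → Coprime f g
  separable⇒coprimeFactors {h} {f} {g} e (u , v , s) = u * g + v * δ g , v * δ f , (begin
    (u * g + v * δ g) * f + v * δ f * g       ≈⟨ solve 6 (λ u v f g f′ g′ →
                                                   (u :* g :+ v :* g′) :* f :+ v :* f′ :* g
                                                     := u :* (f :* g) :+ v :* (f′ :* g :+ f :* g′)) refl u v f g (δ f) (δ g) ⟩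
    u * (f * g) + v * (δ f * g + f * δ g)     ≈⟨ +-cong (*-congˡ e) (*-congˡ (trans (δ-cong e) (δ-* f g))) ⟨
    u * h + v * δ h                           ≈⟨ s ⟩
    1#                                        ∎)

  -- Write h = d h₁ and a = d a₁ with h₁ coprime to a₁. Separability makes h₁ coprime to d as well,
  -- so h₁, which divides a^j = d^j a₁^j, is a unit; then h divides d, which divides a.
  separable⇒radical : ∀ {h a} → CoprimeCofactors h a → Separable h → ∀ j → h ∣ a ^ j → h ∣ a
  separable⇒radical {h} {a} (d , h₁ , a₁ , eh , ea , c) sep j h∣aʲ =
    ∣ʳ-trans h∣d (a₁ , trans (*-comm a₁ d) (sym ea))
    where
    h₁⊥d : Coprime h₁ d
    h₁⊥d = coprime-sym (separable⇒coprimeFactors eh sep)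
    h₁∣ : h₁ ∣ a₁ ^ j * d ^ j
    h₁∣ = ∣ʳ-respʳ-≈ (trans (^-congˡ j ea) (trans (^-distrib-* d a₁ j) (*-comm _ _)))
      (∣ʳ-trans (d , sym eh) h∣aʲ)
    h₁∣1 : h₁ ∣ 1#
    h₁∣1 = coprime⇒∣ (coprime-^ʳ j h₁⊥d)
      (∣ʳ-respʳ-≈ (sym (*-identityʳ (d ^ j))) (coprime⇒∣ (coprime-^ʳ j c) h₁∣))
    h∣d : h ∣ d
    h∣d = ∣ʳ-respˡ-≈ (sym eh) (∣ʳ-respʳ-≈ (*-identityʳ d) (∙-cong-∣ ∣ʳ-refl h₁∣1))

  -- The two identities share the right side g: the first makes ℓ and h coprime, the second makes h
  -- separable.
  separable-solve : ∀ {ℓ h g} u v u′ v′ → Separable ℓ → Coprime ℓ g → Coprime h g →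
                    u * h + v * ℓ ≈ g → u′ * δ h + v′ * h ≈ g → Separable (ℓ * h)
  separable-solve u v u′ v′ sep c c′ e e′ =
    separable-* (coprime-solve u v c e) sep (coprime-solve u′ v′ c′ e′)

  private
    δ0 : δ 0# ≈ 0#
    δ0 = lin₁ (- 1#) (trans (δ-cong (sym (+-identityˡ 0#))) (δ-+ 0# 0#))
      (solve 1 (λ x → x :+ (:- con 1ℤ) :* (x :+ x) := con 0ℤ :+ (:- con 1ℤ) :* x) refl (δ 0#))
    δ1 : δ 1# ≈ 0#
    δ1 = lin₁ (- 1#) (trans (δ-cong (sym (*-identityˡ 1#))) (δ-* 1# 1#))
      (solve 1 (λ x → x :+ (:- con 1ℤ) :* (x :* con 1ℤ :+ con 1ℤ :* x) := con 0ℤ :+ (:- con 1ℤ) :* x) refl (δ 1#))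
    δ-nonneg : ∀ n → δ (ι (+ n)) ≈ 0#
    δ-nonneg zero    = δ0
    δ-nonneg (suc n) = trans (δ-cong (ι-+ 1ℤ (+ n))) (trans (δ-+ 1# (ι (+ n))) (trans (+-cong δ1 (δ-nonneg n)) (+-identityˡ 0#)))

  δ-neg : ∀ x → δ (- x) ≈ - δ x
  δ-neg x = lin₁ (- 1#) (trans (sym δ0) (trans (δ-cong (sym (-‿inverseʳ x))) (δ-+ x (- x))))
    (solve 2 (λ y z → z :+ (:- con 1ℤ) :* (y :+ z) := :- y :+ (:- con 1ℤ) :* con 0ℤ) refl (δ x) (δ (- x)))

  δ-ι≈0 : ∀ c → δ (ι c) ≈ 0#
  δ-ι≈0 (+ n)    = δ-nonneg n
  δ-ι≈0 -[1+ n ] = trans (δ-neg (ι (+ suc n))) (trans (-‿cong (δ-nonneg (suc n))) -0#≈0#)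

  δ-shift : ∀ x c → δ (x + - ι c) ≈ δ x
  δ-shift x c = trans (δ-+ x (- ι c)) (trans
    (+-congˡ (trans (δ-neg (ι c)) (trans (-‿cong (δ-ι≈0 c)) -0#≈0#))) (+-identityʳ (δ x)))


-- Binary forms behind ℱ, and their multiple roots modulo p

-- form a q w n = qⁿ + a Σ_{i<n} qⁱ wⁿ⁻ⁱ.  With z = m²x^k and a = b m²ⁿ, the
-- polynomial m²ⁿ ℱ is form a z 1 n, and form a (n(1 - a)) (n + 1) n = (1 + n a) 𝒟.
module Forms (R : CommutativeRing 0ℓ 0ℓ) where
  open RingKit R

  geo : Carrier → Carrier → ℕ → Carrier
  geo q w zero    = 0#
  geo q w (suc n) = w * (q ^ n + geo q w n)

  form : Carrier → Carrier → Carrier → ℕ → Carrier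
  form a q w n = q ^ n + a * geo q w n

  1^n≈1 : ∀ n → 1# ^ n ≈ 1#
  1^n≈1 zero    = refl
  1^n≈1 (suc n) = trans (*-identityˡ _) (1^n≈1 n)

  ^-mod : ∀ x y n → x + - y ∣ x ^ n + - (y ^ n)
  ^-mod x y zero    = ∣ʳ-respʳ-≈ (sym (-‿inverseʳ 1#)) (_ ∣0)
  ^-mod x y (suc n) = ∣ʳ-respʳ-≈
    (solve 4 (λ x y u v → u :* (x :+ :- y) :+ y :* (u :+ :- v) := x :* u :+ :- (y :* v)) refl x y (x ^ n) (y ^ n))
    (∣-+ (∣-*ˡ (x ^ n) ∣ʳ-refl) (∣-*ˡ y (^-mod x y n)))

  geo-cong : ∀ {q q′ w w′} → q ≈ q′ → w ≈ w′ → ∀ n → geo q w n ≈ geo q′ w′ n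
  geo-cong e f zero    = refl
  geo-cong e f (suc n) = *-cong f (+-cong (^-congˡ n e) (geo-cong e f n))

  form-cong : ∀ {a a′ q q′ w w′} n → a ≈ a′ → q ≈ q′ → w ≈ w′ → form a q w n ≈ form a′ q′ w′ n
  form-cong n d e f = +-cong (^-congˡ n e) (*-cong d (geo-cong e f n))

  geo-mod : ∀ x y w n → x + - y ∣ geo x w n + - geo y w n
  geo-mod x y w zero    = ∣ʳ-respʳ-≈ (sym (-‿inverseʳ 0#)) (_ ∣0)
  geo-mod x y w (suc n) = ∣ʳ-respʳ-≈
    (solve 5 (λ w u v s t → w :* ((u :+ :- v) :+ (s :+ :- t)) := w :* (u :+ s) :+ :- (w :* (v :+ t))) refl
      w (x ^ n) (y ^ n) (geo x w n) (geo y w n))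
    (∣-*ˡ w (∣-+ (^-mod x y n) (geo-mod x y w n)))

  form-mod : ∀ a x y w n → x + - y ∣ form a x w n + - form a y w n
  form-mod a x y w n = ∣ʳ-respʳ-≈
    (solve 5 (λ a u v s t → (u :+ :- v) :+ a :* (s :+ :- t) := (u :+ a :* s) :+ :- (v :+ a :* t)) refl
      a (x ^ n) (y ^ n) (geo x w n) (geo y w n))
    (∣-+ (^-mod x y n) (∣-*ˡ a (geo-mod x y w n)))

  geo-scale : ∀ c q w n → geo (c * q) (c * w) n ≈ c ^ n * geo q w n
  geo-scale c q w zero    = sym (zeroʳ _)
  geo-scale c q w (suc n) = begin
    c * w * ((c * q) ^ n + geo (c * q) (c * w) n)   ≈⟨ *-congˡ (+-cong (^-distrib-* c q n) (geo-scale c q w n)) ⟩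
    c * w * (c ^ n * q ^ n + c ^ n * geo q w n)     ≈⟨ solve 5 (λ c w d u g → c :* w :* (d :* u :+ d :* g) := c :* d :* (w :* (u :+ g))) refl c w (c ^ n) (q ^ n) (geo q w n) ⟩
    c * c ^ n * (w * (q ^ n + geo q w n))           ∎

  -- Homogeneity of degree n. It lets the value of P at a fraction Q / W be handled as the integer
  -- `form a Q W n`.
  form-scale : ∀ a c q w n → form a (c * q) (c * w) n ≈ c ^ n * form a q w n
  form-scale a c q w n = trans (+-cong (^-distrib-* c q n) (*-congˡ (geo-scale c q w n)))
    (solve 4 (λ a d u g → d :* u :+ a :* (d :* g) := d :* (u :+ a :* g)) refl a (c ^ n) (q ^ n) (geo q w n))

  geo-telescope : ∀ q w n → (q + - w) * geo q w n ≈ w * (q ^ n + - (w ^ n))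
  geo-telescope q w zero    = trans (zeroʳ _) (sym (trans (*-congˡ (-‿inverseʳ 1#)) (zeroʳ w)))
  geo-telescope q w (suc n) = lin₁ w (geo-telescope q w n)
    (solve 5 (λ q w u v g →
      (q :+ :- w) :* (w :* (u :+ g)) :+ w :* (w :* (u :+ :- v))
        := w :* (q :* u :+ :- (w :* v)) :+ w :* ((q :+ :- w) :* g)) refl q w (q ^ n) (w ^ n) (geo q w n))

  form-telescope : ∀ a q w n →
    (q + - w) * form a q w n ≈ (q + - w) * q ^ n + a * (w * (q ^ n + - (w ^ n)))
  form-telescope a q w n = lin₁ a (geo-telescope q w n)
    (solve 6 (λ a q w u v g →
      (q :+ :- w) :* (u :+ a :* g) :+ a :* (w :* (u :+ :- v))
        := ((q :+ :- w) :* u :+ a :* (w :* (u :+ :- v))) :+ a :* ((q :+ :- w) :* g)) refl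
      a q w (q ^ n) (w ^ n) (geo q w n))

  ι-suc : ∀ n → ι (+ suc n) ≈ 1# + ι (+ n)
  ι-suc n = ι-+ 1ℤ (+ n)

  geo-diagonal : ∀ w n → geo w w n ≈ ι (+ n) * w ^ n
  geo-diagonal w zero    = sym (zeroˡ 1#)
  geo-diagonal w (suc n) = trans (*-congˡ (+-congˡ (geo-diagonal w n))) (trans
    (solve 3 (λ w u c → w :* (u :+ c :* u) := (con 1ℤ :+ c) :* (w :* u)) refl w (w ^ n) (ι (+ n)))
    (*-congʳ (sym (ι-suc n))))

  form-diagonal : ∀ a w n → form a w w n ≈ w ^ n * (1# + ι (+ n) * a)
  form-diagonal a w n = trans (+-congˡ (*-congˡ (geo-diagonal w n)))
    (solve 3 (λ a u c → u :+ a :* (c :* u) := u :* (con 1ℤ :+ c :* a)) refl a (w ^ n) (ι (+ n)))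

  form-at-0 : ∀ a q w n → w ∣ form a q w n + - (q ^ n)
  form-at-0 a q w zero    = ∣ʳ-respʳ-≈ (solve 1 (λ a → con 0ℤ := (con 1ℤ :+ a :* con 0ℤ) :+ :- con 1ℤ) refl a) (_ ∣0)
  form-at-0 a q w (suc n) = a * (q ^ n + geo q w n) ,
    solve 4 (λ a w u v → a :* u :* w := (v :+ a :* (w :* u)) :+ :- v) refl a w (q ^ n + geo q w n) (q * q ^ n)

  geo-const : ∀ z n → z ∣ geo z 1# (suc n) + - 1#
  geo-const z zero    = ∣ʳ-respʳ-≈ (solve 0 (con 0ℤ := con 1ℤ :* (con 1ℤ :+ con 0ℤ) :+ :- con 1ℤ) refl) (_ ∣0)
  geo-const z (suc n) = ∣ʳ-respʳ-≈
    (solve 3 (λ z u g → z :* u :+ (g :+ :- con 1ℤ) := con 1ℤ :* (z :* u :+ g) :+ :- con 1ℤ) refl z (z ^ n) (geo z 1# (suc n)))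
    (∣-+ (∣-*ʳ _ ∣ʳ-refl) (geo-const z n))

  form-const : ∀ a z n → z ∣ form a z 1# (suc n) + - a
  form-const a z n = ∣ʳ-respʳ-≈
    (solve 4 (λ a z u g → z :* u :+ a :* (g :+ :- con 1ℤ) := (z :* u :+ a :* g) :+ :- a) refl a z (z ^ n) (geo z 1# (suc n)))
    (∣-+ (∣-*ʳ _ ∣ʳ-refl) (∣-*ˡ a (geo-const z n)))

module ℤ-Ring = RingKit ℤP.+-*-commutativeRing
module ℤ-Forms = Forms ℤP.+-*-commutativeRing

module FormsOfIntegers (R : CommutativeRing 0ℓ 0ℓ) where
  open RingKit R
  open Forms R

  ι-^ : ∀ c n → ι (c ℤ-Ring.^ n) ≈ ι c ^ n
  ι-^ c zero    = refl
  ι-^ c (suc n) = trans (ι-* c (c ℤ-Ring.^ n)) (*-congˡ (ι-^ c n))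

  ι-geo : ∀ q w n → ι (ℤ-Forms.geo q w n) ≈ geo (ι q) (ι w) n
  ι-geo q w zero    = refl
  ι-geo q w (suc n) = trans (ι-* w _) (*-congˡ (trans (ι-+ (q ℤ-Ring.^ n) _) (+-cong (ι-^ q n) (ι-geo q w n))))

  ι-form : ∀ a q w n → ι (ℤ-Forms.form a q w n) ≈ form (ι a) (ι q) (ι w) n
  ι-form a q w n = trans (ι-+ (q ℤ-Ring.^ n) _) (+-cong (ι-^ q n) (trans (ι-* a _) (*-congˡ (ι-geo q w n))))

-- The case p ∤ bm, in a ring E of characteristic p; the derivation is x d/dx and κ = k.
module Unramified (E : CommutativeRing 0ℓ 0ℓ) (δ : CommutativeRing.Carrier E → CommutativeRing.Carrier E)
                  (isDerivation : IsDerivation E δ)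
                  (n : ℕ) (a : ℤ) (z κ : CommutativeRing.Carrier E)
                  (δz≈κz : CommutativeRing._≈_ E (δ z) (CommutativeRing._*_ E κ z))
                  (κ-unit : RingKit._∣_ E κ (CommutativeRing.1# E))
                  (a-unit : RingKit._∣_ E (RingKit.ι E a) (CommutativeRing.1# E)) where
  open RingKit E
  open Forms E
  open FormsOfIntegers E
  open IsDerivation isDerivation
  open Derivation E δ isDerivation

  private
    N W Q T : ℤ
    N = + suc n
    W = ℤ.suc N
    Q = N ℤ.* (1ℤ ℤ.+ ℤ.- a)
    T = 1ℤ ℤ.+ N ℤ.* a

  P : Carrier
  P = form (ι a) z 1# (suc n)

  private
    L : Carrier
    L = ι W * z + - ι Q

    W≈ : ι W ≈ 1# + ι N
    W≈ = ι-+ 1ℤ N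
    Q≈ : ι Q ≈ ι N * (1# + - ι a)
    Q≈ = trans (ι-* N (1ℤ ℤ.+ ℤ.- a)) (*-congˡ (trans (ι-+ 1ℤ (ℤ.- a)) (+-congˡ (ι-neg a))))
    T≈ : ι T ≈ 1# + ι N * ι a
    T≈ = trans (ι-+ 1ℤ (N ℤ.* a)) (+-congˡ (ι-* N a))

    T≈W-Q : ι T ≈ ι W + - ι Q
    T≈W-Q = trans T≈ (trans (solve 2 (λ N a → con 1ℤ :+ N :* a := (con 1ℤ :+ N) :+ :- (N :* (con 1ℤ :+ :- a))) refl (ι N) (ι a))
      (+-cong (sym W≈) (-‿cong (sym Q≈))))

    δ-^ : ∀ i → δ (z ^ i) ≈ κ * (ι (+ i) * z ^ i)
    δ-^ zero    = trans (δ-ι≈0 1ℤ) (sym (trans (*-congˡ (zeroˡ _)) (zeroʳ κ)))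
    δ-^ (suc i) = begin
      δ (z * z ^ i)                                     ≈⟨ δ-* z (z ^ i) ⟩
      δ z * z ^ i + z * δ (z ^ i)                       ≈⟨ +-cong (*-congʳ δz≈κz) (*-congˡ (δ-^ i)) ⟩
      κ * z * z ^ i + z * (κ * (ι (+ i) * z ^ i))       ≈⟨ solve 4 (λ κ z c u → κ :* z :* u :+ z :* (κ :* (c :* u)) := κ :* ((con 1ℤ :+ c) :* (z :* u))) refl κ z (ι (+ i)) (z ^ i) ⟩
      κ * ((1# + ι (+ i)) * (z * z ^ i))                ≈⟨ *-congˡ (*-congʳ (ι-suc i)) ⟨
      κ * (ι (+ suc i) * (z * z ^ i))                   ∎

    δz-1 : δ (z + - 1#) ≈ κ * z
    δz-1 = trans (δ-shift z 1ℤ) δz≈κz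

    -- Differentiate (z - 1) P = (z - 1) zⁿ + a (zⁿ - 1).
    euler : κ * z * P + (z + - 1#) * δ P ≈ κ * z ^ suc n * L
    euler = begin
      κ * z * P + (z + - 1#) * δ P             ≈⟨ +-congʳ (*-congʳ δz-1) ⟨
      δ (z + - 1#) * P + (z + - 1#) * δ P      ≈⟨ δ-* (z + - 1#) P ⟨
      δ ((z + - 1#) * P)                       ≈⟨ δ-cong (trans (form-telescope (ι a) z 1# (suc n)) (+-congˡ (*-congˡ (trans (*-identityˡ _) (+-congˡ (-‿cong (1^n≈1 (suc n)))))))) ⟩
      δ ((z + - 1#) * u + ι a * (u + - 1#))    ≈⟨ trans (δ-+ _ _) (+-cong (δ-* _ _) (δ-* _ _)) ⟩
      (δ (z + - 1#) * u + (z + - 1#) * δ u) + (δ (ι a) * (u + - 1#) + ι a * δ (u + - 1#))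
        ≈⟨ +-cong (+-cong (*-congʳ δz-1) (*-congˡ (δ-^ (suc n)))) (+-cong (*-congʳ (δ-ι≈0 a)) (*-congˡ (trans (δ-shift u 1ℤ) (δ-^ (suc n))))) ⟩
      (κ * z * u + (z + - 1#) * (κ * (ι N * u))) + (0# * (u + - 1#) + ι a * (κ * (ι N * u)))
        ≈⟨ solve 5 (λ κ z u N a → (κ :* z :* u :+ (z :+ :- con 1ℤ) :* (κ :* (N :* u))) :+ (con 0ℤ :* (u :+ :- con 1ℤ) :+ a :* (κ :* (N :* u)))
             := κ :* u :* ((con 1ℤ :+ N) :* z :+ :- (N :* (con 1ℤ :+ :- a)))) refl κ z u (ι N) (ι a) ⟩
      κ * u * ((1# + ι N) * z + - (ι N * (1# + - ι a)))
        ≈⟨ *-congˡ (+-cong (*-congʳ W≈) (-‿cong Q≈)) ⟨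
      κ * u * L ∎
      where u = z ^ suc n

    P⊥z : Coprime P z
    P⊥z = coprime-sym (coprime-mod (∣-swap P (ι a) (form-const (ι a) z n)) (coprime-unit a-unit))

    -- What remains of the right side of `euler` once the linear factor z - y of L = W (z - y) is
    -- cancelled. It is built from units and z alone when W is a unit, hence coprime to every
    -- divisor of P.
    G : Carrier
    G = κ * z ^ suc n * ι W

    ⊥G : ∀ {x} → ι W ∣ 1# → x ∣ P → Coprime x G
    ⊥G W-unit x∣P = coprime-*ʳ (coprime-*ʳ (coprime-unit κ-unit) (coprime-^ʳ (suc n) x⊥z)) (coprime-unit W-unit)
      where x⊥z = coprime-sym (coprime-∣ʳ x∣P (coprime-sym P⊥z))

  -- The hypothesis is, up to sign, the resultant of P and L in z. If it is a unit, L is coprime to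
  -- P, and `euler` read modulo P equates (z - 1) δP with a product of elements invertible modulo P.
  separable-P : ι (ℤ-Forms.form a Q W (suc n)) ∣ 1# → Separable P
  separable-P unit = coprime-solve (z + - 1#) (κ * z)
    (coprime-*ʳ (coprime-*ʳ (coprime-unit κ-unit) (coprime-^ʳ (suc n) P⊥z)) (coprime-sym L⊥P))
    (trans (+-comm _ _) euler)
    where
    W^P = form (ι a) (ι W * z) (ι W * 1#) (suc n)
    L∣ : L ∣ ι (ℤ-Forms.form a Q W (suc n)) + - W^P
    L∣ = ∣-swap W^P _ (∣ʳ-respʳ-≈
      (+-cong (form-cong (suc n) refl refl (sym (*-identityʳ (ι W)))) (-‿cong (sym (ι-form a Q W (suc n)))))
      (form-mod (ι a) (ι W * z) (ι Q) (ι W) (suc n)))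
    L⊥P : Coprime L P
    L⊥P = coprime-∣ʳ (ι W ^ suc n , sym (form-scale (ι a) (ι W) z 1# (suc n)))
      (coprime-mod L∣ (coprime-unit unit))

  -- As T = W - Q vanishes, L has its root at z = 1, where (z - 1) P has one zero more than P. The
  -- value P(1) = T makes ℓ = z - 1 divide P, and cancelling ℓ in `euler` leaves `key`: the cofactor
  -- S is coprime to ℓ and separable.
  separable-P-at-1 : NonZeroDivisor P → ι W ∣ 1# → ι T ≈ 0# → Separable P
  separable-P-at-1 P-nzd W-unit T≈0 =
    coprime-resp P≈ (δ-cong P≈) (separable-solve (κ * z + κ * z) (δ S) ℓ (κ * z + κ * z)
      (coprime-resp refl (sym δz-1) (coprime-*ʳ (coprime-unit κ-unit) (coprime-sym (coprime-∣ʳ ℓ∣P (coprime-sym P⊥z)))))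
      (⊥G W-unit ℓ∣P) (⊥G W-unit (ℓ , P≈))
      (trans (+-congˡ (*-comm _ _)) key) (trans (+-comm _ _) key))
    where
    ℓ = z + - 1#
    ℓ∣P : ℓ ∣ P
    ℓ∣P = ∣ʳ-respʳ-≈ (trans (+-congˡ (trans (-‿cong form≈0) -0#≈0#)) (+-identityʳ P)) (form-mod (ι a) z 1# 1# (suc n))
      where
      form≈0 : form (ι a) 1# 1# (suc n) ≈ 0#
      form≈0 = trans (form-diagonal (ι a) 1# (suc n)) (trans (*-congˡ (trans (sym T≈) T≈0)) (zeroʳ _))
    S = proj₁ (∣⇒∃ ℓ∣P)
    P≈ : ℓ * S ≈ P
    P≈ = trans (*-comm ℓ S) (proj₂ (∣⇒∃ ℓ∣P))
    δP≈ : δ P ≈ κ * z * S + ℓ * δ S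
    δP≈ = trans (δ-cong (sym P≈)) (trans (δ-* ℓ S) (+-congʳ (*-congʳ δz-1)))
    euler′ : κ * z * (ℓ * S) + ℓ * (κ * z * S + ℓ * δ S) ≈ κ * z ^ suc n * (ι W * z + - ι W)
    euler′ = begin
      κ * z * (ℓ * S) + ℓ * (κ * z * S + ℓ * δ S)    ≈⟨ +-cong (*-congˡ P≈) (*-congˡ (sym δP≈)) ⟩
      κ * z * P + ℓ * δ P                            ≈⟨ euler ⟩
      κ * z ^ suc n * (ι W * z + - ι Q)              ≈⟨ *-congˡ (+-congˡ (-‿cong W≈Q)) ⟨
      κ * z ^ suc n * (ι W * z + - ι W)              ∎
      where
      W≈Q : ι W ≈ ι Q
      W≈Q = x-y≈0⇒x≈y (trans (sym T≈W-Q) T≈0)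
    key : (κ * z + κ * z) * S + ℓ * δ S ≈ G
    key = cancelˡ (nonZeroDivisor-∣ ℓ∣P P-nzd) (lin₁ 1# euler′
      (solve 6 (λ κ z S S′ u W → let ℓ = z :+ :- con 1ℤ in
        ℓ :* ((κ :* z :+ κ :* z) :* S :+ ℓ :* S′) :+ con 1ℤ :* (κ :* u :* (W :* z :+ :- W))
          := ℓ :* (κ :* u :* W) :+ con 1ℤ :* (κ :* z :* (ℓ :* S) :+ ℓ :* (κ :* z :* S :+ ℓ :* S′)))
        refl κ z S (δ S) (z ^ suc n) (ι W)))

  module _ (P-nzd : NonZeroDivisor P) (W-unit : ι W ∣ 1#) (T-unit : ι T ∣ 1#)
           (y : ℤ) (Wy≈Q : ι W * ι y ≈ ι Q) (S : Carrier) (P≈ : P ≈ (z + - ι y) * S) where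
    private
      ℓ = z + - ι y
      ℓ∣P : ℓ ∣ P
      ℓ∣P = ∣ʳ-respʳ-≈ (sym P≈) (x∣x*y ℓ S)
      ℓ⊥z : Coprime ℓ z
      ℓ⊥z = coprime-sym (coprime-∣ʳ ℓ∣P (coprime-sym P⊥z))
      ℓ⊥κz : Coprime ℓ (κ * z)
      ℓ⊥κz = coprime-*ʳ (coprime-unit κ-unit) ℓ⊥z
      -- Modulo ℓ the element W (z - 1) equals Q - W = - T, a unit.
      ℓ⊥z-1 : Coprime ℓ (z + - 1#)
      ℓ⊥z-1 = coprime-solve (ι W) (- ι W) (coprime-unit -T-unit) (lin₂ 1# 1# Wy≈Q T≈W-Q
        (solve 5 (λ W z y Q T → (W :* (z :+ :- con 1ℤ) :+ (:- W) :* (z :+ :- y)) :+ (con 1ℤ :* Q :+ con 1ℤ :* (W :+ :- Q))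
          := (:- T) :+ (con 1ℤ :* (W :* y) :+ con 1ℤ :* T)) refl (ι W) z (ι y) (ι Q) (ι T)))
        where
        -T-unit : - ι T ∣ 1#
        -T-unit = let q , e = T-unit in - q , trans (solve 2 (λ q t → :- q :* :- t := q :* t) refl q (ι T)) e
      δP≈ : δ P ≈ κ * z * S + ℓ * δ S
      δP≈ = trans (δ-cong P≈) (trans (δ-* ℓ S) (+-congʳ (*-congʳ (trans (δ-shift z y) δz≈κz))))
      euler′ : κ * z * (ℓ * S) + (z + - 1#) * (κ * z * S + ℓ * δ S) ≈ κ * z ^ suc n * (ι W * z + - (ι W * ι y))
      euler′ = begin
        κ * z * (ℓ * S) + (z + - 1#) * (κ * z * S + ℓ * δ S)   ≈⟨ +-cong (*-congˡ (sym P≈)) (*-congˡ (sym δP≈)) ⟩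
        κ * z * P + (z + - 1#) * δ P                           ≈⟨ euler ⟩
        κ * z ^ suc n * (ι W * z + - ι Q)                      ≈⟨ *-congˡ (+-congˡ (-‿cong Wy≈Q)) ⟨
        κ * z ^ suc n * (ι W * z + - (ι W * ι y))              ∎

    -- Modulo ℓ every term of `euler` vanishes except (z - 1) κ z S, and ℓ is coprime to (z - 1) κ
    -- z.
    root-double : z + - ι y ∣ S
    root-double = coprime⇒∣ (coprime-*ʳ ℓ⊥z-1 ℓ⊥κz)
      (κ * z ^ suc n * ι W + - (κ * z * S + (z + - 1#) * δ S) , lin₁ (- 1#) euler′
        (solve 7 (λ κ z y S S′ u W → let ℓ = z :+ :- y in
          (κ :* u :* W :+ :- (κ :* z :* S :+ (z :+ :- con 1ℤ) :* S′)) :* ℓ :+ (:- con 1ℤ) :* (κ :* u :* (W :* z :+ :- (W :* y)))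
            := ((z :+ :- con 1ℤ) :* (κ :* z)) :* S :+ (:- con 1ℤ) :* (κ :* z :* (ℓ :* S) :+ (z :+ :- con 1ℤ) :* (κ :* z :* S :+ ℓ :* S′)))
          refl κ z (ι y) S (δ S) (z ^ suc n) (ι W)))

    -- Putting S = ℓ H and cancelling ℓ once more turns `euler` into `key`. Grouped by H and ℓ it
    -- makes these two coprime; grouped by δ H and H it makes H separable.
    separable-S : Separable S
    separable-S = coprime-resp S≈ (δ-cong S≈) (separable-solve
      ((z + - 1#) * (κ * z + κ * z)) (κ * z * H + (z + - 1#) * δ H)
      ((z + - 1#) * ℓ) (κ * z * ℓ + (z + - 1#) * (κ * z + κ * z))
      (coprime-resp refl (sym (trans (δ-shift z y) δz≈κz)) ℓ⊥κz)
      (⊥G W-unit ℓ∣P) (⊥G W-unit H∣P) (trans (lem₁ _ _ _ _ _) key) (trans (lem₂ _ _ _ _ _) key))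
      where
      H = proj₁ (∣⇒∃ root-double)
      S≈ : ℓ * H ≈ S
      S≈ = trans (*-comm ℓ H) (proj₂ (∣⇒∃ root-double))
      H∣P : H ∣ P
      H∣P = ∣ʳ-trans (ℓ , S≈) (ℓ , sym P≈)
      δS≈ : δ S ≈ κ * z * H + ℓ * δ H
      δS≈ = trans (δ-cong (sym S≈)) (trans (δ-* ℓ H) (+-congʳ (*-congʳ (trans (δ-shift z y) δz≈κz))))
      key : κ * z * (ℓ * H) + (z + - 1#) * (κ * z * H + (κ * z * H + ℓ * δ H)) ≈ G
      key = cancelˡ (nonZeroDivisor-∣ ℓ∣P P-nzd) (lin₃ 1# (κ * z * ℓ + (z + - 1#) * (κ * z)) ((z + - 1#) * ℓ) euler′ S≈ (sym δS≈)
        (solve 9 (λ κ z y S S′ u W H H′ → let ℓ = z :+ :- y ; v = z :+ :- con 1ℤ in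
          ℓ :* (κ :* z :* (ℓ :* H) :+ v :* (κ :* z :* H :+ (κ :* z :* H :+ ℓ :* H′)))
            :+ (con 1ℤ :* (κ :* u :* (W :* z :+ :- (W :* y)))
              :+ ((κ :* z :* ℓ :+ v :* (κ :* z)) :* S :+ v :* ℓ :* S′))
          := ℓ :* (κ :* u :* W)
            :+ (con 1ℤ :* (κ :* z :* (ℓ :* S) :+ v :* (κ :* z :* S :+ ℓ :* S′))
              :+ ((κ :* z :* ℓ :+ v :* (κ :* z)) :* (ℓ :* H) :+ v :* ℓ :* (κ :* z :* H :+ ℓ :* H′))))
          refl κ z (ι y) S (δ S) (z ^ suc n) (ι W) H (δ H)))
      lem₁ : ∀ κz ℓ v H H′ → (v * (κz + κz)) * H + (κz * H + v * H′) * ℓ ≈ κz * (ℓ * H) + v * (κz * H + (κz * H + ℓ * H′))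
      lem₁ = solve 5 (λ κz ℓ v H H′ → (v :* (κz :+ κz)) :* H :+ (κz :* H :+ v :* H′) :* ℓ
        := κz :* (ℓ :* H) :+ v :* (κz :* H :+ (κz :* H :+ ℓ :* H′))) refl
      lem₂ : ∀ κz ℓ v H H′ → (v * ℓ) * H′ + (κz * ℓ + v * (κz + κz)) * H ≈ κz * (ℓ * H) + v * (κz * H + (κz * H + ℓ * H′))
      lem₂ = solve 5 (λ κz ℓ v H H′ → (v :* ℓ) :* H′ :+ (κz :* ℓ :+ v :* (κz :+ κz)) :* H
        := κz :* (ℓ :* H) :+ v :* (κz :* H :+ (κz :* H :+ ℓ :* H′))) refl


-- ℤ[x]: the Euler operator, degrees, division by monic polynomials

ℤ[X] : CommutativeRing 0ℓ 0ℓ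
ℤ[X] = PolynomialRing.commutativeRing ℤP.+-*-commutativeRing

module Zx where
  open PolynomialRing ℤP.+-*-commutativeRing public
    using (Poly; coeff; C; X; _≋_; coeffwise; at; coeff-+; coeff-∙; coeff-neg; _∙ₚ_; ∷-cong; ∷-zero; tail-≈)
  open RingKit ℤ[X] public

open Zx public using (Poly; coeff; C; X; _≋_; coeffwise; at; _∙ₚ_)

coeff-C* : ∀ a f i → coeff (C a Zx.* f) i ≡ a ℤ.* coeff f i
coeff-C* a f i = ≡.trans (Zx.coeff-+ (a ∙ₚ f) (0ℤ ∷ []) i)
  (≡.trans (≡.cong₂ ℤ._+_ (Zx.coeff-∙ a f i) (zero-coeff i)) (ℤP.+-identityʳ _))
  where
  zero-coeff : ∀ i → coeff (0ℤ ∷ []) i ≡ 0ℤ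
  zero-coeff zero    = ≡.refl
  zero-coeff (suc i) = ≡.refl

∙≋C* : ∀ c f → c ∙ₚ f ≋ C c Zx.* f
∙≋C* c f = coeffwise λ i → ≡.trans (Zx.coeff-∙ c f i) (≡.sym (coeff-C* c f i))

C-* : ∀ a b → C (a ℤ.* b) ≋ C a Zx.* C b
C-* a b = coeffwise λ where
  zero    → ≡.sym (coeff-C* a (C b) 0)
  (suc i) → ≡.sym (≡.trans (coeff-C* a (C b) (suc i)) (ℤP.*-zeroʳ a))

C≋ι : ∀ c → C c ≋ Zx.ι c
C≋ι (+ n)    = nonneg n
  where
  nonneg : ∀ n → C (+ n) ≋ Zx.ι (+ n)
  nonneg zero    = Zx.∷-zero ≡.refl Zx.refl
  nonneg (suc n) = Zx.trans (Zx.+-congˡ (nonneg n)) (Zx.sym (Zx.ι-+ 1ℤ (+ n)))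
C≋ι -[1+ n ] = Zx.-‿cong (C≋ι (+ suc n))

C-^ : ∀ c n → C (c ℤ.^ n) ≋ C c Zx.^ n
C-^ c zero    = Zx.refl
C-^ c (suc n) = Zx.trans (C-* c (c ℤ.^ n)) (Zx.*-congˡ {C c} (C-^ c n))

coeff-X*-zero : ∀ f → coeff (X Zx.* f) 0 ≡ 0ℤ
coeff-X*-zero f = ≡.trans (at (Zx.*-comm X f) 0) (lem f)
  where
  lem : ∀ f → coeff (f Zx.* X) 0 ≡ 0ℤ
  lem []      = ≡.refl
  lem (a ∷ f) = ≡.trans (ℤP.+-identityʳ (a ℤ.* 0ℤ)) (ℤP.*-zeroʳ a)

X* : ∀ f → X Zx.* f ≋ 0ℤ ∷ f
X* f = Zx.trans (PolynomialRing.shift-*ₚ ℤP.+-*-commutativeRing (1ℤ ∷ []) f)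
  (Zx.∷-cong ≡.refl (Zx.*-identityˡ f))

∷≋C+X* : ∀ a f → a ∷ f ≋ C a Zx.+ X Zx.* f
∷≋C+X* a f = Zx.trans (Zx.∷-cong (≡.sym (ℤP.+-identityʳ a)) Zx.refl) (Zx.+-congˡ {C a} (Zx.sym (X* f)))

-- The Euler operator x d/dx, in the form δ (a + x f) = x (f + δ f).
δ : Poly → Poly
δ []      = []
δ (a ∷ f) = 0ℤ ∷ f Zx.+ δ f

coeff-δ : ∀ f i → coeff (δ f) i ≡ + i ℤ.* coeff f i
coeff-δ []      i       = ≡.sym (ℤP.*-zeroʳ (+ i))
coeff-δ (a ∷ f) zero    = ≡.refl
coeff-δ (a ∷ f) (suc i) = ≡.trans (Zx.coeff-+ f (δ f) i) (≡.trans
  (≡.cong (λ y → coeff f i ℤ.+ y) (coeff-δ f i)) (≡.sym (ℤP.suc-* (+ i) (coeff f i))))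

δ-cong : ∀ {f g} → f ≋ g → δ f ≋ δ g
δ-cong {f} {g} e = coeffwise λ i →
  ≡.trans (coeff-δ f i) (≡.trans (≡.cong (+ i ℤ.*_) (at e i)) (≡.sym (coeff-δ g i)))

δ-+ : ∀ f g → δ (f Zx.+ g) ≋ δ f Zx.+ δ g
δ-+ f g = coeffwise λ i → begin
  coeff (δ (f Zx.+ g)) i                              ≡⟨ coeff-δ (f Zx.+ g) i ⟩
  + i ℤ.* coeff (f Zx.+ g) i                          ≡⟨ ≡.cong (+ i ℤ.*_) (Zx.coeff-+ f g i) ⟩
  + i ℤ.* (coeff f i ℤ.+ coeff g i)                   ≡⟨ ℤP.*-distribˡ-+ (+ i) _ _ ⟩
  + i ℤ.* coeff f i ℤ.+ + i ℤ.* coeff g i             ≡⟨ ≡.cong₂ ℤ._+_ (coeff-δ f i) (coeff-δ g i) ⟨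
  coeff (δ f) i ℤ.+ coeff (δ g) i                     ≡⟨ Zx.coeff-+ (δ f) (δ g) i ⟨
  coeff (δ f Zx.+ δ g) i                              ∎
  where open ≡.≡-Reasoning

δ-C* : ∀ a f → δ (C a Zx.* f) ≋ C a Zx.* δ f
δ-C* a f = coeffwise λ i → begin
  coeff (δ (C a Zx.* f)) i              ≡⟨ coeff-δ (C a Zx.* f) i ⟩
  + i ℤ.* coeff (C a Zx.* f) i          ≡⟨ ≡.cong (+ i ℤ.*_) (coeff-C* a f i) ⟩
  + i ℤ.* (a ℤ.* coeff f i)             ≡⟨ x∙yz≈y∙xz (+ i) a _ ⟩
  a ℤ.* (+ i ℤ.* coeff f i)             ≡⟨ ≡.cong (a ℤ.*_) (coeff-δ f i) ⟨
  a ℤ.* coeff (δ f) i                   ≡⟨ coeff-C* a (δ f) i ⟨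
  coeff (C a Zx.* δ f) i                ∎
  where
  open ≡.≡-Reasoning
  open CommutativeSemigroupProperties ℤP.*-commutativeSemigroup using (x∙yz≈y∙xz)

δ-X* : ∀ f → δ (X Zx.* f) ≋ X Zx.* f Zx.+ X Zx.* δ f
δ-X* f = Zx.trans (δ-cong (X* f)) (Zx.sym (Zx.+-cong (X* f) (X* (δ f))))

δ-* : ∀ f g → δ (f Zx.* g) ≋ δ f Zx.* g Zx.+ f Zx.* δ g
δ-* []      g = Zx.refl
δ-* (a ∷ f) g = begin
  δ ((a ∷ f) Zx.* g)
    ≈⟨ δ-cong (trans (*-congʳ (∷≋C+X* a f)) (trans (distribʳ g (C a) (X * f)) (+-congˡ {C a * g} (*-assoc X f g)))) ⟩
  δ (C a * g + X * (f * g))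
    ≈⟨ trans (δ-+ (C a * g) (X * (f * g))) (+-cong (δ-C* a g) (δ-X* (f * g))) ⟩
  C a * δ g + (X * (f * g) + X * δ (f * g))
    ≈⟨ +-congˡ {C a * δ g} (+-congˡ {X * (f * g)} (*-congˡ {X} (δ-* f g))) ⟩
  C a * δ g + (X * (f * g) + X * (δ f * g + f * δ g))
    ≈⟨ leibniz (C a) X f g (δ f) (δ g) ⟩
  (X * f + X * δ f) * g + (C a + X * f) * δ g
    ≈⟨ +-cong (*-congʳ (sym (+-cong (X* f) (X* (δ f))))) (*-congʳ (∷≋C+X* a f)) ⟨
  δ (a ∷ f) * g + (a ∷ f) * δ g ∎
  where
  open Zx
  leibniz : ∀ c x f g f′ g′ → c * g′ + (x * (f * g) + x * (f′ * g + f * g′)) ≋ (x * f + x * f′) * g + (c + x * f) * g′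
  leibniz = solve 6 (λ c x f g f′ g′ → c :* g′ :+ (x :* (f :* g) :+ x :* (f′ :* g :+ f :* g′))
    := (x :* f :+ x :* f′) :* g :+ (c :+ x :* f) :* g′) refl

δ-isDerivation : IsDerivation ℤ[X] δ
δ-isDerivation = record { δ-cong = δ-cong ; δ-+ = δ-+ ; δ-* = δ-* }


record DegreeBelow (d : ℕ) (f : Poly) : Set where
  constructor below
  field vanish : ∀ i → d ℕ.≤ i → coeff f i ≡ 0ℤ
open DegreeBelow public

-- The top coefficient a may vanish.
HasTop : Poly → ℕ → ℤ → Set
HasTop f d a = coeff f d ≡ a × DegreeBelow (suc d) f

degreeBelow-resp : ∀ {d f g} → f ≋ g → DegreeBelow d f → DegreeBelow d g
degreeBelow-resp e b = below λ i d≤i → ≡.trans (≡.sym (at e i)) (vanish b i d≤i)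

degreeBelow-length : ∀ f → DegreeBelow (List.length f) f
degreeBelow-length []      = below λ _ _ → ≡.refl
degreeBelow-length (a ∷ f) = below λ { (suc i) (s≤s l) → vanish (degreeBelow-length f) i l }

degreeBelow-+ : ∀ {d f g} → DegreeBelow d f → DegreeBelow d g → DegreeBelow d (f Zx.+ g)
degreeBelow-+ {f = f} {g} b c = below λ i d≤i → ≡.trans (Zx.coeff-+ f g i) (≡.cong₂ ℤ._+_ (vanish b i d≤i) (vanish c i d≤i))

degreeBelow-neg : ∀ {d f} → DegreeBelow d f → DegreeBelow d (Zx.- f)
degreeBelow-neg {f = f} b = below λ i d≤i → ≡.trans (Zx.coeff-neg f i) (≡.cong ℤ.-_ (vanish b i d≤i))

degreeBelow-C* : ∀ {d} c {f} → DegreeBelow d f → DegreeBelow d (C c Zx.* f)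
degreeBelow-C* c {f} b = below λ i d≤i →
  ≡.trans (coeff-C* c f i) (≡.trans (≡.cong (c ℤ.*_) (vanish b i d≤i)) (ℤP.*-zeroʳ c))

degreeBelow-mono : ∀ {d e f} → d ℕ.≤ e → DegreeBelow d f → DegreeBelow e f
degreeBelow-mono d≤e b = below λ i e≤i → vanish b i (ℕP.≤-trans d≤e e≤i)

degreeBelow-0 : ∀ {f} → DegreeBelow 0 f → f ≋ []
degreeBelow-0 b = coeffwise λ i → vanish b i z≤n

degreeBelow-suc : ∀ {d f} → coeff f d ≡ 0ℤ → DegreeBelow (suc d) f → DegreeBelow d f
degreeBelow-suc {d} {f} e b = below λ i d≤i → step i (ℕP.m≤n⇒m<n∨m≡n d≤i)
  where
  step : ∀ i → (d ℕ.< i) ⊎ (d ≡ i) → coeff f i ≡ 0ℤ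
  step i (inj₁ d<i)    = vanish b i d<i
  step i (inj₂ ≡.refl) = e

degreeBelow-∷ : ∀ {d a f} → DegreeBelow d f → DegreeBelow (suc d) (a ∷ f)
degreeBelow-∷ b = below λ { (suc i) (s≤s l) → vanish b i l }

degreeBelow-tail : ∀ {d a f} → DegreeBelow (suc d) (a ∷ f) → DegreeBelow d f
degreeBelow-tail b = below λ i l → vanish b (suc i) (s≤s l)

hasTop-resp : ∀ {f g d a} → f ≋ g → HasTop f d a → HasTop g d a
hasTop-resp {d = d} e (t , b) = ≡.trans (≡.sym (at e d)) t , degreeBelow-resp e b

hasTop-C : ∀ c → HasTop (C c) 0 c
hasTop-C c = ≡.refl , below λ { (suc i) _ → ≡.refl }

degreeBelow⇒top : ∀ {f d} → DegreeBelow d f → HasTop f d 0ℤ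
degreeBelow⇒top {d = d} b = vanish b d ℕP.≤-refl , degreeBelow-mono (ℕP.n≤1+n d) b

top⇒degreeBelow : ∀ {f d} → HasTop f d 0ℤ → DegreeBelow d f
top⇒degreeBelow (t , b) = degreeBelow-suc t b

hasTop-+ : ∀ {f g d a b} → HasTop f d a → HasTop g d b → HasTop (f Zx.+ g) d (a ℤ.+ b)
hasTop-+ {f} {g} {d} (t , b) (t′ , b′) =
  ≡.trans (Zx.coeff-+ f g d) (≡.cong₂ ℤ._+_ t t′) , degreeBelow-+ b b′

hasTop-neg : ∀ {f d a} → HasTop f d a → HasTop (Zx.- f) d (ℤ.- a)
hasTop-neg {f} {d} (t , b) = ≡.trans (Zx.coeff-neg f d) (≡.cong ℤ.-_ t) , degreeBelow-neg b

hasTop-* : ∀ f {g d e a b} → HasTop f d a → HasTop g e b → HasTop (f Zx.* g) (d ℕ.+ e) (a ℤ.* b)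
hasTop-* []      {b = b} (≡.refl , _) _ = ≡.refl , below λ _ _ → ≡.refl
hasTop-* (c ∷ f) {g} {zero} {e} {a} {b} (c≡a , low) (t , bg) =
  hasTop-resp (Zx.sym (Zx.*-congʳ {g} f≋C)) (≡.trans (coeff-C* a g e) (≡.cong (a ℤ.*_) t) , degreeBelow-C* a bg)
  where
  f≋C : c ∷ f ≋ C a
  f≋C = Zx.∷-cong c≡a (coeffwise λ i → vanish low (suc i) (s≤s z≤n))
hasTop-* (c ∷ f) {g} {suc d} {e} {a} {b} (t , low) tg@(_ , bg) =
  hasTop-resp (Zx.sym (Zx.trans (Zx.*-congʳ {g} (∷≋C+X* c f)) (Zx.trans (Zx.distribʳ g (C c) (X Zx.* f))
      (Zx.+-congˡ {C c Zx.* g} (Zx.trans (Zx.*-assoc X f g) (X* (f Zx.* g)))))))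
    (≡.subst (HasTop _ _) (ℤP.+-identityˡ (a ℤ.* b))
      (hasTop-+ (degreeBelow⇒top (degreeBelow-mono (s≤s (ℕP.m≤n+m e d)) (degreeBelow-C* c bg)))
        (let t′ , b′ = hasTop-* f (t , degreeBelow-tail low) tg in t′ , degreeBelow-∷ b′)))

hasTop-^ : ∀ {f d a} → HasTop f d a → ∀ n → HasTop (f Zx.^ n) (n ℕ.* d) (a ℤ.^ n)
hasTop-^ t zero = hasTop-C 1ℤ
hasTop-^ {f} t (suc n) = hasTop-* f t (hasTop-^ t n)

hasTop-X^ : ∀ n → HasTop (X Zx.^ n) n 1ℤ
hasTop-X^ n = ≡.subst₂ (HasTop _) (ℕP.*-identityʳ n) (ℤP.^-zeroˡ n)
  (hasTop-^ (≡.refl , below λ { (suc (suc i)) _ → ≡.refl ; (suc zero) (s≤s ()) }) n)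

-- A bound n on the degree of q is lowered step by step: the coefficient of q at n equals that of q
-- F at n + d, which vanishes.
multiple-low⇒0 : ∀ {F d} → HasTop F d 1ℤ → ∀ q → DegreeBelow d (q Zx.* F) → q ≋ []
multiple-low⇒0 {F} {d} top q low = go (List.length q) (degreeBelow-length q)
  where
  go : ∀ n → DegreeBelow n q → q ≋ []
  go zero    b = degreeBelow-0 b
  go (suc n) b = go n (degreeBelow-suc
    (≡.trans (≡.sym (ℤP.*-identityʳ _)) (≡.trans (≡.sym (proj₁ (hasTop-* q (≡.refl , b) top))) (vanish low (n ℕ.+ d) (ℕP.m≤n+m d n)))) b)

low-multiple⇒0 : ∀ {F d} → HasTop F d 1ℤ → ∀ {s} → DegreeBelow d s → F Zx.∣ s → s ≋ []
low-multiple⇒0 {F} top {s} low F∣s = Zx.trans (Zx.sym eq) (Zx.*-congʳ {F}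
  (multiple-low⇒0 top q (degreeBelow-resp (Zx.sym eq) low)))
  where
  q = proj₁ (Zx.∣⇒∃ F∣s)
  eq : q Zx.* F ≋ s
  eq = proj₂ (Zx.∣⇒∃ F∣s)

-- Dividing the tail first leaves c + x s of degree at most d, and a single subtraction of l F
-- restores the bound on the remainder.
divide : ∀ {F d} → HasTop F d 1ℤ → ∀ a → ∃[ q ] ∃[ s ] a ≋ q Zx.* F Zx.+ s × DegreeBelow d s
divide top [] = [] , [] , Zx.refl , below λ _ _ → ≡.refl
divide {F} {d} top (c ∷ a) with divide top a
... | q , s , e , low = (l ∷ q) , s′ , eq , top⇒degreeBelow (≡.subst (HasTop s′ d) (ℤP.+-inverseʳ l)
        (hasTop-+ {c ∷ s} {Zx.- (C l Zx.* F)} (≡.refl , degreeBelow-∷ low)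
          (hasTop-neg {C l Zx.* F} (≡.subst (HasTop (C l Zx.* F) d) (ℤP.*-identityʳ l) (hasTop-* (C l) (hasTop-C l) top)))))
  where
  l : ℤ
  l = coeff (c ∷ s) d
  s′ : Poly
  s′ = (c ∷ s) Zx.+ Zx.- (C l Zx.* F)
  eq : c ∷ a ≋ (l ∷ q) Zx.* F Zx.+ s′
  eq = begin
    c ∷ a                                               ≈⟨ ∷≋C+X* c a ⟩
    C c + X * a                                         ≈⟨ +-congˡ {C c} (*-congˡ {X} e) ⟩
    C c + X * (q * F + s)                               ≈⟨ lem (C c) X q F s (C l) ⟩
    (C l + X * q) * F + ((C c + X * s) + - (C l * F))   ≈⟨ +-cong (*-congʳ {F} (∷≋C+X* l q)) (+-congʳ {x = - (C l * F)} (∷≋C+X* c s)) ⟨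
    (l ∷ q) * F + s′                                    ∎
    where
    open Zx
    lem : ∀ c x q F s l → c + x * (q * F + s) ≋ (l + x * q) * F + ((c + x * s) + - (l * F))
    lem = solve 6 (λ c x q F s l → c :+ x :* (q :* F :+ s) := (l :+ x :* q) :* F :+ ((c :+ x :* s) :+ :- (l :* F))) refl

ℤ[X]/ : Poly → CommutativeRing 0ℓ 0ℓ
ℤ[X]/ F = Quotient.ring/ ℤ[X] F

ι-quotient : ∀ R a c → RingKit.ι (Quotient.ring/ R a) c ≡ RingKit.ι R c
ι-quotient R a = λ { (+ n) → nonneg n ; -[1+ n ] → ≡.cong (CommutativeRing.-_ R) (nonneg (suc n)) }
  where
  nonneg : ∀ n → RingKit.ι (Quotient.ring/ R a) (+ n) ≡ RingKit.ι R (+ n)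
  nonneg zero          = ≡.refl
  nonneg (suc zero)    = ≡.refl
  nonneg (suc (suc n)) = ≡.cong (λ y → CommutativeRing._+_ R y (CommutativeRing.1# R)) (nonneg (suc n))

-- ℤ[x]/(F) is free over ℤ on the powers of x below d. Concretely, c times the remainder s of a is a
-- multiple of F of degree below d, so c s = 0 and s = 0.
constant-nonZeroDivisor : ∀ {F d} → HasTop F d 1ℤ → ∀ c → c ≢ 0ℤ → RingKit.NonZeroDivisor (ℤ[X]/ F) (C c)
constant-nonZeroDivisor {F} {d} top c c≢0 a ca≈0 with divide top a
... | q , s , e , low = ∣⇒≈0 F∣a
  where
  open Zx
  open Quotient ℤ[X] F using (≈0⇒∣; ∣⇒≈0)
  F∣cs : F ∣ C c * s
  F∣cs = ∣ʳ-respʳ-≈ (trans (+-congʳ {x = - (C c * (q * F))} (*-congˡ {C c} e)) (lem (C c) q F s))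
    (∣-+ (≈0⇒∣ ca≈0) (∣-neg (∣-*ˡ (C c) (∣-*ˡ q ∣ʳ-refl))))
    where
    lem : ∀ c q F s → c * (q * F + s) + - (c * (q * F)) ≋ c * s
    lem = solve 4 (λ c q F s → c :* (q :* F :+ s) :+ :- (c :* (q :* F)) := c :* s) refl
  s≋0 : s ≋ []
  s≋0 = coeffwise λ i → [ (λ c≡0 → contradiction c≡0 c≢0) , id ]′ (ℤP.i*j≡0⇒i≡0∨j≡0 c
    (≡.trans (≡.sym (coeff-C* c s i)) (at (low-multiple⇒0 top (degreeBelow-C* c low) F∣cs) i)))
  F∣a : F ∣ a
  F∣a = q , sym (trans e (trans (+-congˡ {q * F} s≋0) (+-identityʳ (q * F))))


-- Divisibility in ℤ and arithmetic in 𝔽_p[x]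

infix 5 _∣ℤ_
_∣ℤ_ : ℤ → ℤ → Set
_∣ℤ_ = ℤ-Ring._∣_

∣ℤ⇒∣ : ∀ {c x} → c ∣ℤ x → ∣ c ∣ ℕDiv.∣ ∣ x ∣
∣ℤ⇒∣ {c} d = let q , e = ℤ-Ring.∣⇒∃ d in ℕDiv.divides ∣ q ∣ (≡.trans (≡.cong ∣_∣ (≡.sym e)) (ℤP.abs-* q c))

∣⇒∣ℤ : ∀ {c x} → ∣ c ∣ ℕDiv.∣ ∣ x ∣ → c ∣ℤ x
∣⇒∣ℤ {c} {x} d with ℤDivS.∣ᵤ⇒∣ {c} {x} d
... | ℤDivS.divides q e = q ℤ-Ring., ≡.sym e

infix 5 _∣ℤ?_
_∣ℤ?_ : ∀ c x → Dec (c ∣ℤ x)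
c ∣ℤ? x = Dec.map′ ∣⇒∣ℤ ∣ℤ⇒∣ (∣ c ∣ ℕDiv.∣? ∣ x ∣)

prime-∣ℤ : ∀ {p} → Prime p → ∀ x y → + p ∣ℤ x ℤ.* y → (+ p ∣ℤ x) ⊎ (+ p ∣ℤ y)
prime-∣ℤ pr x y d with euclidsLemma ∣ x ∣ ∣ y ∣ pr (≡.subst (_ ℕDiv.∣_) (ℤP.abs-* x y) (∣ℤ⇒∣ d))
... | inj₁ e = inj₁ (∣⇒∣ℤ e)
... | inj₂ e = inj₂ (∣⇒∣ℤ e)

prime-∣ℤ-^ : ∀ {p} → Prime p → ∀ x n → + p ∣ℤ x ℤ-Ring.^ n → + p ∣ℤ x
prime-∣ℤ-^ {p} pr x zero    d = ∣⇒∣ℤ (ℕDiv.∣-trans (∣ℤ⇒∣ d) (ℕDiv.1∣ ∣ x ∣))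
prime-∣ℤ-^     pr x (suc n) d = [ id , prime-∣ℤ-^ pr x n ]′ (prime-∣ℤ pr x (x ℤ-Ring.^ n) d)

private
  bezout-sub : ∀ u v x y → 1ℤ ℤ.+ v ℤ.* y ≡ u ℤ.* x → u ℤ.* x ℤ.+ ℤ.- v ℤ.* y ≡ 1ℤ
  bezout-sub u v x y e = lin₁ ℤ.-1ℤ e (solve 4 (λ u v x y →
    (u :* x :+ :- v :* y) :+ :- con 1ℤ :* (u :* x) := con 1ℤ :+ :- con 1ℤ :* (con 1ℤ :+ v :* y)) ≡.refl u v x y)
    where open ℤ-Ring

coprime-ℤ : ∀ x y → Coprimality.Coprime ∣ x ∣ ∣ y ∣ → ℤ-Ring.Coprime x y
coprime-ℤ x y c with coprimality (Coprimality.coprime-Bézout c) | abs-sign x | abs-sign y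
  where
  coprimality : GCD.Bézout.Identity 1 ∣ x ∣ ∣ y ∣ → ∃[ u ] ∃[ v ] u ℤ.* + ∣ x ∣ ℤ.+ v ℤ.* + ∣ y ∣ ≡ 1ℤ
  coprimality (GCD.Bézout.+- u v e) = + u , ℤ.- + v , bezout-sub (+ u) (+ v) (+ ∣ x ∣) (+ ∣ y ∣)
    (≡.trans (≡.cong (λ w → 1ℤ ℤ.+ w) (≡.sym (ℤP.pos-* v ∣ y ∣))) (≡.trans (≡.cong +_ e) (ℤP.pos-* u ∣ x ∣)))
  coprimality (GCD.Bézout.-+ u v e) = ℤ.- + u , + v , ≡.trans (ℤP.+-comm (ℤ.- + u ℤ.* + ∣ x ∣) _) (bezout-sub (+ v) (+ u) (+ ∣ y ∣) (+ ∣ x ∣)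
    (≡.trans (≡.cong (λ w → 1ℤ ℤ.+ w) (≡.sym (ℤP.pos-* u ∣ x ∣))) (≡.trans (≡.cong +_ e) (ℤP.pos-* v ∣ y ∣))))
  abs-sign : ∀ x → ∃[ s ] + ∣ x ∣ ≡ s ℤ.* x
  abs-sign (+ n)    = 1ℤ , ≡.sym (ℤP.*-identityˡ (+ n))
  abs-sign -[1+ n ] = ℤ.-1ℤ , ≡.sym (ℤP.-1*i≡-i -[1+ n ])
... | u , v , e | s , es | t , et = u ℤ.* s , v ℤ.* t , ≡.trans
  (≡.cong₂ ℤ._+_ (≡.trans (ℤP.*-assoc u s x) (≡.cong (u ℤ.*_) (≡.sym es))) (≡.trans (ℤP.*-assoc v t y) (≡.cong (v ℤ.*_) (≡.sym et)))) e

prime-coprime : ∀ {p} → Prime p → ∀ c → ¬ (+ p ∣ℤ c) → ℤ-Ring.Coprime c (+ p)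
prime-coprime {p} pr c p∤c = coprime-ℤ c (+ p) λ {d} (d∣c , d∣p) →
  [ id , (λ d≡p → contradiction (∣⇒∣ℤ (≡.subst (ℕDiv._∣ ∣ c ∣) d≡p d∣c)) p∤c) ]′ (prime⇒irreducible pr d∣p)

Cp∣⇒coeff : ∀ {c f} → C c Zx.∣ f → ∀ i → c ∣ℤ coeff f i
Cp∣⇒coeff {c} {f} d i = coeff q i ℤ-Ring., ≡.trans (ℤP.*-comm (coeff q i) c)
  (≡.trans (≡.sym (coeff-C* c q i)) (at (Zx.trans (Zx.*-comm (C c) q) (proj₂ (Zx.∣⇒∃ d))) i))
  where q = proj₁ (Zx.∣⇒∃ d)

coeff⇒Cp∣ : ∀ {c} f → (∀ i → c ∣ℤ coeff f i) → C c Zx.∣ f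
coeff⇒Cp∣ {c} f d = Zx._,_ (quotients f d) (Zx.trans (Zx.*-comm (quotients f d) (C c)) (coeffwise λ i →
    ≡.trans (coeff-C* c (quotients f d) i) (coeff-quotients f d i)))
  where
  quotients : ∀ f → (∀ i → c ∣ℤ coeff f i) → Poly
  quotients []      d = []
  quotients (a ∷ f) d = proj₁ (ℤ-Ring.∣⇒∃ (d 0)) ∷ quotients f (d ∘ suc)
  coeff-quotients : ∀ f d i → c ℤ.* coeff (quotients f d) i ≡ coeff f i
  coeff-quotients []      d i       = ℤP.*-zeroʳ c
  coeff-quotients (a ∷ f) d zero    = ≡.trans (ℤP.*-comm c _) (proj₂ (ℤ-Ring.∣⇒∃ (d 0)))
  coeff-quotients (a ∷ f) d (suc i) = coeff-quotients f (d ∘ suc) i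

coeff-*-zero : ∀ f g → coeff (f Zx.* g) 0 ≡ coeff f 0 ℤ.* coeff g 0
coeff-*-zero []      g = ≡.refl
coeff-*-zero (a ∷ f) g = ≡.trans (Zx.coeff-+ (a ∙ₚ g) _ 0) (≡.trans (ℤP.+-identityʳ _) (Zx.coeff-∙ a g 0))

module ModPrime (p : ℕ) (pr : Prime p) where

  𝔽p[X] : CommutativeRing 0ℓ 0ℓ
  𝔽p[X] = ℤ[X]/ (C (+ p))

  module Fx where
    open RingKit 𝔽p[X] public

  open Quotient ℤ[X] (C (+ p)) public using (mod; difference; ≈0⇒∣; ∣⇒≈0) renaming (≈⇒≈/ to ≋⇒≈)

  ≈0⇒coeff : ∀ {f} → f Fx.≈ [] → ∀ i → + p ∣ℤ coeff f i
  ≈0⇒coeff d = Cp∣⇒coeff (≈0⇒∣ d)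

  coeff⇒≈0 : ∀ f → (∀ i → + p ∣ℤ coeff f i) → f Fx.≈ []
  coeff⇒≈0 f d = ∣⇒≈0 (coeff⇒Cp∣ f d)

  coeff⇒≈ : ∀ {f g} → (∀ i → + p ∣ℤ coeff f i ℤ.+ ℤ.- coeff g i) → f Fx.≈ g
  coeff⇒≈ {f} {g} d = mod (coeff⇒Cp∣ (f Zx.+ Zx.- g) λ i → ℤ-Ring.∣ʳ-respʳ-≈
    (≡.sym (≡.trans (Zx.coeff-+ f (Zx.- g) i) (≡.cong (λ y → coeff f i ℤ.+ y) (Zx.coeff-neg g i)))) (d i))

  constant-unit : ∀ c → ¬ (+ p ∣ℤ c) → C c Fx.∣ C 1ℤ
  constant-unit c p∤c = let u , v , e = prime-coprime pr c p∤c in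
    Fx._,_ (C u) (Fx.trans (≋⇒≈ (Zx.sym (C-* u c))) (coeff⇒≈ λ where
      zero    → ℤ-Ring._,_ (ℤ.- v) (rearrange u v c (+ p) e)
      (suc i) → ℤ-Ring._∣0 (+ p)))
    where
    rearrange : ∀ u v c p → u ℤ.* c ℤ.+ v ℤ.* p ≡ 1ℤ → ℤ.- v ℤ.* p ≡ u ℤ.* c ℤ.+ ℤ.- 1ℤ
    rearrange u v c p e = lin₁ ℤ.-1ℤ e (solve 4 (λ u v c p →
      :- v :* p :+ :- con 1ℤ :* con 1ℤ := (u :* c :+ :- con 1ℤ) :+ :- con 1ℤ :* (u :* c :+ v :* p)) ≡.refl u v c p)
      where open ℤ-Ring

  ∷≈X* : ∀ {b} f → + p ∣ℤ b → b ∷ f Fx.≈ X Fx.* f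
  ∷≈X* {b} f d = Fx.trans (coeff⇒≈ λ where
      zero    → ℤ-Ring.∣ʳ-respʳ-≈ (≡.sym (ℤP.+-identityʳ b)) d
      (suc i) → ℤ-Ring.∣ʳ-respʳ-≈ (≡.sym (ℤP.+-inverseʳ (coeff f i))) (ℤ-Ring._∣0 (+ p)))
    (≋⇒≈ (Zx.sym (X* f)))

  X*-cancel : ∀ {f} → X Fx.* f Fx.≈ [] → f Fx.≈ []
  X*-cancel {f} d = coeff⇒≈0 f λ i → ℤ-Ring.∣ʳ-respʳ-≈ (at (X* f) (suc i)) (≈0⇒coeff d (suc i))

  -- Lowest terms first: f₀ b ≡ 0 forces p to divide b, so b ∷ g ≡ x g, and cancelling x leaves the
  -- shorter list g.
  constant⇒nonZeroDivisor : ∀ f → ¬ (+ p ∣ℤ coeff f 0) → Fx.NonZeroDivisor f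
  constant⇒nonZeroDivisor f p∤f₀ []      e = Fx.refl
  constant⇒nonZeroDivisor f p∤f₀ (b ∷ g) e = Fx.trans (∷≈X* g p∣b) (Fx.trans
      (Fx.*-congˡ {X} (constant⇒nonZeroDivisor f p∤f₀ g (X*-cancel
        (Fx.trans (≋⇒≈ (x∙yz≈y∙xz X f g)) (Fx.trans (Fx.*-congˡ {f} (Fx.sym (∷≈X* g p∣b))) e)))))
      (Fx.zeroʳ X))
    where
    open CommutativeSemigroupProperties Zx.*-commutativeSemigroup using (x∙yz≈y∙xz)
    p∣b : + p ∣ℤ b
    p∣b = [ (λ d → contradiction d p∤f₀) , id ]′ (prime-∣ℤ pr (coeff f 0) b
      (ℤ-Ring.∣ʳ-respʳ-≈ (coeff-*-zero f (b ∷ g)) (≈0⇒coeff e 0)))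

  -- Factors x are split off from f until its constant term is prime to p, where
  -- `constant⇒nonZeroDivisor` applies.
  zeroDivisor-free : ∀ f g → f Fx.* g Fx.≈ [] → (f Fx.≈ []) ⊎ (g Fx.≈ [])
  zeroDivisor-free []      g e = inj₁ Fx.refl
  zeroDivisor-free (a ∷ f) g e = go (+ p ∣ℤ? a)
    where
    go : Dec (+ p ∣ℤ a) → (a ∷ f Fx.≈ []) ⊎ (g Fx.≈ [])
    go (no  p∤a) = inj₂ (constant⇒nonZeroDivisor (a ∷ f) p∤a g e)
    go (yes p∣a) = Sum.map₁ (λ f≈0 → Fx.trans (∷≈X* f p∣a) (Fx.trans (Fx.*-congˡ {X} f≈0) (Fx.zeroʳ X)))
      (zeroDivisor-free f g (X*-cancel (Fx.trans
          (Fx.sym (Fx.trans (Fx.*-congʳ {g} (∷≈X* f p∣a)) (≋⇒≈ (Zx.*-assoc X f g)))) e)))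

  coprime-X : ∀ f → ¬ (+ p ∣ℤ coeff f 0) → Fx.Coprime f X
  coprime-X []      p∤0 = contradiction (ℤ-Ring._∣0 (+ p)) p∤0
  coprime-X (a ∷ f) p∤a = Fx.coprime-sym (Fx.coprime-mod
    (Fx._,_ (Zx.- f) (≋⇒≈ (Zx.trans (lem (C a) X f) (Zx.+-congˡ {C a} (Zx.-‿cong (Zx.sym (∷≋C+X* a f)))))))
    (Fx.coprime-unit (constant-unit a p∤a)))
    where
    lem : ∀ a x f → Zx.- f Zx.* x ≋ a Zx.+ Zx.- (a Zx.+ x Zx.* f)
    lem = Zx.solve 3 (λ a x f → Zx.:- f Zx.:* x Zx.:= a Zx.:+ Zx.:- (a Zx.:+ x Zx.:* f)) Zx.refl

  -- The Euclidean algorithm on constant terms.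
  coprimeCofactors : ∀ f g → ¬ (+ p ∣ℤ coeff f 0) → Fx.CoprimeCofactors f g
  coprimeCofactors f g = euclid (List.length f ℕ.+ List.length g) f g ℕP.≤-refl
    where
    -- The constant term is cancelled and the resulting factor x set apart. It may be dropped,
    -- because x is invertible modulo a polynomial with unit constant term; so each round shortens
    -- the lists without consulting leading coefficients.
    reduce : ∀ a f b g c → + p ∣ℤ b ℤ.+ ℤ.- (c ℤ.* a) →
             b ∷ g Fx.≈ C c Fx.* (a ∷ f) Fx.+ X Fx.* (g Fx.+ Fx.- (c ∙ₚ f))
    reduce a f b g c d = Fx.trans (coeff⇒≈ λ where
        zero    → ℤ-Ring.∣ʳ-respʳ-≈ (≡.cong (λ y → b ℤ.+ ℤ.- y) (≡.sym (ℤP.+-identityʳ (c ℤ.* a)))) d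
        (suc i) → ℤ-Ring.∣ʳ-respʳ-≈ (≡.sym (cancels i)) (ℤ-Ring._∣0 (+ p)))
      (≋⇒≈ (Zx.+-cong {x = c ∙ₚ (a ∷ f)} (∙≋C* c (a ∷ f)) (Zx.sym (X* (g Zx.+ Zx.- (c ∙ₚ f))))))
      where
      cancels : ∀ i → coeff g i ℤ.+ ℤ.- coeff ((c ∙ₚ f) Zx.+ (g Zx.+ Zx.- (c ∙ₚ f))) i ≡ 0ℤ
      cancels i = ≡.trans (≡.cong (λ y → coeff g i ℤ.+ ℤ.- y) (at (lem (c ∙ₚ f) g) i)) (ℤP.+-inverseʳ (coeff g i))
        where
        lem : ∀ u v → u Zx.+ (v Zx.+ Zx.- u) ≋ v
        lem = solve 2 (λ u v → u :+ (v :+ :- u) := v) refl where open Zx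

    length-sub : ∀ c f g → List.length f ℕ.≤ List.length g → List.length (g Zx.+ Zx.- (c ∙ₚ f)) ≡ List.length g
    length-sub c []      []      l       = ≡.refl
    length-sub c []      (b ∷ g) l       = ≡.refl
    length-sub c (a ∷ f) (b ∷ g) (s≤s l) = ≡.cong suc (length-sub c f g l)

    quotient : ∀ a b → ¬ (+ p ∣ℤ a) → ∃[ c ] + p ∣ℤ b ℤ.+ ℤ.- (c ℤ.* a)
    quotient a b p∤a = let u , v , e = prime-coprime pr a p∤a in b ℤ.* u , ℤ-Ring._,_ (b ℤ.* v)
      (lin₁ b e (solve 5 (λ a b u v p → b :* v :* p :+ b :* con 1ℤ := (b :+ :- (b :* u :* a)) :+ b :* (u :* a :+ v :* p)) ≡.refl a b u v (+ p)))
      where open ℤ-Ring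

    euclid : ∀ N f g → List.length f ℕ.+ List.length g ℕ.≤ N → ¬ (+ p ∣ℤ coeff f 0) → Fx.CoprimeCofactors f g
    euclid N       []      g       l p∤f₀ = contradiction (ℤ-Ring._∣0 (+ p)) p∤f₀
    euclid N       (a ∷ f) []      l p∤f₀ = Fx.coprimeCofactors-0 (a ∷ f)
    euclid (suc N) (a ∷ f) (b ∷ g) (s≤s l) p∤a = step (+ p ∣ℤ? b) (ℕP.≤-total (List.length f) (List.length g))
      where
      m = List.length f
      n = List.length g
      step : Dec (+ p ∣ℤ b) → (m ℕ.≤ n) ⊎ (n ℕ.≤ m) → Fx.CoprimeCofactors (a ∷ f) (b ∷ g)
      step (yes p∣b) _ = Fx.coprimeCofactors-step [] (coprime-X (a ∷ f) p∤a) (∷≈X* g p∣b)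
        (euclid N (a ∷ f) g (ℕP.≤-trans (ℕP.≤-reflexive (≡.sym (ℕP.+-suc m n))) l) p∤a)
      step (no p∤b) (inj₁ m≤n) = Fx.coprimeCofactors-step (C c) (coprime-X (a ∷ f) p∤a) (reduce a f b g c (proj₂ (quotient a b p∤a)))
        (euclid N (a ∷ f) (g Zx.+ Zx.- (c ∙ₚ f)) (ℕP.≤-trans (ℕP.≤-reflexive
          (≡.trans (≡.cong (suc m ℕ.+_) (length-sub c f g m≤n)) (≡.sym (ℕP.+-suc m n)))) l) p∤a)
        where c = proj₁ (quotient a b p∤a)
      -- The roles are exchanged, as b is a unit as well: the subtraction must take place in the
      -- longer list for the total length to fall.
      step (no p∤b) (inj₂ n≤m) = Fx.coprimeCofactors-sym
        (Fx.coprimeCofactors-step (C c) (coprime-X (b ∷ g) p∤b) (reduce b g a f c (proj₂ (quotient b a p∤b)))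
          (euclid N (b ∷ g) (f Zx.+ Zx.- (c ∙ₚ g)) (ℕP.≤-trans (ℕP.≤-reflexive
            (≡.trans (≡.cong (suc n ℕ.+_) (length-sub c g f n≤m)) (ℕP.+-comm (suc n) m))) l) p∤b))
        where c = proj₁ (quotient b a p∤b)


-- Criteria for p-maximality, checked modulo p

quotient-swap : ∀ R {f p a} → RingKit._∣_ (Quotient.ring/ R f) p a → RingKit._∣_ (Quotient.ring/ R p) f a
-- Either divisibility says that a lies in the ideal (p, f): from s f = q p - a, the quotient of a
-- by f modulo p is - s.
quotient-swap R {f} {p} {a} d = E._,_ (- s) (mod (- q , lin₁ 1# es
    (solve 5 (λ q p s f a → :- q :* p :+ con 1ℤ :* (q :* p :+ :- a) := (:- s :* f :+ :- a) :+ con 1ℤ :* (s :* f)) refl q p s f a)))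
  where
  open RingKit R
  module M = RingKit (Quotient.ring/ R f)
  module E = RingKit (Quotient.ring/ R p)
  open Quotient R p using (mod)
  q = proj₁ (M.∣⇒∃ d)
  s = proj₁ (∣⇒∃ (Quotient.difference (proj₂ (M.∣⇒∃ d))))
  es : s * f ≈ q * p + - a
  es = proj₂ (∣⇒∃ (Quotient.difference (proj₂ (M.∣⇒∃ d))))

^-quotient : ∀ R a x n → RingKit._^_ (Quotient.ring/ R a) x n ≡ RingKit._^_ R x n
^-quotient R a x zero    = ≡.refl
^-quotient R a x (suc n) = ≡.cong (CommutativeRing._*_ R x) (^-quotient R a x n)

module QuotientDerivation (S : CommutativeRing 0ℓ 0ℓ) (δ : CommutativeRing.Carrier S → CommutativeRing.Carrier S)
                          (isDerivation : IsDerivation S δ) (p : CommutativeRing.Carrier S)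
                          (δp≈0 : CommutativeRing._≈_ S (δ p) (CommutativeRing.0# S)) where
  open RingKit S
  open Quotient S p
  private module D = IsDerivation isDerivation
  open Derivation S δ isDerivation using (δ-neg)

  δ-cong/ : ∀ {x y} → x ≈/ y → δ x ≈/ δ y
  δ-cong/ {x} {y} (mod d) = let q , e = ∣⇒∃ d in mod (δ q , (begin
    δ q * p                ≈⟨ trans (sym (+-identityʳ _)) (+-congˡ (sym (trans (*-congˡ δp≈0) (zeroʳ q)))) ⟩
    δ q * p + q * δ p      ≈⟨ D.δ-* q p ⟨
    δ (q * p)              ≈⟨ D.δ-cong e ⟩
    δ (x + - y)            ≈⟨ trans (D.δ-+ x (- y)) (+-congˡ (δ-neg y)) ⟩
    δ x + - δ y            ∎))

  isDerivation/ : IsDerivation ring/ δ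
  isDerivation/ = record { δ-cong = δ-cong/ ; δ-+ = λ x y → ≈⇒≈/ (D.δ-+ x y) ; δ-* = λ x y → ≈⇒≈/ (D.δ-* x y) }

  open Derivation ring/ δ isDerivation/ public

module Local (S : CommutativeRing 0ℓ 0ℓ) (f p : CommutativeRing.Carrier S)
             (p-nzd : RingKit.NonZeroDivisor (Quotient.ring/ S f) p) where
  open RingKit S
  open DedekindCriterion (Quotient.ring/ S f) p p-nzd public using (AlmostIntegral)
  private
    module D = DedekindCriterion (Quotient.ring/ S f) p p-nzd
    module M = RingKit (Quotient.ring/ S f)
    module E = RingKit (Quotient.ring/ S p)
    open Quotient S f using () renaming (≈⇒≈/ to ≈⇒≈ᴹ; mod to modᴹ)
    open Quotient S p using () renaming (≈⇒≈/ to ≈⇒≈ᴱ; mod to modᴱ; difference to differenceᴱ)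

    M∣^⇒E : ∀ b j → p M.∣ b M.^ j → f E.∣ b E.^ j
    M∣^⇒E b j d = ≡.subst (f E.∣_) (≡.trans (^-quotient S f b j) (≡.sym (^-quotient S p b j))) (quotient-swap S d)

    E∣^⇒M : ∀ b j → f E.∣ b E.^ j → p M.∣ b M.^ j
    E∣^⇒M b j d = ≡.subst (p M.∣_) (≡.trans (^-quotient S p b j) (≡.sym (^-quotient S f b j))) (quotient-swap S d)

    ≈ᴱ⇒+ : ∀ {x y} → x E.≈ y → ∃[ c ] y ≈ c * p + x
    ≈ᴱ⇒+ {x} {y} e = let q , eq = ∣⇒∃ (differenceᴱ e) in - q , lin₁ 1# eq
      (solve 4 (λ x y q p → y :+ con 1ℤ :* (x :+ :- y) := (:- q :* p :+ x) :+ con 1ℤ :* (q :* p)) refl x y q p)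

    ideal : ∀ h b → h E.∣ b → D.Ideal h b
    ideal h b d = let q , e = E.∣⇒∃ d ; c , e′ = ≈ᴱ⇒+ e in c , q , ≈⇒≈ᴹ e′

  -- Almost integral elements are nilpotent modulo p, and `radical` says that the quotient by (p, f)
  -- is reduced.
  maximal-if-reduced : (∀ b j → f E.∣ b E.^ j → f E.∣ b) → ∀ b → AlmostIntegral b → p M.∣ b
  maximal-if-reduced radical b ai = let j , d = D.almostIntegral⇒nilpotent b ai in
    quotient-swap S (radical b j (M∣^⇒E b j d))

  -- Modulo p, f is an associate of h u, which supplies the annihilator condition: if h u divides h
  -- x then u divides x, since h can be cancelled. The unit w absorbs the factor m^(2n) by which P
  -- differs from ℱ.
  maximal-if-dedekind : ∀ {h u r w} → w * f ≈ h * u + - (p * r) → w E.∣ 1# →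
    E.NonZeroDivisor h → r E.∣ 1# →
    (∀ b j → h E.∣ b E.^ j → h E.∣ b) →
    ∀ N → f E.∣ h E.^ N →
    ∀ b → AlmostIntegral b → p M.∣ b
  maximal-if-dedekind {h} {u} {r} {w} hu w-unit h-nzd r-unit radical N nilpotent =
    let γ , γr≈1 = E.∣⇒∃ r-unit ; κ , e = ≈ᴱ⇒+ γr≈1 in
    D.almostIntegral⇒∣ (modᴹ (w , hu))
      (λ b j d → ideal h b (radical b j (E.∣ʳ-trans (E.∣ʳ-trans (E.x∣x*y h u) hu∣f) (M∣^⇒E b j d))))
      (λ x d → ideal u x (annihilator x (quotient-swap S d)))
      γ κ (≈⇒≈ᴹ (trans (+-comm _ _) (sym e)))
      N (E∣^⇒M h N nilpotent)
    where
    hu∣f : h * u E.∣ f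
    hu∣f = let v , vw≈1 = E.∣⇒∃ w-unit in E._,_ v (E.trans (E.*-congˡ hu≈wf)
        (E.trans (E.sym (E.*-assoc v w f)) (E.trans (E.*-congʳ vw≈1) (E.*-identityˡ f))))
      where
      hu≈wf : h * u E.≈ w * f
      hu≈wf = modᴱ (r , trans (*-comm r p) (lin₁ 1# hu (solve 4 (λ wf h u pr →
        pr :+ con 1ℤ :* (h :* u :+ :- pr) := (h :* u :+ :- wf) :+ con 1ℤ :* wf) refl (w * f) h u (p * r))))
    annihilator : ∀ x → f E.∣ h * x → u E.∣ x
    annihilator x d = let q , e = E.∣⇒∃ (E.∣ʳ-trans hu∣f d) in
      E._,_ q (E.cancelˡ h-nzd (E.trans (≈⇒≈ᴱ (solve 3 (λ h q u → h :* (q :* u) := q :* (h :* u)) refl h q u)) e))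


-- Frobenius and Fermat in characteristic p

prime∤! : ∀ {p} → Prime p → ∀ k → k ℕ.< p → ¬ (p ℕDiv.∣ k ℕ.!)
prime∤! pr zero    0<p d = contradiction (≡.subst Prime (ℕDiv.∣1⇒≡1 d) pr) ¬prime[1]
prime∤! pr (suc k) k<p d = [ (λ e → ℕP.<⇒≱ k<p (ℕDiv.∣⇒≤ e)) , prime∤! pr k (ℕP.<-trans (ℕP.n<1+n k) k<p) ]′
  (euclidsLemma (suc k) (k ℕ.!) pr d)

prime∣C : ∀ {p} → Prime p → ∀ k → 1 ℕ.≤ k → k ℕ.< p → p ℕDiv.∣ p Combinatorics.C k
prime∣C {p@(suc p-1)} pr k 1≤k k<p =
  [ id , (λ d → contradiction d ∤k![p-k]!) ]′ (euclidsLemma (p Combinatorics.C k) (k ℕ.! ℕ.* (p ∸ k) ℕ.!) pr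
    (≡.subst (p ℕDiv.∣_) (≡.sym p!≡) (ℕDiv.m∣m*n (p-1 ℕ.!))))
  where
  instance
    _ = ℕP._!*_!≢0 k (p ∸ k)
  p!≡ : (p Combinatorics.C k) ℕ.* (k ℕ.! ℕ.* (p ∸ k) ℕ.!) ≡ p ℕ.!
  p!≡ = ≡.trans (≡.cong (ℕ._* (k ℕ.! ℕ.* (p ∸ k) ℕ.!)) (Combinatorics.nCk≡n!/k![n-k]! (ℕP.<⇒≤ k<p)))
    (ℕDivMod.m/n*n≡m (Combinatorics.k![n∸k]!∣n! (ℕP.<⇒≤ k<p)))
  ∤k![p-k]! : ¬ (p ℕDiv.∣ k ℕ.! ℕ.* (p ∸ k) ℕ.!)
  ∤k![p-k]! d = [ prime∤! pr k k<p , prime∤! pr (p ∸ k) (ℕP.∸-monoʳ-< 1≤k (ℕP.<⇒≤ k<p)) ]′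
    (euclidsLemma (k ℕ.!) ((p ∸ k) ℕ.!) pr d)

module Frobenius (E : CommutativeRing 0ℓ 0ℓ) (p : ℕ) (pr : Prime p)
                 (char : CommutativeRing._≈_ E (RingKit.ι E (+ p)) (CommutativeRing.0# E)) where
  open RingKit E
  open Multiples semiring using () renaming (_×_ to _×ᴺ_)
  private
    module M = Multiples semiring
    module N = NaturalMultiples semiring
    module S = Sums semiring
    module B = BinomialTheorem commutativeSemiring

  p×≈0 : ∀ x → p ×ᴺ x ≈ 0#
  p×≈0 x = begin
    p ×ᴺ x            ≈⟨ M.×-congʳ p (*-identityˡ x) ⟨
    p ×ᴺ (1# * x)     ≈⟨ M.×-assoc-* p 1# x ⟨
    (p ×ᴺ 1#) * x     ≈⟨ *-congʳ (trans (N.×ᵤ≈× p 1#) char) ⟩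
    0# * x            ≈⟨ zeroˡ x ⟩
    0#                ∎

  multiple×≈0 : ∀ {j} x → p ℕDiv.∣ j → j ×ᴺ x ≈ 0#
  multiple×≈0 x (ℕDiv.divides-refl q) = trans (M.×-congˡ (ℕP.*-comm q p)) (trans (sym (M.×-assocˡ x p q)) (p×≈0 (q ×ᴺ x)))

  frobenius : ∀ x y → (x + y) ^ p ≈ x ^ p + y ^ p
  frobenius x y = ≡.subst (λ n → (x + y) ^ n ≈ x ^ n + y ^ n) (ℕP.suc-pred p) (expand (ℕ.pred p) (ℕP.suc-pred p))
    where
    instance _ = prime⇒nonZero pr
    expand : ∀ n → suc n ≡ p → (x + y) ^ suc n ≈ x ^ suc n + y ^ suc n
    expand n sn≡p = begin
      (x + y) ^ suc n                                            ≈⟨ B.theorem (suc n) x y ⟩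
      S.sum t                                                    ≈⟨ +-congˡ (S.sum-init-last (t ∘ Fin.suc)) ⟩
      t Fin.zero + (S.sum inner + t (Fin.suc (Fin.fromℕ n)))     ≈⟨ +-cong first (+-cong inner≈0 last) ⟩
      y ^ suc n + (0# + x ^ suc n)                               ≈⟨ trans (+-congˡ (+-identityˡ _)) (+-comm _ _) ⟩
      x ^ suc n + y ^ suc n                                      ∎
      where
      t : Fin (suc (suc n)) → Carrier
      t = B.binomialTerm x y (suc n)
      inner : Fin n → Carrier
      inner i = t (Fin.suc (Fin.inject₁ i))
      inner≈0 : S.sum inner ≈ 0#
      inner≈0 = trans (S.sum-cong-≋ {_} {inner} {λ _ → 0#} λ i → multiple×≈0 _
          (≡.subst (λ j → p ℕDiv.∣ suc n Combinatorics.C suc j) (≡.sym (FinP.toℕ-inject₁ i))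
            (≡.subst (λ q → p ℕDiv.∣ q Combinatorics.C suc (toℕ i)) (≡.sym sn≡p)
              (prime∣C pr (suc (toℕ i)) (s≤s z≤n) (≡.subst (suc (toℕ i) ℕ.<_) sn≡p (s≤s (FinP.toℕ<n i)))))))
        (S.sum-replicate-zero n)
      first : t Fin.zero ≈ y ^ suc n
      first = trans (M.×-congˡ (≡.trans (Combinatorics.nCk≡nC[n∸k] {0} {suc n} z≤n) (Combinatorics.nCn≡1 (suc n))))
        (trans (+-identityʳ _) (*-identityˡ _))
      last : t (Fin.suc (Fin.fromℕ n)) ≈ x ^ suc n
      last = trans (reflexive (≡.cong (λ k → (suc n Combinatorics.C suc k) ×ᴺ (x ^ suc k * y ^ (n ∸ k))) (FinP.toℕ-fromℕ n)))
        (trans (M.×-cong (Combinatorics.nCn≡1 (suc n)) (trans (*-congˡ (reflexive (≡.cong (y ^_) (ℕP.n∸n≡0 n)))) (*-identityʳ _)))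
          (+-identityʳ _))

  frobenius-^ : ∀ e x y → (x + y) ^ (p ℕ.^ e) ≈ x ^ (p ℕ.^ e) + y ^ (p ℕ.^ e)
  frobenius-^ zero    x y = trans (*-identityʳ _) (sym (+-cong (*-identityʳ x) (*-identityʳ y)))
  frobenius-^ (suc e) x y = begin
    (x + y) ^ (p ℕ.* p ℕ.^ e)                          ≈⟨ ^-assocʳ (x + y) p (p ℕ.^ e) ⟨
    ((x + y) ^ p) ^ (p ℕ.^ e)                          ≈⟨ ^-congˡ (p ℕ.^ e) (frobenius x y) ⟩
    (x ^ p + y ^ p) ^ (p ℕ.^ e)                        ≈⟨ frobenius-^ e (x ^ p) (y ^ p) ⟩
    (x ^ p) ^ (p ℕ.^ e) + (y ^ p) ^ (p ℕ.^ e)          ≈⟨ +-cong (^-assocʳ x p _) (^-assocʳ y p _) ⟩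
    x ^ (p ℕ.* p ℕ.^ e) + y ^ (p ℕ.* p ℕ.^ e)          ∎

  fermat : ∀ n → ι (+ n) ^ p ≈ ι (+ n)
  fermat zero    = ≡.subst (λ j → 0# ^ j ≈ 0#) (ℕP.suc-pred p) (zeroˡ _)
    where instance _ = prime⇒nonZero pr
  fermat (suc n) = begin
    ι (+ suc n) ^ p              ≈⟨ ^-congˡ p (ι-+ 1ℤ (+ n)) ⟩
    (1# + ι (+ n)) ^ p           ≈⟨ frobenius 1# (ι (+ n)) ⟩
    1# ^ p + ι (+ n) ^ p         ≈⟨ +-cong (Forms.1^n≈1 E p) (fermat n) ⟩
    1# + ι (+ n)                 ≈⟨ ι-+ 1ℤ (+ n) ⟨
    ι (+ suc n)                  ∎

  fermat-^ : ∀ e n → ι (+ n) ^ (p ℕ.^ e) ≈ ι (+ n)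
  fermat-^ zero    n = *-identityʳ _
  fermat-^ (suc e) n = trans (sym (^-assocʳ (ι (+ n)) p (p ℕ.^ e))) (trans (^-congˡ (p ℕ.^ e) (fermat n)) (fermat-^ e n))

^-ℤ : ∀ x n → x ℤ-Ring.^ n ≡ x ℤ.^ n
^-ℤ x zero    = ≡.refl
^-ℤ x (suc n) = ≡.cong (x ℤ.*_) (^-ℤ x n)

module FermatModPrime (p : ℕ) (pr : Prime p) where
  open ModPrime p pr

  C≈0 : ∀ {c} → + p ∣ℤ c → C c Fx.≈ []
  C≈0 {c} p∣c = Fx.trans (∷≈X* [] p∣c) (Fx.zeroʳ X)

  ι≈C : ∀ c → Fx.ι c Fx.≈ C c
  ι≈C c = Fx.trans (Fx.reflexive (ι-quotient ℤ[X] (C (+ p)) c)) (≋⇒≈ (Zx.sym (C≋ι c)))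

  ^≈^ : ∀ f i → f Zx.^ i Fx.≈ f Fx.^ i
  ^≈^ f i = Fx.reflexive (≡.sym (^-quotient ℤ[X] (C (+ p)) f i))

  module Frob = Frobenius 𝔽p[X] p pr (Fx.trans (ι≈C (+ p)) (C≈0 ℤ-Ring.∣ʳ-refl))

  C-fermat : ∀ b e → C (+ b) Fx.^ (p ℕ.^ e) Fx.≈ C (+ b)
  C-fermat b e = Fx.trans (Fx.^-congˡ (p ℕ.^ e) (Fx.sym (ι≈C (+ b)))) (Fx.trans (Frob.fermat-^ e b) (ι≈C (+ b)))

  C-^ℤ : ∀ c i → C (c ℤ-Ring.^ i) ≋ C c Zx.^ i
  C-^ℤ c i = Zx.trans (Zx.reflexive (≡.cong C (^-ℤ c i))) (C-^ c i)

  -- Frobenius applied to (-b) + b = 0, together with b^q ≡ b. Keeping the sign inside the power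
  -- treats p = 2 along with the odd primes.
  p∣[-b]^q+b : ∀ b e → + p ∣ℤ (ℤ.- + b) ℤ-Ring.^ (p ℕ.^ e) ℤ.+ + b
  p∣[-b]^q+b b e = ≈0⇒coeff {C ((ℤ.- + b) ℤ-Ring.^ q ℤ.+ + b)} (begin
    C ((ℤ.- + b) ℤ-Ring.^ q) + C (+ b)         ≈⟨ +-cong (trans (≋⇒≈ (C-^ℤ (ℤ.- + b) q)) (^≈^ (C (ℤ.- + b)) q)) (sym (C-fermat b e)) ⟩
    C (ℤ.- + b) Fx.^ q + C (+ b) Fx.^ q        ≈⟨ Frob.frobenius-^ e (C (ℤ.- + b)) (C (+ b)) ⟨
    (C (ℤ.- + b) + C (+ b)) Fx.^ q             ≈⟨ ^-congˡ q (≋⇒≈ (Zx.-‿inverseˡ (C (+ b)))) ⟩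
    [] Fx.^ q                                  ≈⟨ 0^q ⟩
    []                                         ∎) 0
    where
    open Fx
    q = p ℕ.^ e
    0^q : [] Fx.^ q ≈ []
    0^q = ≡.subst (λ j → [] Fx.^ j ≈ []) (ℕP.suc-pred q) (≋⇒≈ Zx.refl)
      where instance _ = ℕP.m^n≢0 p e {{prime⇒nonZero pr}}


-- The polynomial ℱ, and p-maximality for p dividing bm

module FamilyIdentities (S : CommutativeRing 0ℓ 0ℓ) (n k : ℕ) (x m b : CommutativeRing.Carrier S) where
  open RingKit S
  open Forms S

  z : Carrier
  z = m ^ 2 * x ^ k

  private
    z^i : ∀ i → z ^ i ≈ m ^ (2 ℕ.* i) * x ^ (i ℕ.* k)
    z^i i = trans (^-distrib-* (m ^ 2) (x ^ k) i) (*-cong (^-assocʳ m 2 i)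
      (trans (^-assocʳ x k i) (reflexive (≡.cong (x ^_) (ℕP.*-comm k i)))))

  -- The factor m^(2n) completes x^(nk) to zⁿ, so that x survives only inside z.
  family-scaled : m ^ (2 ℕ.* n) * (x ^ (n ℕ.* k) + b * geo z 1# n) ≈ form (b * m ^ (2 ℕ.* n)) z 1# n
  family-scaled = trans (solve 4 (λ u v b g → u :* (v :+ b :* g) := u :* v :+ (b :* u) :* g) refl
      (m ^ (2 ℕ.* n)) (x ^ (n ℕ.* k)) b (geo z 1# n))
    (+-congʳ (sym (z^i n)))

  family-mod-m² : ∀ i → n ≡ suc i → m ^ 2 ∣ (x ^ (n ℕ.* k) + b * geo z 1# n) + - (x ^ (n ℕ.* k) + b)
  family-mod-m² i ≡.refl = ∣ʳ-respʳ-≈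
    (solve 3 (λ v b g → b :* (g :+ :- con 1ℤ) := (v :+ b :* g) :+ :- (v :+ b)) refl (x ^ (n ℕ.* k)) b (geo z 1# n))
    (∣-*ˡ b (∣ʳ-trans (x∣x*y (m ^ 2) (x ^ k)) (geo-const z i)))

module Family (n : ℕ) (m : ℤ) (b k : ℕ) where
  module FZ = Forms ℤ[X]

  F : Poly
  F = ℱ n b m k

  z : Poly
  z = C m Zx.^ 2 Zx.* X Zx.^ k

  private
    ^ₚ≡^ : ∀ f e → f ℤ[x].^ₚ e ≡ f Zx.^ e
    ^ₚ≡^ f zero    = ≡.refl
    ^ₚ≡^ f (suc e) = ≡.cong (f Zx.*_) (^ₚ≡^ f e)

    geometric : ∀ f n → ℤ[x].sum {n} (λ i → f ℤ[x].^ₚ (n ∸ suc (toℕ i))) ≋ FZ.geo f Zx.1# n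
    geometric f zero    = Zx.refl
    geometric f (suc n) = Zx.trans (Zx.+-cong {x = f ℤ[x].^ₚ n} (Zx.reflexive (^ₚ≡^ f n)) (geometric f n))
      (Zx.sym (Zx.*-identityˡ (f Zx.^ n Zx.+ FZ.geo f Zx.1# n)))

  F≋ : F ≋ X Zx.^ (n ℕ.* k) Zx.+ C (+ b) Zx.* FZ.geo z Zx.1# n
  F≋ = Zx.+-cong {x = X ℤ[x].^ₚ (n ℕ.* k)} (Zx.reflexive (^ₚ≡^ X (n ℕ.* k)))
    (Zx.*-congˡ {C (+ b)} (Zx.trans (geometric (C (m ℤ.^ 2) Zx.* X ℤ[x].^ₚ k) n)
      (FZ.geo-cong (Zx.*-cong {C (m ℤ.^ 2)} (C-^ m 2) (Zx.reflexive (^ₚ≡^ X k))) Zx.refl n)))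

  scaled : C m Zx.^ (2 ℕ.* n) Zx.* F ≋ FZ.form (C (+ b) Zx.* C m Zx.^ (2 ℕ.* n)) z Zx.1# n
  scaled = Zx.trans (Zx.*-congˡ {C m Zx.^ (2 ℕ.* n)} F≋)
    (FamilyIdentities.family-scaled ℤ[X] n k X (C m) (C (+ b)))

  mod-m² : 1 ℕ.≤ n → C m Zx.^ 2 Zx.∣ F Zx.+ Zx.- (X Zx.^ (n ℕ.* k) Zx.+ C (+ b))
  mod-m² (s≤s {n = i} _) = Zx.∣ʳ-respʳ-≈ (Zx.+-congʳ {x = Zx.- (X Zx.^ (n ℕ.* k) Zx.+ C (+ b))} (Zx.sym F≋))
    (FamilyIdentities.family-mod-m² ℤ[X] n k X (C m) (C (+ b)) i ≡.refl)

  module _ (1≤k : 1 ℕ.≤ k) where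

    private
      z-top : HasTop z k (m ℤ.^ 2)
      z-top = ≡.subst (HasTop z k) (ℤP.*-identityʳ (m ℤ.^ 2))
        (hasTop-* (C m Zx.^ 2) (hasTop-^ (hasTop-C m) 2) (hasTop-X^ k))

      geo-below : ∀ i → DegreeBelow (i ℕ.* k) (FZ.geo z Zx.1# i)
      geo-below zero    = below λ _ _ → ≡.refl
      geo-below (suc i) = degreeBelow-resp (Zx.sym (Zx.*-identityˡ (z Zx.^ i Zx.+ FZ.geo z Zx.1# i)))
        (degreeBelow-+ (degreeBelow-mono (ℕP.+-monoˡ-≤ (i ℕ.* k) 1≤k) (proj₂ (hasTop-^ z-top i)))
                       (degreeBelow-mono (ℕP.m≤n+m (i ℕ.* k) k) (geo-below i)))

    F-monic : HasTop F (n ℕ.* k) 1ℤ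
    F-monic = hasTop-resp (Zx.sym F≋) (≡.subst (HasTop _ _) (ℤP.+-identityʳ 1ℤ)
      (hasTop-+ (hasTop-X^ (n ℕ.* k)) (degreeBelow⇒top (degreeBelow-C* (+ b) (geo-below n)))))

    coeff-X^-zero : ∀ d → 1 ℕ.≤ d → coeff (X Zx.^ d) 0 ≡ 0ℤ
    coeff-X^-zero (suc d) _ = coeff-X*-zero (X Zx.^ d)

    F-constant : 1 ℕ.≤ n → coeff F 0 ≡ + b
    F-constant 1≤n@(s≤s {n = i} _) = begin
      coeff F 0                                                        ≡⟨ at F≋ 0 ⟩
      coeff (X Zx.^ (n ℕ.* k) Zx.+ C (+ b) Zx.* FZ.geo z Zx.1# n) 0    ≡⟨ Zx.coeff-+ (X Zx.^ (n ℕ.* k)) _ 0 ⟩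
      coeff (X Zx.^ (n ℕ.* k)) 0 ℤ.+ coeff (C (+ b) Zx.* FZ.geo z Zx.1# n) 0
        ≡⟨ ≡.cong₂ ℤ._+_ (coeff-X^-zero (n ℕ.* k) (ℕP.*-mono-≤ 1≤n 1≤k)) (coeff-C* (+ b) (FZ.geo z Zx.1# n) 0) ⟩
      0ℤ ℤ.+ + b ℤ.* coeff (FZ.geo z Zx.1# n) 0                        ≡⟨ ℤP.+-identityˡ _ ⟩
      + b ℤ.* coeff (FZ.geo z Zx.1# n) 0                               ≡⟨ ≡.cong (+ b ℤ.*_) geo₀≡1 ⟩
      + b ℤ.* 1ℤ                                                       ≡⟨ ℤP.*-identityʳ (+ b) ⟩
      + b                                                              ∎
      where
      open ≡.≡-Reasoning
      z₀≡0 : coeff z 0 ≡ 0ℤ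
      z₀≡0 = ≡.trans (coeff-*-zero (C m Zx.^ 2) (X Zx.^ k))
        (≡.trans (≡.cong (coeff (C m Zx.^ 2) 0 ℤ.*_) (coeff-X^-zero k 1≤k)) (ℤP.*-zeroʳ (coeff (C m Zx.^ 2) 0)))
      geo₀≡1 : coeff (FZ.geo z Zx.1# n) 0 ≡ 1ℤ
      geo₀≡1 = let q , e = Zx.∣⇒∃ (FZ.geo-const z i) in ℤP.i-j≡0⇒i≡j _ _
        (≡.trans (≡.sym (Zx.coeff-+ (FZ.geo z Zx.1# n) (Zx.- Zx.1#) 0)) (≡.trans (≡.sym (at e 0))
          (≡.trans (coeff-*-zero q z) (≡.trans (≡.cong (coeff q 0 ℤ.*_) z₀≡0) (ℤP.*-zeroʳ (coeff q 0))))))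


δ-C : ∀ c → δ (C c) ≋ []
δ-C c = Zx.∷-zero ≡.refl Zx.refl

δ-X^ : ∀ i → δ (X Zx.^ i) ≋ C (+ i) Zx.* X Zx.^ i
δ-X^ i = coeffwise λ j → begin
  coeff (δ (X Zx.^ i)) j             ≡⟨ coeff-δ (X Zx.^ i) j ⟩
  + j ℤ.* coeff (X Zx.^ i) j         ≡⟨ coeff-X^ i j ⟩
  + i ℤ.* coeff (X Zx.^ i) j         ≡⟨ coeff-C* (+ i) (X Zx.^ i) j ⟨
  coeff (C (+ i) Zx.* X Zx.^ i) j    ∎
  where
  open ≡.≡-Reasoning
  coeff-X^ : ∀ i j → + j ℤ.* coeff (X Zx.^ i) j ≡ + i ℤ.* coeff (X Zx.^ i) j
  coeff-X^ zero    zero    = ≡.refl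
  coeff-X^ zero    (suc j) = ℤP.*-zeroʳ (+ suc j)
  coeff-X^ (suc i) zero    = ≡.sym (≡.trans (≡.cong (+ suc i ℤ.*_) (coeff-X*-zero (X Zx.^ i))) (ℤP.*-zeroʳ (+ suc i)))
  coeff-X^ (suc i) (suc j) = begin
    + suc j ℤ.* coeff (X Zx.^ suc i) (suc j)                 ≡⟨ ≡.cong (+ suc j ℤ.*_) (at (X* (X Zx.^ i)) (suc j)) ⟩
    + suc j ℤ.* coeff (X Zx.^ i) j                           ≡⟨ ℤP.suc-* (+ j) _ ⟩
    coeff (X Zx.^ i) j ℤ.+ + j ℤ.* coeff (X Zx.^ i) j        ≡⟨ ≡.cong (λ y → coeff (X Zx.^ i) j ℤ.+ y) (coeff-X^ i j) ⟩
    coeff (X Zx.^ i) j ℤ.+ + i ℤ.* coeff (X Zx.^ i) j        ≡⟨ ℤP.suc-* (+ i) _ ⟨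
    + suc i ℤ.* coeff (X Zx.^ i) j                           ≡⟨ ≡.cong (+ suc i ℤ.*_) (at (X* (X Zx.^ i)) (suc j)) ⟨
    + suc i ℤ.* coeff (X Zx.^ suc i) (suc j)                 ∎

split-constant : ∀ f → ∃[ u ] f ≋ C (coeff f 0) Zx.+ X Zx.* u
split-constant []      = [] , Zx.sym (Zx.trans (Zx.+-cong {C 0ℤ} (C≋ι 0ℤ) (Zx.zeroʳ X)) (Zx.+-identityˡ []))
split-constant (a ∷ f) = f , ∷≋C+X* a f

module AtPrime (n : ℕ) (m : ℤ) (b k : ℕ) (1≤n : 1 ℕ.≤ n) (1≤k : 1 ℕ.≤ k) (p : ℕ) (pr : Prime p) where
  open Family n m b k
  open ModPrime p pr
  open FermatModPrime p pr

  p-nzd : RingKit.NonZeroDivisor (ℤ[X]/ F) (C (+ p))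
  p-nzd = constant-nonZeroDivisor (F-monic 1≤k) (+ p) λ where ≡.refl → contradiction pr λ ()

  open Local ℤ[X] F (C (+ p)) p-nzd public
  open QuotientDerivation ℤ[X] δ δ-isDerivation (C (+ p)) (δ-C (+ p))

  module Mx where
    open RingKit (ℤ[X]/ F) public

  Maximal : Set
  Maximal = ∀ f → AlmostIntegral f → C (+ p) Mx.∣ f

  d : ℕ
  d = n ℕ.* k

  radical : ∀ h → ¬ (+ p ∣ℤ coeff h 0) → Separable h → ∀ f j → h Fx.∣ f Fx.^ j → h Fx.∣ f
  radical h p∤h₀ sep f = separable⇒radical (coprimeCofactors h f p∤h₀) sep

  X∣⇒ : ∀ f → X Fx.∣ f → + p ∣ℤ coeff f 0
  X∣⇒ f X∣f = ℤ-Ring.∣ʳ-respʳ-≈ (ℤP.neg-involutive (coeff f 0)) (ℤ-Ring.∣-neg (ℤ-Ring.∣ʳ-respʳ-≈ eq (Cp∣⇒coeff (difference (proj₂ (Fx.∣⇒∃ X∣f))) 0)))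
    where
    q = proj₁ (Fx.∣⇒∃ X∣f)
    eq : coeff (q Zx.* X Zx.+ Zx.- f) 0 ≡ ℤ.- coeff f 0
    eq = ≡.trans (Zx.coeff-+ (q Zx.* X) (Zx.- f) 0) (≡.trans (≡.cong₂ ℤ._+_
      (≡.trans (coeff-*-zero q X) (ℤP.*-zeroʳ (coeff q 0))) (Zx.coeff-neg f 0)) (ℤP.+-identityˡ _))

  ⇒X∣ : ∀ f → + p ∣ℤ coeff f 0 → X Fx.∣ f
  ⇒X∣ f p∣f₀ = let u , e = split-constant f in Fx._,_ u (Fx.sym (Fx.trans (≋⇒≈ e)
    (Fx.trans (Fx.+-cong (C≈0 p∣f₀) (Fx.*-comm X u)) (Fx.+-identityˡ (u Zx.* X)))))

  coeff-^-zero : ∀ f j → coeff (f Fx.^ j) 0 ≡ coeff f 0 ℤ-Ring.^ j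
  coeff-^-zero f zero    = ≡.refl
  coeff-^-zero f (suc j) = ≡.trans (coeff-*-zero f (f Fx.^ j)) (≡.cong (coeff f 0 ℤ.*_) (coeff-^-zero f j))

  F≈X^d : + p ∣ℤ + b → F Fx.≈ X Fx.^ d
  F≈X^d p∣b = Fx.trans (≋⇒≈ F≋) (Fx.trans (Fx.+-cong
      (^≈^ X d)
      (Fx.trans (Fx.*-congʳ {FZ.geo z Zx.1# n} (C≈0 p∣b)) Fx.refl))
    (Fx.+-identityʳ (X Fx.^ d)))

  -- The constant term b = b₀ p gives F = x u - p (- b₀), and b₀ is a unit modulo p because p² does
  -- not divide b.
  maximal-eisenstein : + p ∣ℤ + b → ¬ (p ℕ.* p ℕDiv.∣ b) → Maximal
  maximal-eisenstein p∣b p²∤b = maximal-if-dedekind {X} {u} {C (ℤ.- b₀)} {Zx.1#}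
      (rearrange (C b₀) (C (+ p)) X u F F≋u) Fx.∣ʳ-refl (λ f → X*-cancel {f}) (constant-unit (ℤ.- b₀) p∤-b₀)
      (λ f j X∣fʲ → ⇒X∣ f (prime-∣ℤ-^ pr (coeff f 0) j (≡.subst (+ p ∣ℤ_) (coeff-^-zero f j) (X∣⇒ (f Fx.^ j) X∣fʲ))))
      d (Fx.≈⇒∣ (F≈X^d p∣b))
    where
    b₀ : ℤ
    b₀ = proj₁ (ℤ-Ring.∣⇒∃ p∣b)
    b≡ : b₀ ℤ.* + p ≡ + b
    b≡ = proj₂ (ℤ-Ring.∣⇒∃ p∣b)
    p∤-b₀ : ¬ (+ p ∣ℤ ℤ.- b₀)
    p∤-b₀ p∣ = p²∤b (≡.subst (ℕDiv._∣ b) (ℤP.abs-* (+ p) (+ p)) (∣ℤ⇒∣ {+ p ℤ.* + p} {+ b}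
      (ℤ-Ring.∣ʳ-respʳ-≈ b≡ (ℤ-Ring.∙-cong-∣ (ℤ-Ring.∣ʳ-respʳ-≈ (ℤP.neg-involutive b₀) (ℤ-Ring.∣-neg p∣)) ℤ-Ring.∣ʳ-refl))))
    u : Poly
    u = proj₁ (split-constant F)
    F≋u : F ≋ C b₀ Zx.* C (+ p) Zx.+ X Zx.* u
    F≋u = Zx.trans (proj₂ (split-constant F)) (Zx.+-congʳ {X Zx.* u}
      (Zx.trans (Zx.reflexive (≡.cong C (≡.trans (F-constant 1≤k 1≤n) (≡.sym b≡)))) (C-* b₀ (+ p))))
    rearrange : ∀ c p x u f → f ≋ c Zx.* p Zx.+ x Zx.* u → Zx.1# Zx.* f ≋ x Zx.* u Zx.+ Zx.- (p Zx.* Zx.- c)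
    rearrange c p x u f e = trans (*-identityˡ f) (trans e
      (solve 4 (λ c p x u → c :* p :+ x :* u := x :* u :+ :- (p :* :- c)) refl c p x u))
      where open Zx

  module Ramified (p∣m : + p ∣ℤ m) (p∤b : ¬ (+ p ∣ℤ + b)) (e d′ : ℕ) (d≡ : n ℕ.* k ≡ p ℕ.^ e ℕ.* d′)
                  (1≤d′ : 1 ℕ.≤ d′) where
    q : ℕ
    q = p ℕ.^ e
    Y h : Poly
    Y = X Zx.^ d′
    h = Y Zx.+ C (+ b)

    F-expansion : ∃[ s ] F ≋ (X Zx.^ d Zx.+ C (+ b)) Zx.+ (s Zx.* C (+ p)) Zx.* C (+ p)
    F-expansion = s Zx.* (C m₀ Zx.* C m₀) , rearrange F (X Zx.^ d Zx.+ C (+ b)) s (C m₀) (C (+ p))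
      (Zx.trans (Zx.*-congˡ {s} (Zx.sym (Zx.^-congˡ 2 (Zx.trans (Zx.reflexive (≡.cong C (≡.sym m≡))) (C-* m₀ (+ p)))))) es)
      where
      m₀ = proj₁ (ℤ-Ring.∣⇒∃ p∣m)
      m≡ : m₀ ℤ.* + p ≡ m
      m≡ = proj₂ (ℤ-Ring.∣⇒∃ p∣m)
      s = proj₁ (Zx.∣⇒∃ (mod-m² 1≤n))
      es : s Zx.* C m Zx.^ 2 ≋ F Zx.+ Zx.- (X Zx.^ d Zx.+ C (+ b))
      es = proj₂ (Zx.∣⇒∃ (mod-m² 1≤n))
      rearrange : ∀ f g s c p → s Zx.* (c Zx.* p) Zx.^ 2 ≋ f Zx.+ Zx.- g → f ≋ g Zx.+ (s Zx.* (c Zx.* c) Zx.* p) Zx.* p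
      rearrange f g s c p e = lin₁ (- 1#) e (solve 5 (λ f g s c p →
        f :+ :- con 1ℤ :* (f :+ :- g) := (g :+ (s :* (c :* c) :* p) :* p) :+ :- con 1ℤ :* (s :* (c :* p) :^ 2)) refl f g s c p)
        where open Zx

    s : Poly
    s = proj₁ F-expansion

    Y^q : Y Zx.^ q ≋ X Zx.^ d
    Y^q = Zx.trans (Zx.^-assocʳ X d′ q) (Zx.reflexive (≡.cong (X Zx.^_) (≡.trans (ℕP.*-comm d′ q) (≡.sym d≡))))

    F≋ₚ : F Fx.≈ X Zx.^ d Fx.+ C (+ b)
    F≋ₚ = mod (s Zx.* C (+ p) Zx., rearrange {sp = s Zx.* C (+ p)} (proj₂ F-expansion))
      where
      rearrange : ∀ {f g sp} → f ≋ g Zx.+ sp Zx.* C (+ p) → sp Zx.* C (+ p) ≋ f Zx.+ Zx.- g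
      rearrange {f} {g} {sp} e = lin₁ (- 1#) e (solve 3 (λ f g spp → spp :+ :- con 1ℤ :* (g :+ spp) := (f :+ :- g) :+ :- con 1ℤ :* f) refl f g (sp * C (+ p)))
        where open Zx

    h₀ : ¬ (+ p ∣ℤ coeff h 0)
    h₀ p∣h₀ = p∤b (≡.subst (+ p ∣ℤ_) (≡.trans (Zx.coeff-+ Y (C (+ b)) 0)
      (≡.trans (≡.cong (ℤ._+ + b) (coeff-X^-zero 1≤k d′ 1≤d′)) (ℤP.+-identityˡ (+ b)))) p∣h₀)

    -- The combination d′ h - δ h equals d′ b, a unit modulo p.
    h-separable : ¬ (+ p ∣ℤ + d′) → Separable h
    h-separable p∤d′ = Fx.coprime-solve (Zx.- C 1ℤ) (C (+ d′))
      (Fx.coprime-*ʳ (Fx.coprime-unit (constant-unit (+ d′) p∤d′)) (Fx.coprime-unit (constant-unit (+ b) p∤b)))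
      (≋⇒≈ (Zx.trans (Zx.+-congʳ {C (+ d′) Zx.* h} (Zx.*-congˡ {Zx.- C 1ℤ} δh)) (euler (C (+ d′)) Y (C (+ b)))))
      where
      δh : δ h ≋ C (+ d′) Zx.* Y
      δh = Zx.trans (δ-+ Y (C (+ b))) (Zx.trans (Zx.+-cong (δ-X^ d′) (δ-C (+ b))) (Zx.+-identityʳ (C (+ d′) Zx.* Y)))
      euler : ∀ c y b → Zx.- C 1ℤ Zx.* (c Zx.* y) Zx.+ c Zx.* (y Zx.+ b) ≋ c Zx.* b
      euler = solve 3 (λ c y b → :- con 1ℤ :* (c :* y) :+ c :* (y :+ b) := c :* b) refl where open Zx

    F≈h^q : F Fx.≈ h Fx.^ q
    F≈h^q = begin
      F                              ≈⟨ F≋ₚ ⟩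
      X Zx.^ d + C (+ b)             ≈⟨ +-cong (≋⇒≈ Y^q) (C-fermat b e) ⟨
      Y Zx.^ q + C (+ b) Fx.^ q      ≈⟨ +-congʳ (^≈^ Y q) ⟩
      Y Fx.^ q + C (+ b) Fx.^ q      ≈⟨ Frob.frobenius-^ e Y (C (+ b)) ⟨
      h Fx.^ q                       ∎
      where open Fx

    maximal-tame : ¬ (+ p ∣ℤ + d′) → e ≡ 0 → Maximal
    maximal-tame p∤d′ ≡.refl = maximal-if-reduced λ f j F∣ →
      Fx.∣ʳ-respˡ-≈ (Fx.sym F≈h) (radical h h₀ (h-separable p∤d′) f j (Fx.∣ʳ-respˡ-≈ F≈h F∣))
      where
      F≈h : F Fx.≈ h
      F≈h = Fx.trans F≋ₚ (≋⇒≈ (Zx.+-congʳ {C (+ b)} (Zx.sym (Zx.trans (Zx.sym (Zx.*-identityʳ Y)) Y^q))))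

    r₀ : ℤ
    r₀ = proj₁ (ℤ-Ring.∣⇒∃ (p∣[-b]^q+b b e))
    r₀≡ : r₀ ℤ.* + p ≡ (ℤ.- + b) ℤ-Ring.^ q ℤ.+ + b
    r₀≡ = proj₂ (ℤ-Ring.∣⇒∃ (p∣[-b]^q+b b e))
    -- The root Y = - b of h yields u = (Y^q - (-b)^q) / (Y + b) over ℤ, so that x^(nk) + b = h u +
    -- ((-b)^q + b).
    u∣ : Y Zx.+ Zx.- (C (ℤ.- + b)) Zx.∣ Y Zx.^ q Zx.+ Zx.- (C (ℤ.- + b) Zx.^ q)
    u∣ = FZ.^-mod Y (C (ℤ.- + b)) q
    u : Poly
    u = proj₁ (Zx.∣⇒∃ u∣)

    -- F = h u - p r with r = - (r₀ + p s), where p r₀ = (-b)^q + b.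
    factorisation : Zx.1# Zx.* F ≋ h Zx.* u Zx.+ Zx.- (C (+ p) Zx.* Zx.- (C r₀ Zx.+ s Zx.* C (+ p)))
    factorisation = rearrange F h u (X Zx.^ d) (C (+ b)) s (C (+ p)) (C r₀) (C (ℤ.- + b) Zx.^ q)
        (proj₂ F-expansion)
        (Zx.trans (proj₂ (Zx.∣⇒∃ u∣)) (Zx.+-congʳ {Zx.- (C (ℤ.- + b) Zx.^ q)} Y^q))
        (Zx.trans (Zx.sym (C-* r₀ (+ p))) (Zx.trans (Zx.reflexive (≡.cong C r₀≡)) (Zx.+-congʳ {C (+ b)} (C-^ℤ (ℤ.- + b) q))))
      where
      rearrange : ∀ f h u x b s p r c → f ≋ (x Zx.+ b) Zx.+ (s Zx.* p) Zx.* p → u Zx.* (Y Zx.+ Zx.- Zx.- b) ≋ x Zx.+ Zx.- c → r Zx.* p ≋ c Zx.+ b →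
                  Zx.1# Zx.* f ≋ (Y Zx.+ b) Zx.* u Zx.+ Zx.- (p Zx.* Zx.- (r Zx.+ s Zx.* p))
      rearrange f h u x b s p r c ef eu er = lin₃ 1# (- 1#) (- 1#) ef eu er (solve 9 (λ f y u x b s p r c →
        con 1ℤ :* f :+ (con 1ℤ :* ((x :+ b) :+ (s :* p) :* p) :+ (:- con 1ℤ :* (x :+ :- c) :+ :- con 1ℤ :* (c :+ b)))
        := ((y :+ b) :* u :+ :- (p :* :- (r :+ s :* p))) :+ (con 1ℤ :* f :+ (:- con 1ℤ :* (u :* (y :+ :- :- b)) :+ :- con 1ℤ :* (r :* p)))) refl f Y u x b s p r c)
        where open Zx

    maximal-wild : ¬ (+ p ∣ℤ + d′) → ¬ (+ p ℤ.* + p ∣ℤ (ℤ.- + b) ℤ-Ring.^ q ℤ.+ + b) → Maximal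
    maximal-wild p∤d′ p²∤ = maximal-if-dedekind {h} {u} {Zx.- (C r₀ Zx.+ s Zx.* C (+ p))} {Zx.1#} factorisation
      Fx.∣ʳ-refl (constant⇒nonZeroDivisor h h₀) r-unit (radical h h₀ (h-separable p∤d′)) q (Fx.≈⇒∣ F≈h^q)
      where
      r-unit : Zx.- (C r₀ Zx.+ s Zx.* C (+ p)) Fx.∣ C 1ℤ
      r-unit = Fx.∣ʳ-respˡ-≈ (mod (s Zx., lem (C r₀) s (C (+ p)))) (constant-unit (ℤ.- r₀) p∤-r₀)
        where
        lem : ∀ r s p → s Zx.* p ≋ Zx.- r Zx.+ Zx.- (Zx.- (r Zx.+ s Zx.* p))
        lem = solve 3 (λ r s p → s :* p := :- r :+ :- (:- (r :+ s :* p))) refl where open Zx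
        p∤-r₀ : ¬ (+ p ∣ℤ ℤ.- r₀)
        p∤-r₀ p∣ = p²∤ (ℤ-Ring.∣ʳ-respʳ-≈ r₀≡ (ℤ-Ring.∙-cong-∣ (ℤ-Ring.∣ʳ-respʳ-≈ (ℤP.neg-involutive r₀) (ℤ-Ring.∣-neg p∣)) ℤ-Ring.∣ʳ-refl))


-- 𝒟 as a value of the form

ι-ℤ : ∀ c → ℤ-Ring.ι c ≡ c
ι-ℤ = λ { (+ n) → nonneg n ; -[1+ n ] → ≡.cong ℤ.-_ (nonneg (suc n)) }
  where
  nonneg : ∀ n → ℤ-Ring.ι (+ n) ≡ + n
  nonneg zero    = ≡.refl
  nonneg (suc n) = ≡.trans (ℤ-Ring.ι-+ 1ℤ (+ n)) (≡.cong (λ y → 1ℤ ℤ.+ y) (nonneg n))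

ℤ-nonZeroDivisor : ∀ {c} → c ≢ 0ℤ → ℤ-Ring.NonZeroDivisor c
ℤ-nonZeroDivisor {c} c≢0 x e = [ (λ c≡0 → contradiction c≡0 c≢0) , id ]′ (ℤP.i*j≡0⇒i≡0∨j≡0 c e)

module Discriminant (n : ℕ) (m : ℤ) (b : ℕ) where
  open ℤ-Ring
  open ℤ-Forms

  A N W Q T : ℤ
  A = + b * m ℤ.^ (2 ℕ.* n)
  N = + n
  W = ℤ.suc N
  Q = N * (1ℤ + - A)
  T = 1ℤ + N * A

  T≢0 : T ≢ 0ℤ
  T≢0 T≡0 with 𝒟-Exactness.root>0 n m b
  ... | w , e = contradiction (≡.trans (≡.sym e) (≡.trans (≡.cong (λ y → 1ℤ + y) (*-comm A N)) T≡0)) λ ()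

  T-nzd : NonZeroDivisor T
  T-nzd = ℤ-nonZeroDivisor T≢0

  -- Because Q - W = - T, `form-telescope` turns T times the form into the numerator of 𝒟, which is
  -- T² 𝒟 by exactness; one factor T is then cancelled.
  form≡T𝒟 : form A Q W n ≡ T * 𝒟 n m b
  form≡T𝒟 = cancelˡ {T} T-nzd (≡.trans T*form (≡.trans (≡.sym (𝒟-exact n m b)) 𝒟*den))
    where
    𝒟*den : 𝒟 n m b * 𝒟-den n m b ≡ T * (T * 𝒟 n m b)
    𝒟*den = solve 3 (λ D A N → D :* (con 1ℤ :+ A :* N) :^ 2 := (con 1ℤ :+ N :* A) :* ((con 1ℤ :+ N :* A) :* D)) refl (𝒟 n m b) A N
    num : 𝒟-num n m b ≡ (1ℤ + - A) * Q ^ n + A * (W * W ^ n)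
    num = ≡.trans (≡.cong₂ _+_
      (solve 3 (λ u v c → u :* (c :* v) := c :* (u :* v)) refl (N ℤ.^ n) ((1ℤ + - A) ℤ.^ n) (1ℤ + - A))
      (≡.cong (λ y → A * y) (≡.trans (≡.cong (ℤ._^ suc n) (ℤP.+-comm N 1ℤ)) (≡.cong (W *_) (≡.sym (^-ℤ W n))))))
      (≡.cong (λ y → (1ℤ + - A) * y + A * (W * W ^ n))
        (≡.trans (≡.cong₂ _*_ (≡.sym (^-ℤ N n)) (≡.sym (^-ℤ (1ℤ + - A) n))) (≡.sym (^-distrib-* N (1ℤ + - A) n))))
    T*form : T * form A Q W n ≡ 𝒟-num n m b
    T*form = ≡.trans (lin₁ (- 1ℤ) (form-telescope A Q W n) (solve 5 (λ A N f u v →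
        let W = con 1ℤ :+ N ; Q = N :* (con 1ℤ :+ :- A) in
        (con 1ℤ :+ N :* A) :* f :+ :- con 1ℤ :* ((Q :+ :- W) :* u :+ A :* (W :* (u :+ :- v)))
          := ((con 1ℤ :+ :- A) :* u :+ A :* (W :* v)) :+ :- con 1ℤ :* ((Q :+ :- W) :* f)) refl A N (form A Q W n) (Q ^ n) (W ^ n)))
      (≡.sym num)

  private
    W-T≡Q : W + - T ≡ Q
    W-T≡Q = solve 2 (λ A N → (con 1ℤ :+ N) :+ :- (con 1ℤ :+ N :* A) := N :* (con 1ℤ :+ :- A)) refl A N

  -- Writing w = pw′, t = pt′, q = pq′, the difference t′ = w′ - q′ divides
  -- form a q′ w′ n, because it divides form a w′ w′ n = w′ⁿ t.
  square∣𝒟 : ∀ {p} → 3 ℕ.≤ n → p ∣ W → p ∣ T → p * p ∣ 𝒟 n m b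
  square∣𝒟 {p} (s≤s (s≤s (s≤s {n = j} _))) (w , wp≡W) (t , tp≡T) =
    (p ^ j * c) , ≡.trans (solve 3 (λ p u c → (u :* c) :* (p :* p) := (p :* (p :* u)) :* c) refl p (p ^ j) c) (≡.sym 𝒟≡)
    where
    q = w + - t
    Q≡ : p * q ≡ Q
    Q≡ = ≡.trans (lin₂ 1ℤ (- 1ℤ) wp≡W tp≡T (solve 5 (λ p w t W T →
        p :* (w :+ :- t) :+ (con 1ℤ :* W :+ :- con 1ℤ :* T) := (W :+ :- T) :+ (con 1ℤ :* (w :* p) :+ :- con 1ℤ :* (t :* p))) refl p w t W T)) W-T≡Q
    t∣form : t ∣ form A q w n
    t∣form = ∣ʳ-respʳ-≈ (solve 2 (λ f g → (f :+ :- g) :+ g := f) refl (form A q w n) (form A w w n))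
      (∣-+ (∣ʳ-trans (- 1ℤ , solve 2 (λ w t → :- con 1ℤ :* t := w :+ :- t :+ :- w) refl w t) (form-mod A q w w n))
           (∣ʳ-respʳ-≈ (≡.sym (≡.trans (form-diagonal A w n) (≡.cong (λ y → w ^ n * (1ℤ + y * A)) (ι-ℤ (+ n)))))
             (∣-*ˡ (w ^ n) (∣ʳ-respʳ-≈ tp≡T (x∣x*y t p)))))
    c = proj₁ (∣⇒∃ t∣form)
    𝒟≡ : 𝒟 n m b ≡ p ^ suc (suc j) * c
    𝒟≡ = cancelˡ {T} T-nzd (begin
      T * 𝒟 n m b                      ≈⟨ form≡T𝒟 ⟨
      form A Q W n                     ≈⟨ form-cong {A} n refl (≡.sym Q≡) (≡.trans (≡.sym wp≡W) (*-comm w p)) ⟩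
      form A (p * q) (p * w) n         ≈⟨ form-scale A p q w n ⟩
      p ^ n * form A q w n             ≈⟨ *-congˡ {p ^ n} (proj₂ (∣⇒∃ t∣form)) ⟨
      -- Here n = j + 3. One of the n factors p is spent on turning t into T, and p^(n-1) = p^(j+2)
      -- remains for 𝒟.
      p ^ n * (c * t)                  ≈⟨ solve 4 (λ p u c t → (p :* u) :* (c :* t) := (t :* p) :* (u :* c)) refl p (p ^ suc (suc j)) c t ⟩
      (t * p) * (p ^ suc (suc j) * c)  ≈⟨ *-congʳ {p ^ suc (suc j) * c} tp≡T ⟩
      T * (p ^ suc (suc j) * c)        ∎)


-- p-maximality for p not dividing bm

form-quotient : ∀ R c a q w n → Forms.form (Quotient.ring/ R c) a q w n ≡ Forms.form R a q w n
form-quotient R c a q w n = ≡.cong₂ (λ u v → u + a * v) (^-quotient R c q n) (geo-quotient n)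
  where
  open RingKit R
  geo-quotient : ∀ n → Forms.geo (Quotient.ring/ R c) q w n ≡ Forms.geo R q w n
  geo-quotient zero    = ≡.refl
  geo-quotient (suc n) = ≡.cong₂ (λ u v → w * (u + v)) (^-quotient R c q n) (geo-quotient n)

coprime-∣ℤ : ∀ {x y z} → ℤ-Ring.Coprime x y → x ∣ℤ y ℤ.* z → x ∣ℤ z
coprime-∣ℤ {x} {y} {z} = ℤ-Ring.coprime⇒∣ {x} {y} {z}

module UnramifiedPrime (i : ℕ) (m : ℤ) (b k : ℕ) (1≤k : 1 ℕ.≤ k) (p : ℕ) (pr : Prime p)
                       (p∤m : ¬ (+ p ∣ℤ m)) (p∤b : ¬ (+ p ∣ℤ + b)) (p∤k : ¬ (+ p ∣ℤ + k)) where
  private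
    n : ℕ
    n = suc i
  open AtPrime n m b k (s≤s z≤n) 1≤k p pr
  open Family n m b k
  open ModPrime p pr
  open FermatModPrime p pr
  open QuotientDerivation ℤ[X] δ δ-isDerivation (C (+ p)) (δ-C (+ p))
  open Discriminant n m b using (A; N; W; Q; T; form≡T𝒟; square∣𝒟)

  private
    ι-unit : ∀ c → ¬ (+ p ∣ℤ c) → Fx.ι c Fx.∣ C 1ℤ
    ι-unit c p∤c = Fx.∣ʳ-respˡ-≈ (Fx.sym (ι≈C c)) (constant-unit c p∤c)

    ι≈0 : ∀ {c} → + p ∣ℤ c → Fx.ι c Fx.≈ []
    ι≈0 {c} p∣c = Fx.trans (ι≈C c) (C≈0 p∣c)

    p∤m^ : ∀ j → ¬ (+ p ∣ℤ m ℤ.^ j)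
    p∤m^ j d = p∤m (prime-∣ℤ-^ pr m j (≡.subst (+ p ∣ℤ_) (≡.sym (^-ℤ m j)) d))

    p∤A : ¬ (+ p ∣ℤ A)
    p∤A d = [ p∤b , p∤m^ (2 ℕ.* n) ]′ (prime-∣ℤ pr (+ b) (m ℤ.^ (2 ℕ.* n)) d)

    δz : δ z Fx.≈ C (+ k) Fx.* z
    δz = ≋⇒≈ (begin
      δ (C m ^ 2 * X ^ k)                       ≈⟨ δ-cong (*-congʳ {X ^ k} (C-^ m 2)) ⟨
      δ (C (m ℤ.^ 2) * X ^ k)                   ≈⟨ δ-C* (m ℤ.^ 2) (X ^ k) ⟩
      C (m ℤ.^ 2) * δ (X ^ k)                   ≈⟨ *-cong {C (m ℤ.^ 2)} (C-^ m 2) (δ-X^ k) ⟩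
      C m ^ 2 * (C (+ k) * X ^ k)               ≈⟨ x∙yz≈y∙xz (C m ^ 2) (C (+ k)) (X ^ k) ⟩
      C (+ k) * (C m ^ 2 * X ^ k)               ∎)
      where
      open Zx
      open CommutativeSemigroupProperties Zx.*-commutativeSemigroup using (x∙yz≈y∙xz)

    module U = Unramified 𝔽p[X] δ isDerivation/ i A z (C (+ k)) δz (constant-unit (+ k) p∤k) (ι-unit A p∤A)

    P : Poly
    P = FZ.form (Zx.ι A) z Zx.1# n

    M : Poly
    M = C m Zx.^ (2 ℕ.* n)

    MF≋P : M Zx.* F ≋ P
    MF≋P = Zx.trans scaled (FZ.form-cong n A≋ Zx.refl Zx.refl)
      where
      A≋ : C (+ b) Zx.* C m Zx.^ (2 ℕ.* n) ≋ Zx.ι A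
      A≋ = Zx.trans (Zx.*-congˡ {C (+ b)} (Zx.sym (C-^ m (2 ℕ.* n)))) (Zx.trans (Zx.sym (C-* (+ b) (m ℤ.^ (2 ℕ.* n)))) (C≋ι A))

    M-unit : M Fx.∣ C 1ℤ
    M-unit = Fx.∣ʳ-respˡ-≈ (≋⇒≈ (C-^ m (2 ℕ.* n))) (constant-unit (m ℤ.^ (2 ℕ.* n)) (p∤m^ (2 ℕ.* n)))

    U-P≡P : U.P ≡ P
    U-P≡P = ≡.trans (form-quotient ℤ[X] (C (+ p)) (Fx.ι A) z Zx.1# n)
      (≡.cong (λ a → FZ.form a z Zx.1# n) (ι-quotient ℤ[X] (C (+ p)) A))

    P∣F : U.P Fx.∣ F
    P∣F = Fx.∣ʳ-respˡ-≈ (Fx.trans (≋⇒≈ MF≋P) (Fx.reflexive (≡.sym U-P≡P)))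
      (Fx.∣ʳ-respʳ-≈ (Fx.*-identityˡ F) (Fx.∙-cong-∣ M-unit (Fx.∣ʳ-refl {F})))

    F∣P : F Fx.∣ U.P
    F∣P = Fx._,_ M (Fx.trans (≋⇒≈ MF≋P) (Fx.reflexive (≡.sym U-P≡P)))

    ∣F⇒constant : ∀ f → f Fx.∣ F → ¬ (+ p ∣ℤ coeff f 0)
    ∣F⇒constant f f∣F p∣f₀ = p∤b (≡.subst (+ p ∣ℤ_) (F-constant 1≤k (s≤s z≤n)) (X∣⇒ F (Fx.∣ʳ-trans (⇒X∣ f p∣f₀) f∣F)))

    P-nzd : Fx.NonZeroDivisor U.P
    P-nzd = constant⇒nonZeroDivisor U.P (∣F⇒constant U.P P∣F)

    separable⇒maximal : Separable U.P → Maximal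
    separable⇒maximal sep = maximal-if-reduced λ f j F∣f^j →
      Fx.∣ʳ-trans F∣P (radical U.P (∣F⇒constant U.P P∣F) sep f j (Fx.∣ʳ-trans P∣F F∣f^j))

    -- Over ℤ, P = S ℓ + r₀ p with ℓ = z - y. As ℓ divides S modulo p, S² is a multiple of F there,
    -- so the criterion applies with h = S, u = ℓ and r = - r₀.
    module DoubleRoot (p∤W : ¬ (+ p ∣ℤ W)) (p∤T : ¬ (+ p ∣ℤ T)) (y r₀ : ℤ)
                      (p∣Wy-Q : + p ∣ℤ W ℤ.* y ℤ.+ ℤ.- Q)
                      (r₀p≡ : r₀ ℤ.* + p ≡ ℤ-Forms.form A y 1ℤ n) (p∤r₀ : ¬ (+ p ∣ℤ r₀)) where
      Y ℓ S : Poly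
      Y = Fx.ι y
      ℓ = z Zx.+ Zx.- Y
      ℓ∣ : ℓ Zx.∣ P Zx.+ Zx.- FZ.form (Zx.ι A) Y Zx.1# n
      ℓ∣ = FZ.form-mod (Zx.ι A) z Y Zx.1# n
      S = proj₁ (Zx.∣⇒∃ ℓ∣)
      form-y : FZ.form (Zx.ι A) Y Zx.1# n ≋ C r₀ Zx.* C (+ p)
      form-y = begin
        FZ.form (ι A) Y 1# n              ≈⟨ FZ.form-cong {ι A} {w = 1# } n refl (reflexive (ι-quotient ℤ[X] (C (+ p)) y)) refl ⟩
        FZ.form (ι A) (ι y) (ι 1ℤ) n      ≈⟨ FormsOfIntegers.ι-form ℤ[X] A y 1ℤ n ⟨
        ι (ℤ-Forms.form A y 1ℤ n)         ≈⟨ C≋ι (ℤ-Forms.form A y 1ℤ n) ⟨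
        C (ℤ-Forms.form A y 1ℤ n)         ≡⟨ ≡.cong C r₀p≡ ⟨
        C (r₀ ℤ.* + p)                    ≈⟨ C-* r₀ (+ p) ⟩
        C r₀ * C (+ p)                    ∎
        where open Zx
      P≋ : P ≋ S Zx.* ℓ Zx.+ C r₀ Zx.* C (+ p)
      P≋ = rearrange P S ℓ _ _ (proj₂ (Zx.∣⇒∃ ℓ∣)) form-y
        where
        rearrange : ∀ P S ℓ g h → S Zx.* ℓ ≋ P Zx.+ Zx.- g → g ≋ h → P ≋ S Zx.* ℓ Zx.+ h
        rearrange P S ℓ g h e e′ = lin₂ (- 1#) 1# e e′ (solve 5 (λ P S ℓ g h →
          P :+ (:- con 1ℤ :* (P :+ :- g) :+ con 1ℤ :* h) := (S :* ℓ :+ h) :+ (:- con 1ℤ :* (S :* ℓ) :+ con 1ℤ :* g)) refl P S ℓ g h)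
          where open Zx
      P≈ : U.P Fx.≈ ℓ Fx.* S
      P≈ = Fx.trans (Fx.reflexive U-P≡P) (Fx.trans (≋⇒≈ P≋) (Fx.trans
        (Fx.+-cong (Fx.*-comm S ℓ) (∣⇒≈0 (Zx._,_ (C r₀) Zx.refl))) (Fx.+-identityʳ (ℓ Zx.* S))))
      Wy≈Q : Fx.ι W Fx.* Y Fx.≈ Fx.ι Q
      Wy≈Q = Fx.x-y≈0⇒x≈y (Fx.trans (Fx.+-cong (Fx.sym (Fx.ι-* W y)) (Fx.sym (Fx.ι-neg Q)))
        (Fx.trans (Fx.sym (Fx.ι-+ (W ℤ.* y) (ℤ.- Q))) (ι≈0 p∣Wy-Q)))
      S∣F : S Fx.∣ F
      S∣F = Fx.∣ʳ-trans (Fx._,_ ℓ (Fx.sym P≈)) P∣F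
      ℓ∣S : ℓ Fx.∣ S
      ℓ∣S = U.root-double P-nzd (ι-unit W p∤W) (ι-unit T p∤T) y Wy≈Q S P≈
      S-separable : Separable S
      S-separable = U.separable-S P-nzd (ι-unit W p∤W) (ι-unit T p∤T) y Wy≈Q S P≈
      F∣S² : F Fx.∣ S Fx.^ 2
      F∣S² = Fx.∣ʳ-trans F∣P (Fx.∣ʳ-respˡ-≈ (Fx.sym P≈) (Fx.∙-cong-∣ ℓ∣S (Fx.x∣x*y S (C 1ℤ))))
      maximal : Maximal
      maximal = maximal-if-dedekind {S} {ℓ} {Zx.- C r₀} {M}
        (Zx.trans MF≋P (Zx.trans P≋ (lem S ℓ (C r₀) (C (+ p))))) M-unit
        (constant⇒nonZeroDivisor S (∣F⇒constant S S∣F))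
        (constant-unit (ℤ.- r₀) λ d → p∤r₀ (ℤ-Ring.∣ʳ-respʳ-≈ (ℤP.neg-involutive r₀) (ℤ-Ring.∣-neg d)))
        (radical S (∣F⇒constant S S∣F) S-separable) 2 F∣S²
        where
        lem : ∀ S ℓ r p → S Zx.* ℓ Zx.+ r Zx.* p ≋ S Zx.* ℓ Zx.+ Zx.- (p Zx.* Zx.- r)
        lem = solve 4 (λ S ℓ r p → S :* ℓ :+ r :* p := S :* ℓ :+ :- (p :* :- r)) refl where open Zx

  -- For p ∣ 𝒟 and p ∤ W T, the double root of P mod p lifts to an integer y
  -- with W y ≡ Q mod p², and then Wⁿ P(y) ≡ T 𝒟 mod p².
  private
    coprime-square : ∀ c → ¬ (+ p ∣ℤ c) → ℤ-Ring.Coprime (+ p ℤ.* + p) c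
    coprime-square c p∤c = ℤ-Ring.coprime-sym {c} {+ p ℤ.* + p} (ℤ-Ring.coprime-*ʳ {c} {+ p} {+ p} (prime-coprime pr c p∤c) (prime-coprime pr c p∤c))

    double-root : (p∤W : ¬ (+ p ∣ℤ W)) (p∤T : ¬ (+ p ∣ℤ T)) → + p ∣ℤ 𝒟 n m b → ¬ (+ p ℤ.* + p ∣ℤ 𝒟 n m b) → Maximal
    double-root p∤W p∤T p∣𝒟 p²∤𝒟 = DoubleRoot.maximal p∤W p∤T y r₀ (∣ʳ-trans (x∣x*y (+ p) (+ p)) p²∣Wy-Q) (proj₂ (∣⇒∃ p∣form)) p∤r₀
      where
      open ℤ-Ring
      open ℤ-Forms
      cop : Coprime (+ p * + p) W
      cop = coprime-square W p∤W
      v = proj₁ cop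
      u = proj₁ (proj₂ cop)
      y = u * Q
      p²∣Wy-Q : + p * + p ∣ W * y + - Q
      p²∣Wy-Q = - v * Q , lin₁ (- Q) (proj₂ (proj₂ cop)) (solve 5 (λ v u W Q p →
        :- v :* Q :* (p :* p) :+ :- Q :* con 1ℤ := (W :* (u :* Q) :+ :- Q) :+ :- Q :* (v :* (p :* p) :+ u :* W)) refl v u W Q (+ p))
      p²∣W^form-T𝒟 : + p * + p ∣ W ^ n * form A y 1ℤ n + - (T * 𝒟 n m b)
      p²∣W^form-T𝒟 = ∣ʳ-respʳ-≈ (≡.cong₂ _+_ (≡.trans (≡.cong (λ w → form A (W * y) w n) (≡.sym (*-identityʳ W))) (form-scale A W y 1ℤ n))
          (≡.cong -_ form≡T𝒟))
        (∣ʳ-trans p²∣Wy-Q (form-mod A (W * y) Q W n))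
      p∤W^ : ¬ (+ p ∣ W ^ n)
      p∤W^ d = p∤W (prime-∣ℤ-^ pr W n d)
      p∣form : + p ∣ form A y 1ℤ n
      p∣form = [ (λ d → contradiction d p∤W^) , id ]′ (prime-∣ℤ pr (W ^ n) (form A y 1ℤ n)
        (∣ʳ-respʳ-≈ (solve 2 (λ x y → (x :+ :- y) :+ y := x) refl (W ^ n * form A y 1ℤ n) (T * 𝒟 n m b))
          (∣-+ (∣ʳ-trans (x∣x*y (+ p) (+ p)) p²∣W^form-T𝒟) (∣-*ˡ T p∣𝒟))))
      r₀ = proj₁ (∣⇒∃ p∣form)
      p∤r₀ : ¬ (+ p ∣ r₀)
      p∤r₀ p∣r₀ = p²∤𝒟 (coprime-∣ℤ (coprime-square T p∤T)
        (∣ʳ-respʳ-≈ (solve 2 (λ x y → :- (x :+ :- y) :+ x := y) refl (W ^ n * form A y 1ℤ n) (T * 𝒟 n m b))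
          (∣-+ (∣-neg p²∣W^form-T𝒟) (∣-*ˡ (W ^ n) (∣ʳ-respʳ-≈ (proj₂ (∣⇒∃ p∣form)) (∙-cong-∣ p∣r₀ ∣ʳ-refl))))))

  maximal-unramified : 3 ℕ.≤ n → ¬ (+ p ℤ.* + p ∣ℤ 𝒟 n m b) → Maximal
  maximal-unramified 3≤n p²∤𝒟 = cases (+ p ∣ℤ? ℤ-Forms.form A Q W n) (+ p ∣ℤ? W) (+ p ∣ℤ? T)
    where
    -- The form is Qⁿ modulo W, so p divides Q, and T = W - Q.
    p∣W⇒p∣T : + p ∣ℤ ℤ-Forms.form A Q W n → + p ∣ℤ W → + p ∣ℤ T
    p∣W⇒p∣T p∣form p∣W = ∣ʳ-respʳ-≈
        (solve 2 (λ N A → (con 1ℤ :+ N) :+ :- (N :* (con 1ℤ :+ :- A)) := con 1ℤ :+ N :* A) refl N A)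
        (∣-+ p∣W (∣-neg {y = Q} p∣Q))
      where
      open ℤ-Ring
      p∣Q : + p ∣ Q
      p∣Q = prime-∣ℤ-^ pr Q n (∣ʳ-respʳ-≈
        (solve 2 (λ f q → :- (f :+ :- q) :+ f := q) refl (ℤ-Forms.form A Q W n) (Q ^ n))
        (∣-+ (∣-neg (∣ʳ-trans p∣W (ℤ-Forms.form-at-0 A Q W n))) p∣form))
    -- The cases follow L modulo p: it has no root in common with P; it vanishes identically, which
    -- `square∣𝒟` excludes; its root is z = 1, a simple root of P; or its root is a double root of
    -- P, controlled by 𝒟.
    cases : Dec (+ p ∣ℤ ℤ-Forms.form A Q W n) → Dec (+ p ∣ℤ W) → Dec (+ p ∣ℤ T) → Maximal
    cases (no p∤form) _ _ = separable⇒maximal (U.separable-P (ι-unit (ℤ-Forms.form A Q W n) p∤form))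
    cases (yes p∣form) (yes p∣W) _ = contradiction (square∣𝒟 3≤n p∣W (p∣W⇒p∣T p∣form p∣W)) p²∤𝒟
    cases (yes p∣form) (no p∤W) (yes p∣T) = separable⇒maximal (U.separable-P-at-1 P-nzd (ι-unit W p∤W) (ι≈0 p∣T))
    cases (yes p∣form) (no p∤W) (no p∤T) = double-root p∤W p∤T
      ([ (λ d → contradiction d p∤T) , id ]′ (prime-∣ℤ pr T (𝒟 n m b) (≡.subst (+ p ∣ℤ_) form≡T𝒟 p∣form))) p²∤𝒟


-- From ℤ[x] to ℚ[x]

infix 9 _/1
_/1 : ℤ → ℚ
z /1 = z ℚ./ 1

private
  toℚᵘ-/1 : ∀ z → ℚ.toℚᵘ (z /1) ℚᵘ.≃ mkℚᵘ z 0
  toℚᵘ-/1 z = ℚP.toℚᵘ-fromℚᵘ (mkℚᵘ z 0)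

/1-+ : ∀ a b → (a ℤ.+ b) /1 ≡ a /1 ℚ.+ b /1
/1-+ a b = ℚP.toℚᵘ-injective (begin
  ℚ.toℚᵘ ((a ℤ.+ b) /1)                  ≈⟨ toℚᵘ-/1 (a ℤ.+ b) ⟩
  mkℚᵘ (a ℤ.+ b) 0                       ≈⟨ *≡* (ℤ-Ring.solve 2 (λ a b → (a ℤ-Ring.:+ b) ℤ-Ring.:* ℤ-Ring.con 1ℤ ℤ-Ring.:=
                                             (a ℤ-Ring.:* ℤ-Ring.con 1ℤ ℤ-Ring.:+ b ℤ-Ring.:* ℤ-Ring.con 1ℤ) ℤ-Ring.:* ℤ-Ring.con 1ℤ) ≡.refl a b) ⟩
  mkℚᵘ a 0 ℚᵘ.+ mkℚᵘ b 0                 ≈⟨ ℚᵘP.+-cong (toℚᵘ-/1 a) (toℚᵘ-/1 b) ⟨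
  ℚ.toℚᵘ (a /1) ℚᵘ.+ ℚ.toℚᵘ (b /1)       ≈⟨ ℚP.toℚᵘ-homo-+ (a /1) (b /1) ⟨
  ℚ.toℚᵘ (a /1 ℚ.+ b /1)                 ∎)
  where open ℚᵘP.≃-Reasoning

/1-* : ∀ a b → (a ℤ.* b) /1 ≡ a /1 ℚ.* b /1
/1-* a b = ℚP.toℚᵘ-injective (begin
  ℚ.toℚᵘ ((a ℤ.* b) /1)                  ≈⟨ toℚᵘ-/1 (a ℤ.* b) ⟩
  mkℚᵘ (a ℤ.* b) 0                       ≈⟨ ℚᵘP.*-cong (toℚᵘ-/1 a) (toℚᵘ-/1 b) ⟨
  ℚ.toℚᵘ (a /1) ℚᵘ.* ℚ.toℚᵘ (b /1)       ≈⟨ ℚP.toℚᵘ-homo-* (a /1) (b /1) ⟨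
  ℚ.toℚᵘ (a /1 ℚ.* b /1)                 ∎)
  where open ℚᵘP.≃-Reasoning

/1-injective : ∀ {a b} → a /1 ≡ b /1 → a ≡ b
/1-injective {a} {b} e with ℚᵘP.≃-trans (ℚᵘP.≃-sym (toℚᵘ-/1 a)) (ℚᵘP.≃-trans (ℚP.toℚᵘ-cong e) (toℚᵘ-/1 b))
... | *≡* a*1≡b*1 = ≡.trans (≡.sym (ℤP.*-identityʳ a)) (≡.trans a*1≡b*1 (ℤP.*-identityʳ b))

denominator*q : ∀ q → (ℚ.↧ q) /1 ℚ.* q ≡ (ℚ.↥ q) /1
denominator*q q@(ℚ.mkℚ n d-1 _) = ℚP.toℚᵘ-injective (begin
  ℚ.toℚᵘ ((ℚ.↧ q) /1 ℚ.* q)                     ≈⟨ ℚP.toℚᵘ-homo-* ((ℚ.↧ q) /1) q ⟩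
  ℚ.toℚᵘ ((ℚ.↧ q) /1) ℚᵘ.* mkℚᵘ n d-1           ≈⟨ ℚᵘP.*-congʳ {mkℚᵘ n d-1} (toℚᵘ-/1 (ℚ.↧ q)) ⟩
  mkℚᵘ (+ suc d-1) 0 ℚᵘ.* mkℚᵘ n d-1            ≈⟨ *≡* (≡.trans (ℤP.*-identityʳ (+ suc d-1 ℤ.* n)) (≡.trans (ℤP.*-comm (+ suc d-1) n)
                                                     (≡.cong (λ k → n ℤ.* + k) (≡.sym (ℕP.*-identityˡ (suc d-1)))))) ⟩
  mkℚᵘ n 0                                      ≈⟨ toℚᵘ-/1 n ⟨
  ℚ.toℚᵘ (n /1)                                 ∎)
  where open ℚᵘP.≃-Reasoning

/1-neg : ∀ a → (ℤ.- a) /1 ≡ ℚ.- a /1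
/1-neg a = ℚ-Ring.x-y≈0⇒x≈y (≡.trans (≡.cong ((ℤ.- a) /1 ℚ.+_) (ℚ-Ring.-‿involutive (a /1)))
    (≡.trans (≡.sym (/1-+ (ℤ.- a) a)) (≡.cong _/1 (ℤP.+-inverseˡ a))))
  where module ℚ-Ring = RingKit ℚP.+-*-commutativeRing

/1-inverse : ∀ {c} → c ≢ 0ℤ → ∃[ r ] r ℚ.* c /1 ≡ ℚ.1ℚ
/1-inverse {c} c≢0 = ℚ.1/ (c /1) , ℚP.*-inverseˡ (c /1)
  where instance _ = ℚ.≢-nonZero {c /1} (c≢0 ∘ /1-injective)

ℚ[X] : CommutativeRing 0ℓ 0ℓ
ℚ[X] = PolynomialRing.commutativeRing ℚP.+-*-commutativeRing

module Qx where
  open PolynomialRing ℚP.+-*-commutativeRing public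
    using (Poly; coeff; C; X; _≋_; coeffwise; at; coeff-+; coeff-∙; coeff-neg; _∙ₚ_; ∷-cong; ∷-zero; +ₚ-identityʳ; shift-*ₚ)
  open RingKit ℚ[X] public

φ : Poly → Qx.Poly
φ = ℤ[x]→ℚ[x]

coeff-φ : ∀ f i → Qx.coeff (φ f) i ≡ coeff f i /1
coeff-φ []      i       = ≡.refl
coeff-φ (a ∷ f) zero    = ≡.refl
coeff-φ (a ∷ f) (suc i) = coeff-φ f i

φ-cong : ∀ {f g} → f ≋ g → φ f Qx.≋ φ g
φ-cong {f} {g} e = Qx.coeffwise λ i → ≡.trans (coeff-φ f i) (≡.trans (≡.cong _/1 (at e i)) (≡.sym (coeff-φ g i)))

φ-injective : ∀ {f g} → φ f Qx.≋ φ g → f ≋ g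
φ-injective {f} {g} e = coeffwise λ i → /1-injective (≡.trans (≡.sym (coeff-φ f i)) (≡.trans (Qx.at e i) (coeff-φ g i)))

φ-+ : ∀ f g → φ (f Zx.+ g) Qx.≋ φ f Qx.+ φ g
φ-+ []      g       = Qx.refl
φ-+ (a ∷ f) []      = Qx.refl
φ-+ (a ∷ f) (b ∷ g) = Qx.∷-cong (/1-+ a b) (φ-+ f g)

φ-neg : ∀ f → φ (Zx.- f) Qx.≋ Qx.- φ f
φ-neg []      = Qx.refl
φ-neg (a ∷ f) = Qx.∷-cong (/1-neg a) (φ-neg f)

φ-∙ : ∀ a f → φ (a ∙ₚ f) Qx.≋ (a /1) Qx.∙ₚ φ f
φ-∙ a []      = Qx.refl
φ-∙ a (b ∷ f) = Qx.∷-cong (/1-* a b) (φ-∙ a f)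

φ-* : ∀ f g → φ (f Zx.* g) Qx.≋ φ f Qx.* φ g
φ-* []      g = Qx.refl
φ-* (a ∷ f) g = Qx.trans (φ-+ (a ∙ₚ g) (0ℤ ∷ f Zx.* g)) (Qx.+-cong (φ-∙ a g) (Qx.∷-cong ≡.refl (φ-* f g)))

φ-^ : ∀ f i → φ (f Zx.^ i) Qx.≋ φ f Qx.^ i
φ-^ f zero    = Qx.refl
φ-^ f (suc i) = Qx.trans (φ-* f (f Zx.^ i)) (Qx.*-congˡ {φ f} (φ-^ f i))

φ-ι : ∀ c → φ (C c) Qx.≋ Qx.ι c
φ-ι (+ n)    = nonneg n
  where
  nonneg : ∀ n → φ (C (+ n)) Qx.≋ Qx.ι (+ n)
  nonneg zero    = Qx.∷-zero ≡.refl Qx.refl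
  nonneg (suc n) = Qx.trans (φ-+ (C 1ℤ) (C (+ n))) (Qx.trans (Qx.+-congˡ {Qx.C ℚ.1ℚ} (nonneg n)) (Qx.sym (Qx.ι-+ 1ℤ (+ n))))
φ-ι -[1+ n ] = Qx.trans (φ-neg (C (+ suc n))) (Qx.-‿cong (φ-ι (+ suc n)))

φ-divides : ∀ {f g} → f Zx.∣ g → φ f Qx.∣ φ g
φ-divides {f} d = let q , e = Zx.∣⇒∃ d in φ q Qx., Qx.trans (Qx.sym (φ-* q f)) (φ-cong e)

coeff-C*ℚ : ∀ a f i → Qx.coeff (Qx.C a Qx.* f) i ≡ a ℚ.* Qx.coeff f i
coeff-C*ℚ a f i = ≡.trans (Qx.coeff-+ (a Qx.∙ₚ f) (ℚ.0ℚ ∷ []) i)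
  (≡.trans (≡.cong₂ ℚ._+_ (Qx.coeff-∙ a f i) (zero-coeff i)) (ℚP.+-identityʳ _))
  where
  zero-coeff : ∀ i → Qx.coeff (ℚ.0ℚ ∷ []) i ≡ ℚ.0ℚ
  zero-coeff zero    = ≡.refl
  zero-coeff (suc i) = ≡.refl

clearDenominators : ∀ f → ∃[ N ] ∃[ A ] 1 ℕ.≤ N × φ (C (+ N)) Qx.* f Qx.≋ φ A
clearDenominators [] = 1 , [] , s≤s z≤n , Qx.zeroʳ (φ (C 1ℤ))
clearDenominators (q ∷ f) with clearDenominators f
... | N , A , 1≤N , e = M ℕ.* N , (+ N ℤ.* ℚ.↥ q) ∷ C (+ M) Zx.* A , ℕP.*-mono-≤ (s≤s (z≤n {ℚ.denominator-1 q})) 1≤N ,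
  Qx.coeffwise λ where
    zero → begin
      Qx.coeff (φ (C (+ (M ℕ.* N))) Qx.* (q ∷ f)) 0    ≡⟨ coeff-C*ℚ ((+ (M ℕ.* N)) /1) (q ∷ f) 0 ⟩
      (+ (M ℕ.* N)) /1 ℚ.* q                           ≡⟨ ≡.cong (λ y → y /1 ℚ.* q) (≡.trans (ℤP.pos-* M N) (ℤP.*-comm (+ M) (+ N))) ⟩
      (+ N ℤ.* + M) /1 ℚ.* q                           ≡⟨ ≡.cong (ℚ._* q) (/1-* (+ N) (+ M)) ⟩
      (+ N) /1 ℚ.* (+ M) /1 ℚ.* q                      ≡⟨ ℚP.*-assoc ((+ N) /1) ((+ M) /1) q ⟩
      (+ N) /1 ℚ.* ((+ M) /1 ℚ.* q)                    ≡⟨ ≡.cong ((+ N) /1 ℚ.*_) (denominator*q q) ⟩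
      (+ N) /1 ℚ.* (ℚ.↥ q) /1                          ≡⟨ /1-* (+ N) (ℚ.↥ q) ⟨
      (+ N ℤ.* ℚ.↥ q) /1                               ∎
    (suc i) → begin
      Qx.coeff (φ (C (+ (M ℕ.* N))) Qx.* (q ∷ f)) (suc i)    ≡⟨ coeff-C*ℚ ((+ (M ℕ.* N)) /1) (q ∷ f) (suc i) ⟩
      (+ (M ℕ.* N)) /1 ℚ.* Qx.coeff f i                      ≡⟨ ≡.cong (λ y → y /1 ℚ.* Qx.coeff f i) (ℤP.pos-* M N) ⟩
      (+ M ℤ.* + N) /1 ℚ.* Qx.coeff f i                      ≡⟨ ≡.cong (ℚ._* Qx.coeff f i) (/1-* (+ M) (+ N)) ⟩
      (+ M) /1 ℚ.* (+ N) /1 ℚ.* Qx.coeff f i                 ≡⟨ ℚP.*-assoc ((+ M) /1) ((+ N) /1) (Qx.coeff f i) ⟩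
      (+ M) /1 ℚ.* ((+ N) /1 ℚ.* Qx.coeff f i)               ≡⟨ ≡.cong ((+ M) /1 ℚ.*_) (≡.trans (≡.sym (coeff-C*ℚ ((+ N) /1) f i)) (≡.trans (Qx.at e i) (coeff-φ A i))) ⟩
      (+ M) /1 ℚ.* (coeff A i) /1                            ≡⟨ /1-* (+ M) (coeff A i) ⟨
      (+ M ℤ.* coeff A i) /1                                 ≡⟨ ≡.cong _/1 (coeff-C* (+ M) A i) ⟨
      (coeff (C (+ M) Zx.* A) i) /1                          ≡⟨ coeff-φ (C (+ M) Zx.* A) i ⟨
      Qx.coeff (φ (C (+ M) Zx.* A)) i                        ∎
  where
  open ≡.≡-Reasoning
  M = ℚ.↧ₙ q

-- Clearing a denominator N of the quotient makes N a a multiple of F over ℤ, and N can be cancelled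
-- modulo the monic F.
φ-divides⁻¹ : ∀ {F d} → HasTop F d 1ℤ → ∀ a → φ F Qx.∣ φ a → F Zx.∣ a
φ-divides⁻¹ {F} top a φF∣φa with clearDenominators (proj₁ (Qx.∣⇒∃ φF∣φa))
... | N@(suc _) , B , _ , e = ≈0⇒∣ (constant-nonZeroDivisor top (+ N) (λ ()) a (∣⇒≈0 (B Zx., φ-injective (begin
    φ (B * F)                          ≈⟨ φ-* B F ⟩
    φ B Qx.* φ F                       ≈⟨ Qx.*-congʳ {φ F} e ⟨
    φ (C (+ N)) Qx.* q Qx.* φ F        ≈⟨ Qx.*-assoc (φ (C (+ N))) q (φ F) ⟩
    φ (C (+ N)) Qx.* (q Qx.* φ F)      ≈⟨ Qx.*-congˡ {φ (C (+ N))} (proj₂ (Qx.∣⇒∃ φF∣φa)) ⟩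
    φ (C (+ N)) Qx.* φ a               ≈⟨ φ-* (C (+ N)) a ⟨
    φ (C (+ N) * a)                    ∎))))
  where
  open Zx using (_*_)
  open Qx using (begin_; step-≈-⟩; step-≈-⟨; _∎)
  open Quotient ℤ[X] F using (≈0⇒∣; ∣⇒≈0)
  q = proj₁ (Qx.∣⇒∃ φF∣φa)


-- Evaluation, the field ℚ(θ) and denominators of integral elements

module Evaluation (K : CommutativeRing 0ℓ 0ℓ) (ι′ : ℤ → CommutativeRing.Carrier K)
                  (ι′≈ι : ∀ c → CommutativeRing._≈_ K (ι′ c) (RingKit.ι K c)) (α : CommutativeRing.Carrier K) where
  open RingKit K

  eval : Poly → Carrier
  eval = List.foldr (λ c acc → ι′ c + α * acc) 0#

  private
    ι′0 : ι′ 0ℤ ≈ 0#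
    ι′0 = ι′≈ι 0ℤ
    ι′-+ : ∀ a b → ι′ (a ℤ.+ b) ≈ ι′ a + ι′ b
    ι′-+ a b = trans (ι′≈ι (a ℤ.+ b)) (trans (ι-+ a b) (sym (+-cong (ι′≈ι a) (ι′≈ι b))))
    ι′-* : ∀ a b → ι′ (a ℤ.* b) ≈ ι′ a * ι′ b
    ι′-* a b = trans (ι′≈ι (a ℤ.* b)) (trans (ι-* a b) (sym (*-cong (ι′≈ι a) (ι′≈ι b))))

  eval-≋0 : ∀ {f} → f ≋ [] → eval f ≈ 0#
  eval-≋0 {[]}    e = refl
  eval-≋0 {a ∷ f} e = trans (+-cong (trans (reflexive (≡.cong ι′ (at e 0))) ι′0)
    (trans (*-congˡ (eval-≋0 {f} (coeffwise (at e ∘ suc)))) (zeroʳ α))) (+-identityˡ 0#)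

  eval-+ : ∀ f g → eval (f Zx.+ g) ≈ eval f + eval g
  eval-+ []      g       = sym (+-identityˡ _)
  eval-+ (a ∷ f) []      = sym (+-identityʳ _)
  eval-+ (a ∷ f) (b ∷ g) = trans (+-cong (ι′-+ a b) (*-congˡ (eval-+ f g)))
    (solve 5 (λ a b x u v → (a :+ b) :+ x :* (u :+ v) := (a :+ x :* u) :+ (b :+ x :* v)) refl (ι′ a) (ι′ b) α (eval f) (eval g))

  eval-∙ : ∀ c f → eval (c ∙ₚ f) ≈ ι′ c * eval f
  eval-∙ c []      = sym (zeroʳ _)
  eval-∙ c (a ∷ f) = trans (+-cong (ι′-* c a) (*-congˡ (eval-∙ c f)))
    (solve 4 (λ c a x u → c :* a :+ x :* (c :* u) := c :* (a :+ x :* u)) refl (ι′ c) (ι′ a) α (eval f))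

  eval-* : ∀ f g → eval (f Zx.* g) ≈ eval f * eval g
  eval-* []      g = sym (zeroˡ _)
  eval-* (a ∷ f) g = trans (eval-+ (a ∙ₚ g) (0ℤ ∷ f Zx.* g)) (trans
    (+-cong (eval-∙ a g) (+-cong ι′0 (*-congˡ (eval-* f g))))
    (solve 4 (λ a x u v → a :* v :+ (con 0ℤ :+ x :* (u :* v)) := (a :+ x :* u) :* v) refl (ι′ a) α (eval f) (eval g)))

  eval-neg : ∀ f → eval (Zx.- f) ≈ - eval f
  eval-neg f = lin₁ (- 1#) (trans (sym (eval-≋0 (Zx.-‿inverseʳ f))) (eval-+ f (Zx.- f)))
    (solve 2 (λ u v → v :+ :- con 1ℤ :* (u :+ v) := :- u :+ :- con 1ℤ :* con 0ℤ) refl (eval f) (eval (Zx.- f)))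

  -- A submodule V containing 1, α, …, α^(e-1) contains all powers of α
  -- as soon as α is a root of a monic polynomial of degree e.
  module _ (V : Carrier → Set) (V-resp : ∀ {x y} → x ≈ y → V x → V y)
           (V-+ : ∀ {x y} → V x → V y → V (x + y)) (V-* : ∀ c {x} → V x → V (ι′ c * x)) where
    private
      -- Horner's rule from the low end: subtracting c α^j removes the constant term of g and leaves
      -- the rest multiplied by α^(j+1), until only the leading coefficient 1 remains.
      V-leading : ∀ g e → HasTop g e 1ℤ → ∀ j → (∀ i → i ℕ.< e → V (α ^ (i ℕ.+ j))) →
                  V (eval g * α ^ j) → V (α ^ (e ℕ.+ j))
      V-leading []      e       (() , _) j lower v
      V-leading (c ∷ g) zero    (c≡1 , low) j lower v = V-resp (trans (*-congʳ (trans
        (+-cong (trans (reflexive (≡.cong ι′ c≡1)) (ι′≈ι 1ℤ))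
          (trans (*-congˡ (eval-≋0 (degreeBelow-0 (degreeBelow-tail low)))) (zeroʳ α))) (+-identityʳ 1#))) (*-identityˡ (α ^ j))) v
      V-leading (c ∷ g) (suc e) (t , low) j lower v = V-resp (reflexive (≡.cong (α ^_) (ℕP.+-suc e j)))
        (V-leading g e (t , degreeBelow-tail low) (suc j)
          (λ i i<e → V-resp (reflexive (≡.cong (α ^_) (≡.sym (ℕP.+-suc i j)))) (lower (suc i) (s≤s i<e)))
          (V-resp (lem (ι′ c) (ι′ (ℤ.- c)) (eval g) (α ^ j) ι′-neg) (V-+ v (V-* (ℤ.- c) (lower 0 (s≤s z≤n))))))
        where
        ι′-neg : ι′ (ℤ.- c) ≈ - ι′ c
        ι′-neg = trans (ι′≈ι (ℤ.- c)) (trans (ι-neg c) (-‿cong (sym (ι′≈ι c))))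
        lem : ∀ c c′ u w → c′ ≈ - c → (c + α * u) * w + c′ * w ≈ u * (α * w)
        lem c c′ u w e = trans (+-congˡ (*-congʳ e))
          (solve 4 (λ c x u w → (c :+ x :* u) :* w :+ :- c :* w := u :* (x :* w)) refl c α u w)

    powers∈ : ∀ g e → HasTop g e 1ℤ → eval g ≈ 0# → V 0# → (∀ i → i ℕ.< e → V (α ^ i)) → ∀ j → V (α ^ j)
    powers∈ g e top root V0 base = ℕInduction.<-rec (λ j → V (α ^ j)) step
      where
      step : ∀ j → (∀ {i} → i ℕ.< j → V (α ^ i)) → V (α ^ j)
      step j rec = choose (j ℕP.<? e)
        where
        choose : Dec (j ℕ.< e) → V (α ^ j)
        choose (yes j<e) = base j j<e
        choose (no  j≮e) = ≡.subst (λ i → V (α ^ i)) (ℕP.m+[n∸m]≡n e≤j)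
          (V-leading g e top (j ∸ e)
            (λ i i<e → rec (≡.subst (i ℕ.+ (j ∸ e) ℕ.<_) (ℕP.m+[n∸m]≡n e≤j) (ℕP.+-monoˡ-< (j ∸ e) i<e)))
            (V-resp (sym (trans (*-congʳ root) (zeroˡ _))) V0))
          where e≤j = ℕP.≮⇒≥ j≮e

module NumberFieldOf (F : Poly) {d : ℕ} (F-monic : HasTop F d 1ℤ) where

  Kθ : CommutativeRing 0ℓ 0ℓ
  Kθ = Quotient.ring/ ℚ[X] (φ F)

  module Kx where
    open RingKit Kθ public
  module Rx where
    open RingKit (ℤ[X]/ F) public

  open Quotient ℚ[X] (φ F) public using () renaming (≈⇒≈/ to ≋⇒≈K; mod to modK; difference to differenceK)

  φ-cong-K : ∀ {f g} → f Rx.≈ g → φ f Kx.≈ φ g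
  φ-cong-K {f} {g} e = modK (Qx.∣ʳ-respʳ-≈ (Qx.trans (φ-+ f (Zx.- g)) (Qx.+-congˡ {φ f} (φ-neg g)))
    (φ-divides (Quotient.difference e)))

  -- ℤ[θ] embeds in ℚ(θ), since divisibility by the monic F descends from ℚ[x] to ℤ[x].
  φ-injective-K : ∀ {f g} → φ f Kx.≈ φ g → f Rx.≈ g
  φ-injective-K {f} {g} e = Quotient.mod (φ-divides⁻¹ F-monic (f Zx.+ Zx.- g)
    (Qx.∣ʳ-respʳ-≈ (Qx.sym (Qx.trans (φ-+ f (Zx.- g)) (Qx.+-congˡ {φ f} (φ-neg g)))) (differenceK e)))

  φ-constant : ∀ c → φ (C c) Kx.≈ Kx.ι c
  φ-constant c = Kx.trans (≋⇒≈K (φ-ι c)) (Kx.reflexive (≡.sym (ι-quotient ℚ[X] (φ F) c)))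

  φ-^-K : ∀ f i → φ (f Rx.^ i) Kx.≈ φ f Kx.^ i
  φ-^-K f i = Kx.trans (≋⇒≈K (Qx.trans (Qx.reflexive (≡.cong φ (^-quotient ℤ[X] F f i))) (φ-^ f i)))
    (Kx.reflexive (≡.sym (^-quotient ℚ[X] (φ F) (φ f) i)))

  φ-*-K : ∀ f g → φ (f Rx.* g) Kx.≈ φ f Kx.* φ g
  φ-*-K f g = ≋⇒≈K (φ-* f g)

  constant-cancel : ∀ {f g c} → c ≢ 0ℤ → φ (C c) Kx.* f Kx.≈ φ (C c) Kx.* g → f Kx.≈ g
  constant-cancel {f} {g} {c} c≢0 e = Kx.trans (Kx.sym (undo f)) (Kx.trans (Kx.*-congˡ {Qx.C r} e) (undo g))
    where
    r = proj₁ (/1-inverse c≢0)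
    undo : ∀ f → Qx.C r Kx.* (φ (C c) Kx.* f) Kx.≈ f
    undo f = ≋⇒≈K (Qx.coeffwise λ i → begin
      Qx.coeff (Qx.C r Qx.* (φ (C c) Qx.* f)) i    ≡⟨ coeff-C*ℚ r (φ (C c) Qx.* f) i ⟩
      r ℚ.* Qx.coeff (φ (C c) Qx.* f) i            ≡⟨ ≡.cong (r ℚ.*_) (coeff-C*ℚ (c /1) f i) ⟩
      r ℚ.* (c /1 ℚ.* Qx.coeff f i)                ≡⟨ ℚP.*-assoc r (c /1) (Qx.coeff f i) ⟨
      (r ℚ.* c /1) ℚ.* Qx.coeff f i                ≡⟨ ≡.cong (ℚ._* Qx.coeff f i) (proj₂ (/1-inverse c≢0)) ⟩
      ℚ.1ℚ ℚ.* Qx.coeff f i                        ≡⟨ ℚP.*-identityˡ _ ⟩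
      Qx.coeff f i                                 ∎)
      where open ≡.≡-Reasoning


module IntegralClosure (F : Poly) {d : ℕ} (F-monic : HasTop F d 1ℤ) where
  open NumberFieldOf F F-monic

  module Eval (α : Qx.Poly) where
    open Evaluation Kθ (λ c → φ (C c)) φ-constant α public

  IsIntegral : Qx.Poly → Set
  IsIntegral α = ∃[ g ] ∃[ e ] HasTop g e 1ℤ × Eval.eval α g Kx.≈ []

  private
    rescale : ∀ η α e i → η Kx.^ e Kx.* α Kx.^ (e ℕ.+ i) Kx.* η Kx.^ i Kx.≈ (η Kx.* α) Kx.^ (e ℕ.+ i)
    rescale η α e i = Kx.trans (Kx.trans (xy∙z≈xz∙y (η Kx.^ e) (α Kx.^ (e ℕ.+ i)) (η Kx.^ i))
        (Kx.*-congʳ {α Kx.^ (e ℕ.+ i)} (Kx.sym (Kx.^-homo-* η e i))))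
      (Kx.sym (Kx.^-distrib-* η α (e ℕ.+ i)))
      where open CommutativeSemigroupProperties Kx.*-commutativeSemigroup using (xy∙z≈xz∙y)

  -- V consists of the x with N^e x in ℤ[θ]. It contains α^i for i < e because N α = a lies in ℤ[θ],
  -- hence all powers of α. This gives s = e: a^(e+i) is N^i times the element N^e α^(e+i) of ℤ[θ].
  integral⇒almostIntegral : ∀ {α a} N → IsIntegral α → φ (C (+ N)) Kx.* α Kx.≈ φ a →
                            ∃[ s ] ∀ i → C (+ N) Rx.^ i Rx.∣ a Rx.^ (s ℕ.+ i)
  integral⇒almostIntegral {α} {a} N (g , e , top , root) Nα≈a = e , λ i →
    let B , eB = bounded (e ℕ.+ i) in Rx._,_ B (φ-injective-K (begin
      φ (B Rx.* C (+ N) Rx.^ i)                    ≈⟨ φ-*-K B (C (+ N) Rx.^ i) ⟩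
      φ B Kx.* φ (C (+ N) Rx.^ i)                  ≈⟨ Kx.*-cong (sym eB) (φ-^-K (C (+ N)) i) ⟩
      η Kx.^ e Kx.* α Kx.^ (e ℕ.+ i) Kx.* η Kx.^ i ≈⟨ rescale η α e i ⟩
      (η Kx.* α) Kx.^ (e ℕ.+ i)                    ≈⟨ Kx.^-congˡ (e ℕ.+ i) Nα≈a ⟩
      φ a Kx.^ (e ℕ.+ i)                           ≈⟨ φ-^-K a (e ℕ.+ i) ⟨
      φ (a Rx.^ (e ℕ.+ i))                         ∎))
    where
    open Kx using (begin_; step-≈-⟩; step-≈-⟨; _∎; trans; sym)
    η = φ (C (+ N))
    V : Qx.Poly → Set
    V x = ∃[ B ] η Kx.^ e Kx.* x Kx.≈ φ B
    V-resp : ∀ {x y} → x Kx.≈ y → V x → V y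
    V-resp x≈y (B , eB) = B , trans (Kx.*-congˡ {η Kx.^ e} (sym x≈y)) eB
    V-+ : ∀ {x y} → V x → V y → V (x Kx.+ y)
    V-+ {x} {y} (B , eB) (B′ , eB′) = B Zx.+ B′ , trans (Kx.distribˡ (η Kx.^ e) x y)
      (trans (Kx.+-cong eB eB′) (sym (≋⇒≈K (φ-+ B B′))))
    V-* : ∀ c {x} → V x → V (φ (C c) Kx.* x)
    V-* c {x} (B , eB) = C c Zx.* B , trans (x∙yz≈y∙xz (η Kx.^ e) (φ (C c)) x)
      (trans (Kx.*-congˡ {φ (C c)} eB) (sym (φ-*-K (C c) B)))
      where open CommutativeSemigroupProperties Kx.*-commutativeSemigroup using (x∙yz≈y∙xz)
    V-base : ∀ i → i ℕ.< e → V (α Kx.^ i)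
    V-base i i<e = C (+ N) Rx.^ (e ∸ i) Rx.* a Rx.^ i , (begin
      η Kx.^ e Kx.* α Kx.^ i                               ≈⟨ Kx.*-congʳ {α Kx.^ i} (trans (Kx.reflexive (≡.cong (η Kx.^_) (≡.sym (ℕP.m∸n+n≡m (ℕP.<⇒≤ i<e))))) (Kx.^-homo-* η (e ∸ i) i)) ⟩
      η Kx.^ (e ∸ i) Kx.* η Kx.^ i Kx.* α Kx.^ i           ≈⟨ Kx.*-assoc (η Kx.^ (e ∸ i)) (η Kx.^ i) (α Kx.^ i) ⟩
      η Kx.^ (e ∸ i) Kx.* (η Kx.^ i Kx.* α Kx.^ i)         ≈⟨ Kx.*-congˡ {η Kx.^ (e ∸ i)} (sym (Kx.^-distrib-* η α i)) ⟩
      η Kx.^ (e ∸ i) Kx.* (η Kx.* α) Kx.^ i                ≈⟨ Kx.*-congˡ {η Kx.^ (e ∸ i)} (Kx.^-congˡ i Nα≈a) ⟩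
      η Kx.^ (e ∸ i) Kx.* φ a Kx.^ i                       ≈⟨ Kx.*-cong (φ-^-K (C (+ N)) (e ∸ i)) (φ-^-K a i) ⟨
      φ (C (+ N) Rx.^ (e ∸ i)) Kx.* φ (a Rx.^ i)           ≈⟨ φ-*-K (C (+ N) Rx.^ (e ∸ i)) (a Rx.^ i) ⟨
      φ (C (+ N) Rx.^ (e ∸ i) Rx.* a Rx.^ i)               ∎)
    bounded : ∀ j → V (α Kx.^ j)
    bounded = Eval.powers∈ α V V-resp V-+ V-* g e top root ([] , Kx.zeroʳ (η Kx.^ e)) V-base

  module _ (maximal : ∀ p → Prime p → ∀ a → ∃[ s ] (∀ i → C (+ p) Rx.^ i Rx.∣ a Rx.^ (s ℕ.+ i)) → C (+ p) Rx.∣ a) where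

    private
      -- The denominator is removed one prime at a time. As p divides the current denominator, the
      -- bound on powers of a holds for p as well; so p divides a by maximality, and both can be
      -- divided by p.
      reduce : ∀ {α} → IsIntegral α → ∀ ps → All Prime ps → ∀ a → φ (C (+ product ps)) Kx.* α Kx.≈ φ a → ∃[ B ] α Kx.≈ φ B
      reduce {α} int []       []         a e = a , Kx.trans (Kx.sym (Kx.*-identityˡ α)) e
      reduce {α} int (p ∷ ps) (pr ∷ prs) a e = reduce int ps prs a₁ (constant-cancel {c = + p} p≢0 (begin
          φ (C (+ p)) Kx.* (φ (C (+ product ps)) Kx.* α)   ≈⟨ Kx.*-assoc (φ (C (+ p))) (φ (C (+ product ps))) α ⟨
          φ (C (+ p)) Kx.* φ (C (+ product ps)) Kx.* α     ≈⟨ Kx.*-congʳ {α} (Kx.trans (φ-cong-K (≋⇒≈R C-product)) (φ-*-K (C (+ p)) (C (+ product ps)))) ⟨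
          φ (C (+ product (p ∷ ps))) Kx.* α                ≈⟨ e ⟩
          φ a                                              ≈⟨ φ-cong-K (proj₂ (Rx.∣⇒∃ p∣a)) ⟨
          φ (a₁ Rx.* C (+ p))                              ≈⟨ φ-cong-K (Rx.*-comm a₁ (C (+ p))) ⟩
          φ (C (+ p) Rx.* a₁)                              ≈⟨ φ-*-K (C (+ p)) a₁ ⟩
          φ (C (+ p)) Kx.* φ a₁                            ∎))
        where
        open Kx using (begin_; step-≈-⟩; step-≈-⟨; _∎)
        open Quotient ℤ[X] F using () renaming (≈⇒≈/ to ≋⇒≈R)
        p≢0 : + p ≢ 0ℤ
        p≢0 ≡.refl = contradiction pr λ ()
        C-product : C (+ product (p ∷ ps)) ≋ C (+ p) Zx.* C (+ product ps)
        C-product = Zx.trans (Zx.reflexive (≡.cong C (ℤP.pos-* p (product ps)))) (C-* (+ p) (+ product ps))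
        p^∣ : ∀ i → C (+ p) Rx.^ i Rx.∣ C (+ product (p ∷ ps)) Rx.^ i
        p^∣ zero    = Rx.∣ʳ-refl
        p^∣ (suc i) = Rx.∙-cong-∣ (Rx.∣ʳ-respʳ-≈ (≋⇒≈R (Zx.sym C-product)) (Rx.x∣x*y (C (+ p)) (C (+ product ps)))) (p^∣ i)
        p∣a : C (+ p) Rx.∣ a
        p∣a = let s , d = integral⇒almostIntegral {α} {a} (product (p ∷ ps)) int e in
          maximal p pr a (s , λ i → Rx.∣ʳ-trans (p^∣ i) (d i))
        a₁ : Poly
        a₁ = proj₁ (Rx.∣⇒∃ p∣a)

    integral⇒integer : ∀ α → IsIntegral α → ∃[ B ] DegreeBelow d B × α Kx.≈ φ B
    integral⇒integer α int = let N , a , 1≤N , e = clearDenominators α in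
      let B , α≈B = integer N a 1≤N e in let q , s , B≋ , low = divide F-monic B in
      s , low , Kx.trans α≈B (φ-cong-K (remainder B q s B≋))
      where
      integer : ∀ N a → 1 ℕ.≤ N → φ (C (+ N)) Qx.* α Qx.≋ φ a → ∃[ B ] α Kx.≈ φ B
      integer N@(suc _) a _ e = reduce int (PrimeFactorisation.factors fact) (PrimeFactorisation.factorsPrime fact) a
        (≡.subst (λ M → φ (C (+ M)) Kx.* α Kx.≈ φ a) (PrimeFactorisation.isFactorisation fact) (≋⇒≈K e))
        where fact = factorise N
      remainder : ∀ B q s → B ≋ q Zx.* F Zx.+ s → B Rx.≈ s
      remainder B q s e = Quotient.mod (q Zx., rearrange B q s F e)
        where
        rearrange : ∀ B q s F → B ≋ q Zx.* F Zx.+ s → q Zx.* F ≋ B Zx.+ Zx.- s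
        rearrange B q s F e = lin₁ (- 1#) e (solve 4 (λ B q s F → q :* F :+ :- con 1ℤ :* (q :* F :+ s) := (B :+ :- s) :+ :- con 1ℤ :* B) refl B q s F)
          where open Zx


-- Integrality by the determinant trick

module FiniteSums (R : CommutativeRing 0ℓ 0ℓ) where
  open RingKit R
  open Sums semiring public using (sum)

  sum-linear : ∀ {n} a c (f g : Fin n → Carrier) →
               sum (λ j → a * f j + - (c * g j)) ≈ a * sum f + - (c * sum g)
  sum-linear {zero}  a c f g = solve 2 (λ a c → con 0ℤ := a :* con 0ℤ :+ :- (c :* con 0ℤ)) refl a c
  sum-linear {suc n} a c f g = trans (+-congˡ (sum-linear a c (f ∘ Fin.suc) (g ∘ Fin.suc)))
    (solve 6 (λ a c f g s t → (a :* f :+ :- (c :* g)) :+ (a :* s :+ :- (c :* t)) := a :* (f :+ s) :+ :- (c :* (g :+ t))) refl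
      a c (f Fin.zero) (g Fin.zero) (sum (f ∘ Fin.suc)) (sum (g ∘ Fin.suc)))

  sum-cong : ∀ {n} {f g : Fin n → Carrier} → (∀ j → f j ≈ g j) → sum f ≈ sum g
  sum-cong {zero}  e = refl
  sum-cong {suc n} e = +-cong (e Fin.zero) (sum-cong (e ∘ Fin.suc))

  sum-0 : ∀ {n} {f : Fin n → Carrier} → (∀ j → f j ≈ 0#) → sum f ≈ 0#
  sum-0 {zero}  e = refl
  sum-0 {suc n} e = trans (+-cong (e Fin.zero) (sum-0 (e ∘ Fin.suc))) (+-identityˡ 0#)

  *-sum : ∀ {n} a (f : Fin n → Carrier) → a * sum f ≈ sum (λ j → a * f j)
  *-sum {zero}  a f = zeroʳ a
  *-sum {suc n} a f = trans (distribˡ a _ _) (+-congˡ (*-sum a (f ∘ Fin.suc)))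

-- A vector e annihilated by a matrix over ℤ[t], at t = α, whose diagonal entries are
-- monic of degree D and whose other entries have smaller degree, is annihilated by
-- a monic integer polynomial in α.  Fraction-free elimination preserves this shape.
module Elimination (K : CommutativeRing 0ℓ 0ℓ) (ι′ : ℤ → CommutativeRing.Carrier K)
                  (ι′≈ι : ∀ c → CommutativeRing._≈_ K (ι′ c) (RingKit.ι K c)) (α : CommutativeRing.Carrier K) where
  open RingKit K
  open Evaluation K ι′ ι′≈ι α
  open FiniteSums K

  kronecker : ∀ {n} → Fin n → Fin n → ℤ
  kronecker Fin.zero    Fin.zero    = 1ℤ
  kronecker Fin.zero    (Fin.suc j) = 0ℤ
  kronecker (Fin.suc i) Fin.zero    = 0ℤ
  kronecker (Fin.suc i) (Fin.suc j) = kronecker i j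

  eliminate : ∀ n D (M : Fin n → Fin n → Poly) (e : Fin n → Carrier) →
              (∀ i j → HasTop (M i j) D (kronecker i j)) →
              (∀ i → sum (λ j → eval (M i j) * e j) ≈ 0#) →
              ∃[ P ] ∃[ E ] HasTop P E 1ℤ × (∀ j → eval P * e j ≈ 0#)
  eliminate zero    D M e tops rows = C 1ℤ , 0 , hasTop-C 1ℤ , λ ()
  eliminate (suc n) D M e tops rows =
    let P , E , top , kills = eliminate n (D ℕ.+ D) M′ (e ∘ Fin.suc) tops′ rows′ in
    P Zx.* M₀₀ , E ℕ.+ D , hasTop-* P top (tops Fin.zero Fin.zero) , λ where
      Fin.zero    → kill₀ P kills
      (Fin.suc j) → trans (*-congʳ (eval-* P M₀₀)) (trans (xy∙z≈xz∙y (eval P) (eval M₀₀) (e (Fin.suc j)))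
        (trans (*-congʳ (kills j)) (zeroˡ _)))
    where
    open CommutativeSemigroupProperties *-commutativeSemigroup using (xy∙z≈xz∙y; x∙yz≈y∙xz)
    M₀₀ : Poly
    M₀₀ = M Fin.zero Fin.zero
    Mᵢ₀ M₀ⱼ : Fin n → Poly
    Mᵢ₀ i = M (Fin.suc i) Fin.zero
    M₀ⱼ j = M Fin.zero (Fin.suc j)
    Mᵢⱼ : Fin n → Fin n → Poly
    Mᵢⱼ i j = M (Fin.suc i) (Fin.suc j)
    row : Fin (suc n) → Carrier
    row i = sum (λ j → eval (M i (Fin.suc j)) * e (Fin.suc j))
    M′ : Fin n → Fin n → Poly
    M′ i j = M₀₀ Zx.* Mᵢⱼ i j Zx.+ Zx.- (Mᵢ₀ i Zx.* M₀ⱼ j)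
    -- In degree D + D the first product contributes a Kronecker delta and the second 0, both its
    -- factors lying off the diagonal.
    tops′ : ∀ i j → HasTop (M′ i j) (D ℕ.+ D) (kronecker i j)
    tops′ i j = ≡.subst (HasTop (M′ i j) (D ℕ.+ D))
      (≡.trans (ℤP.+-identityʳ _) (ℤP.*-identityˡ (kronecker i j)))
      (hasTop-+ (hasTop-* M₀₀ (tops Fin.zero Fin.zero) (tops (Fin.suc i) (Fin.suc j)))
        (hasTop-neg (hasTop-* (Mᵢ₀ i) (tops (Fin.suc i) Fin.zero) (tops Fin.zero (Fin.suc j)))))
    rows′ : ∀ i → sum (λ j → eval (M′ i j) * e (Fin.suc j)) ≈ 0#
    rows′ i = begin
      sum (λ j → eval (M′ i j) * e (Fin.suc j))
        ≈⟨ sum-cong (λ j → trans (*-congʳ (trans (eval-+ (M₀₀ Zx.* Mᵢⱼ i j) (Zx.- (Mᵢ₀ i Zx.* M₀ⱼ j)))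
             (+-cong (eval-* M₀₀ (Mᵢⱼ i j)) (trans (eval-neg (Mᵢ₀ i Zx.* M₀ⱼ j)) (-‿cong (eval-* (Mᵢ₀ i) (M₀ⱼ j)))))))
             (solve 5 (λ a b c d x → (a :* b :+ :- (c :* d)) :* x := a :* (b :* x) :+ :- (c :* (d :* x))) refl
               (eval M₀₀) (eval (Mᵢⱼ i j)) (eval (Mᵢ₀ i)) (eval (M₀ⱼ j)) (e (Fin.suc j)))) ⟩
      sum (λ j → eval M₀₀ * (eval (Mᵢⱼ i j) * e (Fin.suc j))
        + - (eval (Mᵢ₀ i) * (eval (M₀ⱼ j) * e (Fin.suc j))))
        ≈⟨ sum-linear (eval M₀₀) (eval (Mᵢ₀ i)) (λ j → eval (Mᵢⱼ i j) * e (Fin.suc j)) (λ j → eval (M₀ⱼ j) * e (Fin.suc j)) ⟩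
      eval M₀₀ * row (Fin.suc i) + - (eval (Mᵢ₀ i) * row Fin.zero)
        ≈⟨ lin₂ (eval M₀₀) (- eval (Mᵢ₀ i)) (rows (Fin.suc i)) (rows Fin.zero)
             (solve 5 (λ a c r s x → (a :* r :+ :- (c :* s)) :+ (a :* con 0ℤ :+ :- c :* con 0ℤ)
               := con 0ℤ :+ (a :* (c :* x :+ r) :+ :- c :* (a :* x :+ s))) refl
               (eval M₀₀) (eval (Mᵢ₀ i)) (row (Fin.suc i)) (row Fin.zero) (e Fin.zero)) ⟩
      0# ∎
    -- The first row expresses M₀₀ e₀ through the remaining entries of e, all of which P kills.
    kill₀ : ∀ P → (∀ j → eval P * e (Fin.suc j) ≈ 0#) → eval (P Zx.* M₀₀) * e Fin.zero ≈ 0#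
    kill₀ P kills = begin
      eval (P Zx.* M₀₀) * e Fin.zero                     ≈⟨ *-congʳ (eval-* P M₀₀) ⟩
      eval P * eval M₀₀ * e Fin.zero                     ≈⟨ lin₂ (eval P) (- 1#) (rows Fin.zero) killed
        (solve 4 (λ p a x r → p :* a :* x :+ (p :* con 0ℤ :+ :- con 1ℤ :* con 0ℤ) := con 0ℤ :+ (p :* (a :* x :+ r) :+ :- con 1ℤ :* (p :* r))) refl
          (eval P) (eval M₀₀) (e Fin.zero) (row Fin.zero)) ⟩
      0#                                                 ∎
      where
      killed : eval P * row Fin.zero ≈ 0#
      killed = trans (*-sum (eval P) (λ j → eval (M₀ⱼ j) * e (Fin.suc j)))
        (sum-0 λ j → trans (x∙yz≈y∙xz (eval P) (eval (M₀ⱼ j)) (e (Fin.suc j))) (trans (*-congˡ (kills j)) (zeroʳ _)))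

monomials : ∀ {d} → (ℕ → ℤ) → Fin d → Qx.Poly
monomials c j = Qx.C (c (toℕ j) /1) Qx.* Qx.X Qx.^ toℕ j

X*-Q : ∀ f → Qx.X Qx.* f Qx.≋ ℚ.0ℚ ∷ f
X*-Q f = Qx.trans (Qx.shift-*ₚ (ℚ.1ℚ ∷ []) f) (Qx.∷-cong ≡.refl (Qx.*-identityˡ f))

open FiniteSums ℚ[X] using () renaming (sum to ∑; sum-cong to ∑-cong; *-sum to *-∑)

expansion : ∀ d S → DegreeBelow d S → ∑ {d} (monomials (coeff S)) Qx.≋ φ S
expansion zero    S low = Qx.sym (φ-cong (degreeBelow-0 low))
expansion (suc d) S low = Qx.trans (Qx.+-cong {Qx.C (coeff S 0 /1) Qx.* Qx.C ℚ.1ℚ} (Qx.*-identityʳ (Qx.C (coeff S 0 /1))) (shifted d S))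
    (split S low)
  where
  split : ∀ S → DegreeBelow (suc d) S → Qx.C (coeff S 0 /1) Qx.+ Qx.X Qx.* ∑ {d} (monomials (coeff S ∘ suc)) Qx.≋ φ S
  split []      low = Qx.trans (Qx.+-cong {Qx.C (0ℤ /1)} (Qx.∷-zero ≡.refl Qx.refl)
    (Qx.*-congˡ {Qx.X} (expansion d [] (below λ _ _ → ≡.refl)))) (Qx.trans (Qx.+-identityˡ (Qx.X Qx.* [])) (Qx.zeroʳ Qx.X))
  split (a ∷ S) low = Qx.trans (Qx.+-congˡ {Qx.C (a /1)} (Qx.trans (Qx.*-congˡ {Qx.X} (expansion d S (degreeBelow-tail low))) (X*-Q (φ S))))
    (Qx.∷-cong (ℚP.+-identityʳ (a /1)) Qx.refl)
  shifted : ∀ d S → ∑ {d} (λ j → monomials (coeff S) (Fin.suc j)) Qx.≋ Qx.X Qx.* ∑ {d} (monomials (coeff S ∘ suc))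
  shifted d S = Qx.sym (Qx.trans (*-∑ {d} Qx.X (monomials (coeff S ∘ suc)))
    (∑-cong {d} λ j → x∙yz≈y∙xz Qx.X (Qx.C (coeff S (suc (toℕ j)) /1)) (Qx.X Qx.^ toℕ j)))
    where open CommutativeSemigroupProperties Qx.*-commutativeSemigroup using (x∙yz≈y∙xz)


module QuadraticSums (K : CommutativeRing 0ℓ 0ℓ) where
  open RingKit K
  open FiniteSums K

  -- The bracket is the unfolding of `eval` on a list of three coefficients, with its trailing `0#`.
  sum-quadratic : ∀ {n} β (a b c e : Fin n → Carrier) →
                  sum (λ j → (a j + β * (b j + β * (c j + β * 0#))) * e j) ≈
                  sum (λ j → a j * e j) + β * (sum (λ j → b j * e j) + β * sum (λ j → c j * e j))
  sum-quadratic {zero}  β a b c e = solve 1 (λ β → con 0ℤ := con 0ℤ :+ β :* (con 0ℤ :+ β :* con 0ℤ)) refl β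
  sum-quadratic {suc n} β a b c e = trans (+-congˡ (sum-quadratic β (a ∘ Fin.suc) (b ∘ Fin.suc) (c ∘ Fin.suc) (e ∘ Fin.suc)))
    (solve 8 (λ β a b c e u v w →
      (a :+ β :* (b :+ β :* (c :+ β :* con 0ℤ))) :* e :+ (u :+ β :* (v :+ β :* w))
        := (a :* e :+ u) :+ β :* ((b :* e :+ v) :+ β :* (c :* e :+ w))) refl
      β (a Fin.zero) (b Fin.zero) (c Fin.zero) (e Fin.zero)
      (sum (λ j → a (Fin.suc j) * e (Fin.suc j))) (sum (λ j → b (Fin.suc j) * e (Fin.suc j))) (sum (λ j → c (Fin.suc j) * e (Fin.suc j))))

module IntegralElements (F : Poly) {d : ℕ} (F-monic : HasTop F d 1ℤ) (1≤d : 1 ℕ.≤ d) where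
  open NumberFieldOf F F-monic
  open IntegralClosure F F-monic
  open FiniteSums Kθ using (sum; sum-cong; sum-0)

  private
    remainder : Poly → Poly
    remainder a = proj₁ (proj₂ (divide F-monic a))

    remainder-low : ∀ a → DegreeBelow d (remainder a)
    remainder-low a = proj₂ (proj₂ (proj₂ (divide F-monic a)))

    remainder-≈ : ∀ a → φ (remainder a) Kx.≈ φ a
    remainder-≈ a = φ-cong-K (Rx.sym (Quotient.mod (proj₁ (divide F-monic a) Zx.,
      rearrange a (proj₁ (divide F-monic a)) (remainder a) F (proj₁ (proj₂ (proj₂ (divide F-monic a)))))))
      where
      rearrange : ∀ B q s F → B ≋ q Zx.* F Zx.+ s → q Zx.* F ≋ B Zx.+ Zx.- s
      rearrange B q s F e = lin₁ (- 1#) e (solve 4 (λ B q s F → q :* F :+ :- con 1ℤ :* (q :* F :+ s) := (B :+ :- s) :+ :- con 1ℤ :* B) refl B q s F)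
        where open Zx

    θ^ : ℕ → Qx.Poly
    θ^ i = Qx.X Qx.^ i

    φ-X^ : ∀ i → φ (X Zx.^ i) Kx.≈ θ^ i
    φ-X^ i = ≋⇒≈K (φ-^ X i)

    expand : ∀ a → sum {d} (λ j → φ (C (coeff (remainder a) (toℕ j))) Kx.* θ^ (toℕ j)) Kx.≈ φ a
    expand a = Kx.trans (≋⇒≈K (expansion d (remainder a) (remainder-low a))) (remainder-≈ a)

  -- Row i of the matrix is (β² - v β - s) θ^i = 0 written in the powers 1, ..., θ^(d-1). Its
  -- entries are integer quadratics in β with the Kronecker delta as coefficient of β², the shape
  -- `eliminate` needs; the vector entry θ^0 = 1 turns the annihilating polynomial into an equation
  -- for β itself.
  quadratic-integral : ∀ β v s → β Kx.* β Kx.≈ φ v Kx.* β Kx.+ φ s → IsIntegral β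
  quadratic-integral β v s root = P , E , top , Kx.trans (Kx.sym (Kx.*-identityʳ (eval P))) (kill-1 1≤d kills)
    where
    open Evaluation Kθ (λ c → φ (C c)) φ-constant β using (eval)
    open Elimination Kθ (λ c → φ (C c)) φ-constant β using (eliminate; kronecker)
    sᵢ vᵢ : ℕ → Poly
    sᵢ i = Zx.- (s Zx.* X Zx.^ i)
    vᵢ i = Zx.- (v Zx.* X Zx.^ i)
    M : Fin d → Fin d → Poly
    M i j = coeff (remainder (sᵢ (toℕ i))) (toℕ j) ∷ coeff (remainder (vᵢ (toℕ i))) (toℕ j) ∷ kronecker i j ∷ []
    tops : ∀ i j → HasTop (M i j) 2 (kronecker i j)
    tops i j = ≡.refl , below λ { (suc (suc (suc _))) _ → ≡.refl ; (suc zero) (s≤s ()) ; (suc (suc zero)) (s≤s (s≤s ())) }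
    sum-kronecker : ∀ {n} (i : Fin n) (e : Fin n → Qx.Poly) → sum {n} (λ j → φ (C (kronecker i j)) Kx.* e j) Kx.≈ e i
    sum-kronecker {suc n} Fin.zero e = Kx.trans (Kx.+-cong (Kx.*-identityˡ (e Fin.zero))
      (sum-0 {n} {f = λ j → φ (C 0ℤ) Kx.* e (Fin.suc j)} λ j → Kx.trans (Kx.*-congʳ {e (Fin.suc j)} (φ-constant 0ℤ)) (Kx.zeroˡ (e (Fin.suc j)))))
      (Kx.+-identityʳ (e Fin.zero))
    sum-kronecker (Fin.suc i) e = Kx.trans (Kx.+-cong (Kx.trans (Kx.*-congʳ {e Fin.zero} (φ-constant 0ℤ)) (Kx.zeroˡ (e Fin.zero)))
      (sum-kronecker i (e ∘ Fin.suc))) (Kx.+-identityˡ (e (Fin.suc i)))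
    φ-vᵢ : ∀ w i → φ (Zx.- (w Zx.* X Zx.^ i)) Kx.≈ Kx.- (φ w Kx.* θ^ i)
    φ-vᵢ w i = Kx.trans (≋⇒≈K (Qx.trans (φ-neg (w Zx.* X Zx.^ i)) (Qx.-‿cong (φ-* w (X Zx.^ i)))))
      (Kx.-‿cong (Kx.*-congˡ {φ w} (φ-X^ i)))
    rows : ∀ i → sum {d} (λ j → eval (M i j) Kx.* θ^ (toℕ j)) Kx.≈ []
    rows i = begin
      sum {d} (λ j → eval (M i j) Kx.* θ^ (toℕ j))
        ≈⟨ QuadraticSums.sum-quadratic Kθ {d} β (λ j → φ (C (coeff (remainder (sᵢ I)) (toℕ j)))) (λ j → φ (C (coeff (remainder (vᵢ I)) (toℕ j))))
             (λ j → φ (C (kronecker i j))) (λ j → θ^ (toℕ j)) ⟩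
      sum {d} (λ j → φ (C (coeff (remainder (sᵢ I)) (toℕ j))) Kx.* θ^ (toℕ j)) Kx.+
        β Kx.* (sum {d} (λ j → φ (C (coeff (remainder (vᵢ I)) (toℕ j))) Kx.* θ^ (toℕ j)) Kx.+ β Kx.* sum {d} (λ j → φ (C (kronecker i j)) Kx.* θ^ (toℕ j)))
        ≈⟨ Kx.+-cong (Kx.trans (expand (sᵢ I)) (φ-vᵢ s I))
             (Kx.*-congˡ {β} (Kx.+-cong (Kx.trans (expand (vᵢ I)) (φ-vᵢ v I)) (Kx.*-congˡ {β} (sum-kronecker i (λ j → θ^ (toℕ j)))))) ⟩
      Kx.- (φ s Kx.* θ^ I) Kx.+ β Kx.* (Kx.- (φ v Kx.* θ^ I) Kx.+ β Kx.* θ^ I)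
        ≈⟨ cancels (φ s) (φ v) β (θ^ I) root ⟩
      [] ∎
      where
      open Kx using (begin_; step-≈-⟩; _∎)
      I = toℕ i
      cancels : ∀ s v β x → β Kx.* β Kx.≈ v Kx.* β Kx.+ s → Kx.- (s Kx.* x) Kx.+ β Kx.* (Kx.- (v Kx.* x) Kx.+ β Kx.* x) Kx.≈ []
      cancels s v β x e = lin₁ x e (solve 4 (λ s v β x → (:- (s :* x) :+ β :* (:- (v :* x) :+ β :* x)) :+ x :* (v :* β :+ s) := con 0ℤ :+ x :* (β :* β)) refl s v β x)
        where open Kx
    elimination : ∃[ P ] ∃[ E ] HasTop P E 1ℤ × (∀ j → eval P Kx.* θ^ (toℕ j) Kx.≈ [])
    elimination = eliminate d 2 M (λ j → θ^ (toℕ j)) tops rows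
    P = proj₁ elimination
    E = proj₁ (proj₂ elimination)
    top = proj₁ (proj₂ (proj₂ elimination))
    kills = proj₂ (proj₂ (proj₂ elimination))
    kill-1 : ∀ {d} → 1 ℕ.≤ d → (∀ (j : Fin d) → eval P Kx.* θ^ (toℕ j) Kx.≈ []) → eval P Kx.* Qx.C ℚ.1ℚ Kx.≈ []
    kill-1 (s≤s _) k = k Fin.zero

  -- β = θ^i satisfies β² = θ^i β, the quadratic case with v = x^i and s = 0.
  power-integral : ∀ i → IsIntegral (Qx.X Qx.^ i)
  power-integral i = quadratic-integral (θ^ i) (X Zx.^ i) [] (Kx.trans (Kx.*-congʳ {θ^ i} (Kx.sym (φ-X^ i)))
    (Kx.sym (Kx.+-identityʳ (φ (X Zx.^ i) Kx.* θ^ i))))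


-- Integral power bases

monicOfDegree⇒hasTop : ∀ {f d} → ℤ[x].MonicOfDegree f d → HasTop f d 1ℤ
monicOfDegree⇒hasTop (t , low) = t , below low

hasTop⇒monicOfDegree : ∀ {f d} → HasTop f d 1ℤ → ℤ[x].MonicOfDegree f d
hasTop⇒monicOfDegree (t , low) = t , vanish low

top-unique : ∀ {f d e a b} → a ≢ 0ℤ → b ≢ 0ℤ → HasTop f d a → HasTop f e b → d ≡ e
top-unique {f} a≢0 b≢0 (t , low) (t′ , low′) = ℕP.≤-antisym (ℕP.≮⇒≥ (absurd a≢0 t low′)) (ℕP.≮⇒≥ (absurd b≢0 t′ low))
  where
  absurd : ∀ {d e a} → a ≢ 0ℤ → coeff f d ≡ a → DegreeBelow (suc e) f → ¬ (e ℕ.< d)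
  absurd {d} a≢0 t low e<d = a≢0 (≡.trans (≡.sym t) (vanish low d e<d))

coeff-tabulate : ∀ {n} (c : Fin n → ℤ) i → coeff (List.tabulate c) (toℕ i) ≡ c i
coeff-tabulate c Fin.zero    = ≡.refl
coeff-tabulate c (Fin.suc i) = coeff-tabulate (c ∘ Fin.suc) i

tabulate-low : ∀ {n} (c : Fin n → ℤ) → DegreeBelow n (List.tabulate c)
tabulate-low c = ≡.subst (λ n → DegreeBelow n (List.tabulate c)) (ListP.length-tabulate c) (degreeBelow-length (List.tabulate c))

module PowerBasis (F : Poly) {d : ℕ} (F-monic : HasTop F d 1ℤ) (1≤d : 1 ℕ.≤ d) where
  open NumberFieldOf F F-monic
  open IntegralClosure F F-monic
  open IntegralElements F F-monic 1≤d
  private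
    module NF = NumberField F
    module RK = RawRing NF.K
  open FiniteSums Kθ using (sum; sum-cong)

  private
    toK : ∀ {α β} → α RK.≈ β → α Kx.≈ β
    toK (RawMagmaDefinitions._,_ q e) = modK (Qx._,_ q (Qx.coeffwise e))

    fromK : ∀ {α β} → α Kx.≈ β → α RK.≈ β
    fromK e = let q , e′ = Qx.∣⇒∃ (differenceK e) in RawMagmaDefinitions._,_ q (Qx.at e′)

    powers≡ : ∀ {N} (i : Fin N) → NF.powers N i ≡ Qx.X Qx.^ toℕ i
    powers≡ i = power (toℕ i)
      where
      module P = RawSemiringDefinitions (RawRing.rawSemiring NF.K)
      power : ∀ n → NF.θ P.^ n ≡ Qx.X Qx.^ n
      power zero    = ≡.refl
      power (suc n) = ≡.cong (Qx.X Qx.*_) (power n)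

    combination≈ : ∀ S → DegreeBelow d S → ∀ (c : Fin d → ℤ) → (∀ i → c i ≡ coeff S (toℕ i)) →
                   NF.combination c (NF.powers d) Kx.≈ φ S
    combination≈ S low c c≡ = Kx.trans (sum-cong {d} {λ i → NF.ι (c i) Kx.* NF.powers d i} {monomials (coeff S)} λ i →
        Kx.reflexive (≡.cong₂ (λ a x → Qx.C (a /1) Qx.* x) (c≡ i) (powers≡ i)))
      (≋⇒≈K (expansion d S low))

  private
    toIntegral : ∀ α → IsIntegral α → NF.Integral α
    toIntegral α (g , e , top , root) = g , (e , hasTop⇒monicOfDegree top) , fromK {NF.eval g α} {[]} root

    integral : ∀ i → NF.Integral (NF.powers d i)
    integral i = toIntegral (NF.powers d i) (≡.subst IsIntegral (≡.sym (powers≡ i)) (power-integral (toℕ i)))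

    independent : ∀ c → NF.combination c (NF.powers d) RK.≈ [] → ∀ i → c i ≡ 0ℤ
    independent c combination≈0 i = ≡.trans (≡.sym (coeff-tabulate c i)) (at S≋0 (toℕ i))
      where
      S = List.tabulate c
      φS≈0 : φ S Kx.≈ φ []
      φS≈0 = Kx.trans (Kx.sym (combination≈ S (tabulate-low c) c (λ i → ≡.sym (coeff-tabulate c i))))
        (toK {NF.combination c (NF.powers d)} {[]} combination≈0)
      S≋0 : S ≋ []
      S≋0 = low-multiple⇒0 F-monic (tabulate-low c) (Quotient.≈0⇒∣ ℤ[X] F (φ-injective-K {S} {[]} φS≈0))

  integralBasis : (∀ α → IsIntegral α → ∃[ B ] DegreeBelow d B × α Kx.≈ φ B) → NF.IsIntegralBasis (NF.powers d)
  integralBasis span = record { integral = integral ; spanning = spanning ; independent = independent }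
    where
    spanning : ∀ α → NF.Integral α → ∃[ c ] α RK.≈ NF.combination {d} c (NF.powers d)
    spanning α (g , (e , monic) , root) =
      let B , low , α≈B = span α (g , e , monicOfDegree⇒hasTop monic , toK {NF.eval g α} {[]} root) in
      (λ i → coeff B (toℕ i)) ,
      fromK {α} {NF.combination {d} (λ i → coeff B (toℕ i)) (NF.powers d)}
        (Kx.trans α≈B (Kx.sym (combination≈ B low (λ i → coeff B (toℕ i)) (λ _ → ≡.refl))))

  monogenic⇒spanning : Monogenic F → ∀ α → IsIntegral α → ∃[ B ] DegreeBelow d B × α Kx.≈ φ B
  monogenic⇒spanning mono α int =
    let c , α≈ = NF.IsIntegralBasis.spanning basis α (toIntegral α int) in
    List.tabulate c , tabulate-low c ,
    Kx.trans (toK {α} {NF.combination {d} c (NF.powers d)} α≈) (combination≈ (List.tabulate c) (tabulate-low c) c (λ i → ≡.sym (coeff-tabulate c i)))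
    where
    basis : NF.IsIntegralBasis (NF.powers d)
    -- The degree stored in `mono` must be d, because F has leading coefficient 1 in both degrees.
    basis = ≡.subst (λ d → NF.IsIntegralBasis (NF.powers d))
      (top-unique (λ ()) (λ ()) (monicOfDegree⇒hasTop (Monogenic.monic mono)) F-monic) (Monogenic.powerBasis mono)


-- Irreducibility over ℚ by Eisenstein's criterion

top-or-zero : ∀ f → (f ≋ []) ⊎ (∃[ i ] ∃[ a ] a ≢ 0ℤ × HasTop f i a)
top-or-zero []      = inj₁ Zx.refl
top-or-zero (c ∷ f) with top-or-zero f | c ℤP.≟ 0ℤ
... | inj₂ (i , a , a≢0 , t , low) | _       = inj₂ (suc i , a , a≢0 , t , degreeBelow-∷ low)
... | inj₁ f≋0 | yes c≡0 = inj₁ (Zx.∷-zero c≡0 f≋0)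
... | inj₁ f≋0 | no  c≢0 = inj₂ (0 , c , c≢0 , ≡.refl , below λ { (suc i) _ → at f≋0 i })

C*-cancel : ∀ {c f g} → c ≢ 0ℤ → C c Zx.* f ≋ C c Zx.* g → f ≋ g
C*-cancel {c} {f} {g} c≢0 e = coeffwise λ i → ℤP.*-cancelˡ-≡ c (coeff f i) (coeff g i) {{ℤ.≢-nonZero c≢0}}
  (≡.trans (≡.sym (coeff-C* c f i)) (≡.trans (at e i) (coeff-C* c g i)))

coeff-X^* : ∀ d f i → i ℕ.< d → coeff (X Zx.^ d Zx.* f) i ≡ 0ℤ
coeff-X^* (suc d) f i i<d = ≡.trans (at (Zx.trans (Zx.*-assoc X (X Zx.^ d) f) (X* (X Zx.^ d Zx.* f))) i) (go i i<d)
  where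
  go : ∀ i → i ℕ.< suc d → coeff (0ℤ ∷ X Zx.^ d Zx.* f) i ≡ 0ℤ
  go zero    _         = ≡.refl
  go (suc i) (s≤s i<d) = coeff-X^* d f i i<d

module Eisenstein (F : Poly) {d : ℕ} (F-monic : HasTop F d 1ℤ) (1≤d : 1 ℕ.≤ d) (p : ℕ) (pr : Prime p)
                  (F≈X^d : CommutativeRing._≈_ (ModPrime.𝔽p[X] p pr) F (RingKit._^_ (ModPrime.𝔽p[X] p pr) X d))
                  (p²∤F₀ : ¬ (+ p ℤ.* + p ∣ℤ coeff F 0)) where
  open ModPrime p pr

  private
    -- Modulo p, B is coprime to x, so x^d divides A and p divides all coefficients of A below d.
    -- The top coefficient of A divides N, hence is prime to p and sits in degree at least d;
    -- nothing is left for B but a constant.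
    low-factor : ∀ N A B → ¬ (+ p ∣ℤ N) → C N Zx.* F ≋ A Zx.* B → ¬ (+ p ∣ℤ coeff B 0) → DegreeBelow 1 B
    low-factor N A B p∤N e p∤B₀ = go (top-or-zero A) (top-or-zero B)
      where
      X^d∣A : X Fx.^ d Fx.∣ A
      X^d∣A = Fx.coprime⇒∣ (Fx.coprime-sym (Fx.coprime-^ʳ d (coprime-X B p∤B₀)))
        (Fx._,_ (C N) (Fx.trans (Fx.*-congˡ {C N} (Fx.sym F≈X^d)) (≋⇒≈ (Zx.trans e (Zx.*-comm A B)))))
      p∣A : ∀ i → i ℕ.< d → + p ∣ℤ coeff A i
      p∣A i i<d = ℤ-Ring.∣ʳ-respʳ-≈ (≡.trans (≡.cong (λ y → ℤ.- (y ℤ.+ ℤ.- coeff A i)) zero-coeff) (≡.trans (≡.cong ℤ.-_ (ℤP.+-identityˡ _)) (ℤP.neg-involutive (coeff A i))))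
          (ℤ-Ring.∣-neg (ℤ-Ring.∣ʳ-respʳ-≈ (≡.trans (Zx.coeff-+ (q Zx.* X^d) (Zx.- A) i) (≡.cong (λ y → coeff (q Zx.* X^d) i ℤ.+ y) (Zx.coeff-neg A i)))
            (Cp∣⇒coeff (difference (proj₂ (Fx.∣⇒∃ X^d∣A))) i)))
        where
        X^d = X Fx.^ d
        q = proj₁ (Fx.∣⇒∃ X^d∣A)
        zero-coeff : coeff (q Zx.* X^d) i ≡ 0ℤ
        zero-coeff = ≡.trans (at (Zx.trans (Zx.*-comm q X^d) (Zx.*-congʳ {q} (Zx.reflexive (^-quotient ℤ[X] (C (+ p)) X d)))) i) (coeff-X^* d q i i<d)
      N≢0 : N ≢ 0ℤ
      N≢0 ≡.refl = p∤N (ℤ-Ring._∣0 (+ p))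
      NF-top : HasTop (A Zx.* B) d N
      NF-top = hasTop-resp e (≡.subst (HasTop (C N Zx.* F) d) (ℤP.*-identityʳ N) (hasTop-* (C N) (hasTop-C N) F-monic))
      vanishing : A Zx.* B ≋ [] → DegreeBelow 1 B
      vanishing AB≋0 = contradiction (≡.trans (≡.sym (proj₁ NF-top)) (at AB≋0 d)) N≢0
      go : (A ≋ []) ⊎ (∃[ i ] ∃[ a ] a ≢ 0ℤ × HasTop A i a) → (B ≋ []) ⊎ (∃[ j ] ∃[ b ] b ≢ 0ℤ × HasTop B j b) → DegreeBelow 1 B
      go (inj₁ A≋0) _ = vanishing (Zx.*-congʳ {B} A≋0)
      go _ (inj₁ B≋0) = vanishing (Zx.trans (Zx.*-congˡ {A} B≋0) (Zx.zeroʳ A))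
      go (inj₂ (i , a , a≢0 , topA)) (inj₂ (j , b , b≢0 , topB)) = ≡.subst (λ j → DegreeBelow (suc j) B) j≡0 (proj₂ topB)
        where
        topAB : HasTop (A Zx.* B) (i ℕ.+ j) (a ℤ.* b)
        topAB = hasTop-* A topA topB
        ab≢0 : a ℤ.* b ≢ 0ℤ
        ab≢0 ab≡0 = b≢0 (ℤ-nonZeroDivisor a≢0 b ab≡0)
        i+j≡d : i ℕ.+ j ≡ d
        i+j≡d = top-unique ab≢0 N≢0 topAB NF-top
        ab≡N : a ℤ.* b ≡ N
        ab≡N = ≡.trans (≡.sym (proj₁ topAB)) (≡.trans (≡.cong (coeff (A Zx.* B)) i+j≡d) (proj₁ NF-top))
        d≤i : d ℕ.≤ i
        d≤i = ℕP.≮⇒≥ λ i<d → p∤N (≡.subst (+ p ∣ℤ_) ab≡N (ℤ-Ring.∣-*ʳ b (≡.subst (+ p ∣ℤ_) (proj₁ topA) (p∣A i i<d))))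
        j≡0 : j ≡ 0
        j≡0 = ℕP.n≤0⇒n≡0 (ℕP.+-cancelˡ-≤ i j 0 (ℕP.≤-trans (ℕP.≤-reflexive i+j≡d) (ℕP.≤-trans d≤i (ℕP.m≤m+n i 0))))

    -- If p divided both constant terms, p² would divide N F₀ and therefore F₀.
    constant-factor-prime : ∀ N A B → ¬ (+ p ∣ℤ N) → C N Zx.* F ≋ A Zx.* B → DegreeBelow 1 A ⊎ DegreeBelow 1 B
    constant-factor-prime N A B p∤N e = go (+ p ∣ℤ? coeff A 0) (+ p ∣ℤ? coeff B 0)
      where
      go : Dec (+ p ∣ℤ coeff A 0) → Dec (+ p ∣ℤ coeff B 0) → DegreeBelow 1 A ⊎ DegreeBelow 1 B
      go _ (no p∤B₀) = inj₂ (low-factor N A B p∤N e p∤B₀)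
      go (no p∤A₀) _ = inj₁ (low-factor N B A p∤N (Zx.trans e (Zx.*-comm A B)) p∤A₀)
      go (yes p∣A₀) (yes p∣B₀) = contradiction (coprime-∣ℤ p²⊥N
        (≡.subst (+ p ℤ.* + p ∣ℤ_) (≡.trans (≡.sym (coeff-*-zero A B)) (≡.trans (≡.sym (at e 0)) (coeff-C* N F 0)))
          (ℤ-Ring.∙-cong-∣ p∣A₀ p∣B₀))) p²∤F₀
        where
        p²⊥N : ℤ-Ring.Coprime (+ p ℤ.* + p) N
        p²⊥N = ℤ-Ring.coprime-sym {N} (ℤ-Ring.coprime-*ʳ {N} (prime-coprime pr N p∤N) (prime-coprime pr N p∤N))

    -- A substitute for Gauss's lemma in which only the prime p leaves N: if p divides N, the
    -- product A B vanishes modulo p, so p divides all coefficients of one factor and cancels.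
    strip : ∀ N → 1 ℕ.≤ N → ∀ A B → C (+ N) Zx.* F ≋ A Zx.* B → DegreeBelow 1 A ⊎ DegreeBelow 1 B
    strip = ℕInduction.<-rec _ step
      where
      Claim : ℕ → Set
      Claim N = 1 ℕ.≤ N → ∀ A B → C (+ N) Zx.* F ≋ A Zx.* B → DegreeBelow 1 A ⊎ DegreeBelow 1 B
      step : ∀ N → (∀ {M} → M ℕ.< N → Claim M) → Claim N
      step N rec 1≤N A B e = go (p ℕDiv.∣? N)
        where
        content : ∀ f → f Fx.≈ [] → ∃[ g ] f ≋ C (+ p) Zx.* g
        content f f≈0 = let g , eg = Zx.∣⇒∃ (≈0⇒∣ f≈0) in g , Zx.trans (Zx.sym eg) (Zx.*-comm g (C (+ p)))
        go : Dec (p ℕDiv.∣ N) → DegreeBelow 1 A ⊎ DegreeBelow 1 B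
        go (no p∤N) = constant-factor-prime (+ N) A B (p∤N ∘ ∣ℤ⇒∣) e
        go (yes (ℕDiv.divides M N≡Mp)) = [ factorA , factorB ]′ (zeroDivisor-free A B AB≈0)
          where
          C-N : C (+ N) ≋ C (+ p) Zx.* C (+ M)
          C-N = Zx.trans (Zx.reflexive (≡.cong C (≡.trans (≡.cong +_ (≡.trans N≡Mp (ℕP.*-comm M p))) (ℤP.pos-* p M)))) (C-* (+ p) (+ M))
          AB≈0 : A Fx.* B Fx.≈ []
          AB≈0 = ∣⇒≈0 (Zx.∣ʳ-respʳ-≈ (Zx.trans (Zx.*-congʳ {F} (Zx.sym C-N)) e) (Zx.∣-*ʳ F (Zx.x∣x*y (C (+ p)) (C (+ M)))))
          1≤M : 1 ℕ.≤ M
          1≤M = ℕP.n≢0⇒n>0 λ M≡0 → ℕP.<⇒≢ 1≤N (≡.sym (≡.trans N≡Mp (≡.cong (ℕ._* p) M≡0)))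
          1<p : 1 ℕ.< p
          1<p = ℕ.nonTrivial⇒n>1 p {{prime⇒nonTrivial pr}}
          M<N : M ℕ.< N
          M<N = ≡.subst (M ℕ.<_) (≡.sym N≡Mp) (ℕP.m<m*n M p {{ℕ.>-nonZero 1≤M}} 1<p)
          p≢0 : + p ≢ 0ℤ
          p≢0 ≡.refl = contradiction pr λ ()
          divided : ∀ {A B A′} → C (+ N) Zx.* F ≋ A Zx.* B → A ≋ C (+ p) Zx.* A′ → C (+ M) Zx.* F ≋ A′ Zx.* B
          divided {A} {B} {A′} e eA = C*-cancel {+ p} p≢0 (Zx.trans (Zx.sym (Zx.*-assoc (C (+ p)) (C (+ M)) F))
            (Zx.trans (Zx.*-congʳ {F} (Zx.sym C-N)) (Zx.trans e (Zx.trans (Zx.*-congʳ {B} eA) (Zx.*-assoc (C (+ p)) A′ B)))))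
          factorA : A Fx.≈ [] → DegreeBelow 1 A ⊎ DegreeBelow 1 B
          factorA A≈0 = let A′ , eA = content A A≈0 in
            Sum.map₁ (λ low → degreeBelow-resp (Zx.sym eA) (degreeBelow-C* (+ p) low)) (rec M<N 1≤M A′ B (divided e eA))
          factorB : B Fx.≈ [] → DegreeBelow 1 A ⊎ DegreeBelow 1 B
          factorB B≈0 = let B′ , eB = content B B≈0 in
            Sum.map₂ (λ low → degreeBelow-resp (Zx.sym eB) (degreeBelow-C* (+ p) low))
              (rec M<N 1≤M A B′ (Zx.trans (divided (Zx.trans e (Zx.*-comm A B)) eB) (Zx.*-comm B′ A)))

    constant-factor-unit : ∀ {g N B} → φ (C N) Qx.* g Qx.≋ φ B → DegreeBelow 1 B → ¬ (B ≋ []) → g Qx.∣ Qx.C ℚ.1ℚ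
    constant-factor-unit {g} {N} {B} e low B≢0 = Qx._,_ (Qx.C r Qx.* φ (C N)) (Qx.trans (Qx.*-assoc (Qx.C r) (φ (C N)) g)
      (Qx.trans (Qx.*-congˡ {Qx.C r} (Qx.trans e (φ-cong B≋C))) (Qx.coeffwise λ where
        zero    → ≡.trans (coeff-C*ℚ r (φ (C b₀)) 0) rb₀≡1
        (suc i) → ≡.trans (coeff-C*ℚ r (φ (C b₀)) (suc i)) (ℚP.*-zeroʳ r))))
      where
      b₀ = coeff B 0
      B≋C : B ≋ C b₀
      B≋C = coeffwise λ { zero → ≡.refl ; (suc i) → vanish low (suc i) (s≤s z≤n) }
      b₀≢0 : b₀ ≢ 0ℤ
      b₀≢0 b₀≡0 = B≢0 (Zx.trans B≋C (Zx.∷-zero b₀≡0 Zx.refl))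
      r = proj₁ (/1-inverse b₀≢0)
      rb₀≡1 = proj₂ (/1-inverse b₀≢0)

  private
    module Raw = RawSemiringDefinitions (RawRing.rawSemiring ℚ[x].polyRing)

    toRaw : ∀ {f g} → f Qx.∣ g → f Raw.∣ g
    toRaw d = let q , e = Qx.∣⇒∃ d in RawMagmaDefinitions._,_ q (Qx.at e)

    fromRaw : ∀ {f g} → f Raw.∣ g → f Qx.∣ g
    fromRaw (RawMagmaDefinitions._,_ q e) = Qx._,_ q (Qx.coeffwise e)

    not-unit : ¬ (φ F Qx.∣ Qx.C ℚ.1ℚ)
    not-unit d = contradiction (at (low-multiple⇒0 F-monic {C 1ℤ} (degreeBelow-mono 1≤d (proj₂ (hasTop-C 1ℤ)))
      (φ-divides⁻¹ F-monic (C 1ℤ) d)) 0) λ ()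

    split : ∀ f g → φ F Qx.≋ f Qx.* g → f Qx.∣ Qx.C ℚ.1ℚ ⊎ g Qx.∣ Qx.C ℚ.1ℚ
    split f g e = let N₁ , A , 1≤N₁ , eA = clearDenominators f ; N₂ , B , 1≤N₂ , eB = clearDenominators g in
      factors N₁ N₂ A B 1≤N₁ 1≤N₂ eA eB
      where
      factors : ∀ N₁ N₂ A B → 1 ℕ.≤ N₁ → 1 ℕ.≤ N₂ → φ (C (+ N₁)) Qx.* f Qx.≋ φ A → φ (C (+ N₂)) Qx.* g Qx.≋ φ B →
                f Qx.∣ Qx.C ℚ.1ℚ ⊎ g Qx.∣ Qx.C ℚ.1ℚ
      factors N₁ N₂ A B 1≤N₁ 1≤N₂ eA eB = Sum.map
          (λ low → constant-factor-unit {f} {+ N₁} eA low A≢0) (λ low → constant-factor-unit {g} {+ N₂} eB low B≢0)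
          (strip (N₁ ℕ.* N₂) 1≤N A B NF≋AB)
        where
        1≤N : 1 ℕ.≤ N₁ ℕ.* N₂
        1≤N = ℕP.*-mono-≤ 1≤N₁ 1≤N₂
        NF≋AB : C (+ (N₁ ℕ.* N₂)) Zx.* F ≋ A Zx.* B
        NF≋AB = φ-injective (begin
          φ (C (+ (N₁ ℕ.* N₂)) Zx.* F)                        ≈⟨ φ-cong (Zx.*-congʳ {F} (Zx.trans (Zx.reflexive (≡.cong C (ℤP.pos-* N₁ N₂))) (C-* (+ N₁) (+ N₂)))) ⟩
          φ (C (+ N₁) Zx.* C (+ N₂) Zx.* F)                   ≈⟨ trans (φ-* (C (+ N₁) Zx.* C (+ N₂)) F) (*-cong (φ-* (C (+ N₁)) (C (+ N₂))) e) ⟩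
          φ (C (+ N₁)) * φ (C (+ N₂)) * (f * g)               ≈⟨ interchange (φ (C (+ N₁))) (φ (C (+ N₂))) f g ⟩
          (φ (C (+ N₁)) * f) * (φ (C (+ N₂)) * g)             ≈⟨ *-cong eA eB ⟩
          φ A * φ B                                           ≈⟨ φ-* A B ⟨
          φ (A Zx.* B)                                        ∎)
          where
          open Qx using (begin_; step-≈-⟩; step-≈-⟨; _∎; _*_; trans; *-cong)
          open CommutativeSemigroupProperties Qx.*-commutativeSemigroup using (interchange)
        AB≢0 : ¬ (A Zx.* B ≋ [])
        AB≢0 AB≋0 = ℕP.<⇒≢ 1≤N (≡.sym (ℤP.+-injective (≡.trans (≡.sym (ℤP.*-identityʳ _)) (≡.trans
          (≡.sym (proj₁ (hasTop-* (C (+ (N₁ ℕ.* N₂))) (hasTop-C (+ (N₁ ℕ.* N₂))) F-monic))) (at (Zx.trans NF≋AB AB≋0) d)))))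
        A≢0 : ¬ (A ≋ [])
        A≢0 A≋0 = AB≢0 (Zx.*-congʳ {B} A≋0)
        B≢0 : ¬ (B ≋ [])
        B≢0 B≋0 = AB≢0 (Zx.trans (Zx.*-congˡ {A} B≋0) (Zx.zeroʳ A))

  irreducible : ℚ[x].Irreducible (φ F)
  irreducible = RawSemiringDefinitions.mkIrred (λ d → not-unit (fromRaw d))
    (λ {f} {g} e → Sum.map toRaw toRaw (split f g (Qx.coeffwise e)))


-- Congruences modulo p² and the Wieferich condition

module _ where
  open ℤ-Ring

  -- Write y = x - s p. In the expansion of y^p the linear term carries p times s p, and the later
  -- terms carry (s p)².
  ^-lift : ∀ p x y → p ∣ x + - y → ∀ q → + suc q ≡ p → p * p ∣ x ^ suc q + - (y ^ suc q)
  ^-lift p x y (s , sp≡x-y) q refl′ = s * x ^ q + - (r * (s * s)) , ≡.sym (lin₁ (- 1ℤ) y^p (solve 6 (λ p s u v w r →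
      (w :+ :- v) :+ :- con 1ℤ :* (w :- p :* ((s :* p) :* u) :+ r :* ((s :* p) :* (s :* p)))
        := (s :* u :+ :- (r :* (s :* s))) :* (p :* p) :+ :- con 1ℤ :* v) refl p s (x ^ q) (y ^ suc q) (x ^ suc q) r))
    where
    binomial = 𝒟-Exactness.binomial x (s * p) q
    r = proj₁ binomial
    y≡ : x + - (s * p) ≡ y
    y≡ = lin₁ (- 1ℤ) sp≡x-y (solve 4 (λ s p x y → (x :+ :- (s :* p)) :+ :- con 1ℤ :* (x :+ :- y) := y :+ :- con 1ℤ :* (s :* p)) refl s p x y)
    y^p : y ^ suc q ≡ x ^ suc q + - (p * ((s * p) * x ^ q)) + r * ((s * p) * (s * p))
    y^p = ≡.trans (≡.cong (_^ suc q) (≡.sym y≡)) (≡.trans (^-ℤ (x + - (s * p)) (suc q)) (≡.trans (proj₂ binomial)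
      (≡.cong (λ w → w + r * ((s * p) * (s * p))) (≡.cong₂ (λ u v → u + - v) (≡.sym (^-ℤ x (suc q)))
        (≡.cong₂ (λ c u → c * ((s * p) * u)) refl′ (≡.sym (^-ℤ x q)))))))

module WieferichCriterion (p : ℕ) (pr : Prime p) (b : ℕ) (p∤b : ¬ (+ p ∣ℤ + b)) where
  open ℤ-Ring

  -- For odd p this says p² | b^p - b, which is the Wieferich condition as p does not divide b; for
  -- p = 2 it says 4 | b (b + 1), that is b ≡ 3 mod 4 as b is odd.
  Exceptional : Set
  Exceptional = + p * + p ∣ (- + b) ^ p + + b

  -- By Fermat (-b)^(p^e) ≡ - b modulo p, and p-th powers lift this to (-b)^(p^(e+1)) ≡ (-b)^p
  -- modulo p². So the condition does not depend on the exact power of p in nk.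
  exceptional-^ : ∀ e → + p * + p ∣ (- + b) ^ (p ℕ.^ suc e) + + b → Exceptional
  exceptional-^ e d = ∣ʳ-respʳ-≈ (solve 3 (λ x y b → (x :+ b) :+ :- (x :+ :- y) := y :+ b) refl ((- + b) ^ (p ℕ.^ suc e)) ((- + b) ^ p) (+ b))
    (∣-+ d (∣-neg lifted))
    where
    instance _ = prime⇒nonZero pr
    lifted : + p * + p ∣ (- + b) ^ (p ℕ.^ suc e) + - ((- + b) ^ p)
    lifted = ≡.subst (λ x → + p * + p ∣ x + - ((- + b) ^ p)) (≡.trans (^-assocʳ (- + b) (p ℕ.^ e) p) (≡.cong ((- + b) ^_) (ℕP.*-comm (p ℕ.^ e) p)))
      (≡.subst (λ n → + p * + p ∣ ((- + b) ^ (p ℕ.^ e)) ^ n + - ((- + b) ^ n)) (ℕP.suc-pred p)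
        (^-lift (+ p) ((- + b) ^ (p ℕ.^ e)) (- + b)
          (∣ʳ-respʳ-≈ (≡.cong (λ y → (- + b) ^ (p ℕ.^ e) + y) (≡.sym (ℤP.neg-involutive (+ b)))) (FermatModPrime.p∣[-b]^q+b p pr b e))
          (ℕ.pred p) (≡.cong +_ (ℕP.suc-pred p))))

  private
    p²⊥b : Coprime (+ p * + p) (+ b)
    p²⊥b = coprime-sym {+ b} (coprime-*ʳ {+ b} (prime-coprime pr (+ b) p∤b) (prime-coprime pr (+ b) p∤b))

    p²≡ : + (p ℕ.^ 2) ≡ + p * + p
    p²≡ = ≡.trans (≡.cong +_ (≡.cong (p ℕ.*_) (ℕP.*-identityʳ p))) (ℤP.pos-* p p)

    odd⇒ : ∀ p → ¬ (2 ℕDiv.∣ p) → ∃[ k ] p ≡ suc (2 ℕ.* k)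
    odd⇒ p 2∤p = p ℕDivMod./ 2 , ≡.trans (ℕDivMod.m≡m%n+[m/n]*n p 2) (≡.cong₂ ℕ._+_ (p%2≡1 (p ℕDivMod.% 2) ≡.refl (ℕDivMod.m%n<n p 2)) (ℕP.*-comm (p ℕDivMod./ 2) 2))
      where
      p%2≡1 : ∀ r → r ≡ p ℕDivMod.% 2 → r ℕ.< 2 → r ≡ 1
      p%2≡1 zero    e _ = contradiction (ℕDiv.m%n≡0⇒n∣m p 2 (≡.sym e)) 2∤p
      p%2≡1 (suc zero) e _ = ≡.refl
      p%2≡1 (suc (suc r)) e (s≤s (s≤s ()))

    odd-expansion : ¬ (2 ℕDiv.∣ p) → (- + b) ^ p + + b ≡ + b * - ((+ b) ℤ.^ (p ∸ 1) + - 1ℤ)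
    odd-expansion 2∤p = let k , p≡ = odd⇒ p 2∤p in
      ≡.subst (λ p → (- + b) ^ p + + b ≡ + b * - ((+ b) ℤ.^ (p ∸ 1) + - 1ℤ)) (≡.sym p≡) (≡.trans
        (≡.cong (λ u → - + b * u + + b) (≡.trans (≡.sym (^-assocʳ (- + b) 2 k)) (≡.trans
          (≡.cong (_^ k) (solve 1 (λ b → (:- b) :^ 2 := b :^ 2) refl (+ b))) (≡.trans (^-assocʳ (+ b) 2 k) (^-ℤ (+ b) (2 ℕ.* k))))))
        (solve 2 (λ b u → :- b :* u :+ b := b :* :- (u :+ :- con 1ℤ)) refl (+ b) ((+ b) ℤ.^ (2 ℕ.* k))))

  wieferich⇒exceptional : ¬ (2 ℕDiv.∣ p) → Wieferich b p → Exceptional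
  wieferich⇒exceptional 2∤p w = ∣ʳ-respʳ-≈ (≡.sym (odd-expansion 2∤p))
    (∣-*ˡ (+ b) (∣-neg (≡.subst (_∣ (+ b) ℤ.^ (p ∸ 1) + - 1ℤ) p²≡ (∣⇒∣ℤ {+ (p ℕ.^ 2)} w))))

  exceptional⇒wieferich : ¬ (2 ℕDiv.∣ p) → Exceptional → Wieferich b p
  exceptional⇒wieferich 2∤p e = ∣ℤ⇒∣ (≡.subst (_∣ u) (≡.sym p²≡) (∣ʳ-respʳ-≈ (ℤP.neg-involutive u)
    (∣-neg {y = - u} (coprime-∣ℤ p²⊥b (∣ʳ-respʳ-≈ (odd-expansion 2∤p) e)))))
    where u = (+ b) ℤ.^ (p ∸ 1) + - 1ℤ

  two-exceptional⇒ : p ≡ 2 → Exceptional → ¬ (+ b ≡ 1ℤ [mod 4 ])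
  two-exceptional⇒ ≡.refl e b≡1 = contradiction (ℕDiv.∣⇒≤ (∣ℤ⇒∣ {+ 4} {+ 2} 4∣2)) λ { (s≤s (s≤s ())) }
    where
    -- `Exceptional` gives 4 | b + 1, while the congruence gives 4 | b - 1.
    4∣2 : + 4 ∣ + 2
    4∣2 = ∣ʳ-respʳ-≈ (solve 1 (λ b → (b :+ con 1ℤ) :+ :- (b :+ :- con 1ℤ) := con (+ 2)) refl (+ b))
      (∣-+ (coprime-∣ℤ p²⊥b (∣ʳ-respʳ-≈ (solve 1 (λ b → (:- b) :^ 2 :+ b := b :* (b :+ con 1ℤ)) refl (+ b)) e))
           (∣-neg {y = + b + - 1ℤ} (∣⇒∣ℤ {+ 4} b≡1)))

  two-exceptional⇐ : p ≡ 2 → ¬ (+ b ≡ 1ℤ [mod 4 ]) → Exceptional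
  two-exceptional⇐ ≡.refl b≢1 = residues (b ℕDivMod.% 4) ≡.refl (ℕDivMod.m%n<n b 4)
    where
    c = b ℕDivMod./ 4
    +b≡ : + b ≡ + (b ℕDivMod.% 4) + + c * + 4
    +b≡ = ≡.trans (≡.cong +_ (ℕDivMod.m≡m%n+[m/n]*n b 4)) (≡.cong (λ y → + (b ℕDivMod.% 4) + y) (ℤP.pos-* c 4))
    b≡r : ∀ r → r ≡ b ℕDivMod.% 4 → + b ≡ + r + + c * + 4
    b≡r r e = ≡.trans +b≡ (≡.cong (λ r → + r + + c * + 4) (≡.sym e))
    residues : ∀ r → r ≡ b ℕDivMod.% 4 → r ℕ.< 4 → Exceptional
    residues 0 e _ = contradiction (∣ʳ-respʳ-≈ (≡.sym (b≡r 0 e)) (+ c * + 2 , solve 1 (λ c → c :* con (+ 2) :* con (+ 2) := con 0ℤ :+ c :* con (+ 4)) refl (+ c))) p∤b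
    residues 1 e _ = contradiction (∣ℤ⇒∣ (+ c , ≡.sym (≡.trans (≡.cong (_+ - 1ℤ) (b≡r 1 e)) (solve 1 (λ c → con 1ℤ :+ c :* con (+ 4) :+ :- con 1ℤ := c :* con (+ 4)) refl (+ c))))) b≢1
    residues 2 e _ = contradiction (∣ʳ-respʳ-≈ (≡.sym (b≡r 2 e)) (1ℤ + + c * + 2 , solve 1 (λ c → (con 1ℤ :+ c :* con (+ 2)) :* con (+ 2) := con (+ 2) :+ c :* con (+ 4)) refl (+ c))) p∤b
    -- For b = 4c + 3 one has b² + b = b (b + 1) = 4 b (c + 1).
    residues 3 e _ = (+ 3 + + c * + 4) * (1ℤ + + c) , ≡.trans (solve 1 (λ c → (con (+ 3) :+ c :* con (+ 4)) :* (con 1ℤ :+ c) :* con (+ 4) :=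
        (:- (con (+ 3) :+ c :* con (+ 4))) :^ 2 :+ (con (+ 3) :+ c :* con (+ 4))) refl (+ c)) (≡.cong (λ b → (- b) ^ 2 + b) (≡.sym (b≡r 3 e)))
    residues (suc (suc (suc (suc r)))) e (s≤s (s≤s (s≤s (s≤s ()))))

-- Prime powers, the primary part, and squares dividing 𝒟

primePowerPart : ∀ {p} → Prime p → ∀ N → 1 ℕ.≤ N → ∃[ e ] ∃[ d ] N ≡ p ℕ.^ e ℕ.* d × 1 ℕ.≤ d × ¬ (p ℕDiv.∣ d)
primePowerPart {p} pr = ℕInduction.<-rec _ step
  where
  Claim : ℕ → Set
  Claim N = 1 ℕ.≤ N → ∃[ e ] ∃[ d ] N ≡ p ℕ.^ e ℕ.* d × 1 ℕ.≤ d × ¬ (p ℕDiv.∣ d)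
  step : ∀ N → (∀ {M} → M ℕ.< N → Claim M) → Claim N
  step N rec 1≤N = go (p ℕDiv.∣? N)
    where
    go : Dec (p ℕDiv.∣ N) → ∃[ e ] ∃[ d ] N ≡ p ℕ.^ e ℕ.* d × 1 ℕ.≤ d × ¬ (p ℕDiv.∣ d)
    go (no p∤N) = 0 , N , ≡.sym (ℕP.+-identityʳ N) , 1≤N , p∤N
    go (yes (ℕDiv.divides M N≡Mp)) = let e , d , M≡ , 1≤d , p∤d = rec M<N 1≤M in
      suc e , d , ≡.trans N≡Mp (≡.trans (ℕP.*-comm M p) (≡.trans (≡.cong (p ℕ.*_) M≡) (≡.sym (ℕP.*-assoc p (p ℕ.^ e) d)))) , 1≤d , p∤d
      where
      1≤M : 1 ℕ.≤ M
      1≤M = ℕP.n≢0⇒n>0 λ M≡0 → ℕP.<⇒≢ 1≤N (≡.sym (≡.trans N≡Mp (≡.cong (ℕ._* p) M≡0)))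
      M<N : M ℕ.< N
      M<N = ≡.subst (M ℕ.<_) (≡.sym N≡Mp) (ℕP.m<m*n M p {{ℕ.>-nonZero 1≤M}} (ℕ.nonTrivial⇒n>1 p {{prime⇒nonTrivial pr}}))

∣rad : ∀ {p N} → Prime p → 1 ℕ.≤ N → p ℕDiv.∣ N → p ℕDiv.∣ rad N
∣rad {p} {N} pr 1≤N p∣N = ∈⇒∣product (∈-filter⁺ (λ p → prime? p ×-dec (p ℕDiv.∣? N))
  (∈-upTo⁺ (s≤s (ℕDiv.∣⇒≤ {{ℕ.>-nonZero 1≤N}} p∣N))) (pr , p∣N))

prime∣prime : ∀ {p q} → Prime p → Prime q → p ℕDiv.∣ q → p ≡ q
prime∣prime pr qr p∣q = [ (λ p≡1 → contradiction (≡.subst Prime p≡1 pr) ¬prime[1]) , id ]′ (prime⇒irreducible qr p∣q)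

prime∣^ : ∀ {p} → Prime p → ∀ q e → p ℕDiv.∣ q ℕ.^ e → p ℕDiv.∣ q
prime∣^ pr q zero    d = contradiction (≡.subst Prime (ℕDiv.∣1⇒≡1 d) pr) ¬prime[1]
prime∣^ pr q (suc e) d = [ id , prime∣^ pr q e ]′ (euclidsLemma q (q ℕ.^ e) pr d)

^ν≤∣ : ∀ e p z → p ℕ.^ ν≤ e p z ℕDiv.∣ z
^ν≤∣ zero    p z = ℕDiv.1∣ z
^ν≤∣ (suc e) p z with (p ℕ.^ suc e) ℕDiv.∣? z
... | yes d = d
... | no  _ = ^ν≤∣ e p z

module PrimaryPart (N z : ℤ) where
  private
    f : ℕ → ℕ
    f p = p ℕ.^ ν p z

    coprime-rest : ∀ {p} → Prime p → ∀ ps → All Prime ps → All (p ≢_) ps → ¬ (p ℕDiv.∣ product (List.map f ps))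
    coprime-rest pr []       _          _          d = contradiction (≡.subst Prime (ℕDiv.∣1⇒≡1 d) pr) ¬prime[1]
    coprime-rest pr (q ∷ ps) (qr ∷ qrs) (p≢q ∷ p≢) d =
      [ (λ e → p≢q (prime∣prime pr qr (prime∣^ pr q (ν q z) e))) , coprime-rest pr ps qrs p≢ ]′
        (euclidsLemma (f q) (product (List.map f ps)) pr d)

    -- The prime power `f p` is coprime to the product R over the other primes, so it divides the
    -- cofactor of R in z.
    product∣ : ∀ ps → All Prime ps → Unique ps → product (List.map f ps) ℕDiv.∣ ∣ z ∣
    product∣ []       _          _         = ℕDiv.1∣ ∣ z ∣
    product∣ (p ∷ ps) (pr ∷ prs) (p≢ ∷ u) = divisor (product∣ ps prs u)
      where
      R = product (List.map f ps)
      divisor : R ℕDiv.∣ ∣ z ∣ → f p ℕ.* R ℕDiv.∣ ∣ z ∣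
      divisor (ℕDiv.divides c z≡cR) = ≡.subst (f p ℕ.* R ℕDiv.∣_) (≡.sym z≡cR) (ℕDiv.*-monoˡ-∣ R
        (∣ℤ⇒∣ {+ f p} {+ c} (coprime-∣ℤ {y = + R} f⊥R (∣⇒∣ℤ {+ f p} {+ R ℤ.* + c} (≡.subst (f p ℕDiv.∣_)
          (≡.trans z≡cR (≡.trans (ℕP.*-comm c R) (≡.sym (ℤP.abs-* (+ R) (+ c))))) (^ν≤∣ (∣ z ∣) p (∣ z ∣)))))))
        where
        pos-^ : ∀ e → (+ p) ℤ-Ring.^ e ≡ + (p ℕ.^ e)
        pos-^ zero    = ≡.refl
        pos-^ (suc e) = ≡.trans (≡.cong (+ p ℤ.*_) (pos-^ e)) (≡.sym (ℤP.pos-* p (p ℕ.^ e)))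
        f⊥R : ℤ-Ring.Coprime (+ f p) (+ R)
        f⊥R = ≡.subst (λ x → ℤ-Ring.Coprime x (+ R)) (pos-^ (ν p z)) (ℤ-Ring.coprime-^ˡ {+ p} {+ R} (ν p z)
          (ℤ-Ring.coprime-sym {+ R} (prime-coprime pr (+ R) (coprime-rest pr ps prs p≢ ∘ ∣ℤ⇒∣))))

    isDivisor? : ∀ p → Dec (Prime p × p ℕDiv.∣ ∣ N ∣)
    isDivisor? p = prime? p ×-dec (p ℕDiv.∣? ∣ N ∣)

    divisors : All (λ p → Prime p × p ℕDiv.∣ ∣ N ∣) (primeDivisors ∣ N ∣)
    divisors = all-filter isDivisor? (List.upTo (suc ∣ N ∣))

  primaryPart∣ : primaryPart N z ℕDiv.∣ ∣ z ∣
  primaryPart∣ = product∣ (primeDivisors ∣ N ∣) (All.map proj₁ divisors)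
    (filter⁺ isDivisor? (upTo⁺ (suc ∣ N ∣)))

  ∤primaryPart : ∀ {p} → Prime p → ¬ (p ℕDiv.∣ ∣ N ∣) → ¬ (p ℕDiv.∣ primaryPart N z)
  ∤primaryPart pr p∤N = coprime-rest pr (primeDivisors ∣ N ∣) (All.map proj₁ divisors)
    (All.map (λ { (_ , q∣N) ≡.refl → p∤N q∣N }) divisors)

-- The primary part is composed of primes dividing bm only, so p², being coprime to it, would
-- survive in the quotient `𝒹`.
square∤𝒟 : ∀ n m b → Squarefree (𝒹 n m b) → ∀ {p} → Prime p → ¬ (+ p ∣ℤ + b) → ¬ (+ p ∣ℤ m) → ¬ (+ p ℤ.* + p ∣ℤ 𝒟 n m b)
square∤𝒟 n m b sqf {p} pr p∤b p∤m p²∣𝒟 = contradiction (≡.subst Prime (sqf p p²∣𝒹) pr) ¬prime[1]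
  where
  instance _ = primaryPart-nonZero (+ b ℤ.* m) (𝒟 n m b)
  open PrimaryPart (+ b ℤ.* m) (𝒟 n m b)
  pp = primaryPart (+ b ℤ.* m) (𝒟 n m b)
  p∤bm : ¬ (p ℕDiv.∣ ∣ + b ℤ.* m ∣)
  p∤bm d = [ p∤b , p∤m ]′ (prime-∣ℤ pr (+ b) m (∣⇒∣ℤ d))
  p∤pp : ¬ (+ p ∣ℤ + pp)
  p∤pp = ∤primaryPart pr p∤bm ∘ ∣ℤ⇒∣
  p²⊥pp : ℤ-Ring.Coprime (+ p ℤ.* + p) (+ pp)
  p²⊥pp = ℤ-Ring.coprime-sym {+ pp} (ℤ-Ring.coprime-*ʳ {+ pp} (prime-coprime pr (+ pp) p∤pp) (prime-coprime pr (+ pp) p∤pp))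
  p²∣𝒹 : p ℕ.* p ℕDiv.∣ 𝒹 n m b
  p²∣𝒹 = ≡.subst (ℕDiv._∣ 𝒹 n m b) (ℤP.abs-* (+ p) (+ p)) (∣ℤ⇒∣ {+ p ℤ.* + p} {+ 𝒹 n m b} (coprime-∣ℤ {y = + pp} p²⊥pp
    (∣⇒∣ℤ {+ p ℤ.* + p} {+ pp ℤ.* + 𝒹 n m b} (≡.subst (∣ + p ℤ.* + p ∣ ℕDiv.∣_)
      (≡.trans (≡.sym (ℕDivMod.m/n*n≡m primaryPart∣)) (≡.trans (ℕP.*-comm (𝒹 n m b) pp) (≡.sym (ℤP.abs-* (+ pp) (+ 𝒹 n m b)))))
      (∣ℤ⇒∣ p²∣𝒟)))))


-- Exceptional primes produce integral elements outside ℤ[θ]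

-- If p² divides (-b)^p + b then F = h u - p² s with u ≡ h^(p-1) mod p, and u(θ) / p
-- is an algebraic integer outside ℤ[θ]: it is a root of t² - v t - w.
module NonMaximal (n : ℕ) (m : ℤ) (b k : ℕ) (1≤n : 1 ℕ.≤ n) (1≤k : 1 ℕ.≤ k) (p : ℕ) (pr : Prime p)
                  (p∣m : + p ∣ℤ m) (p∤b : ¬ (+ p ∣ℤ + b)) (p∣d : p ℕDiv.∣ n ℕ.* k)
                  (exceptional : + p ℤ.* + p ∣ℤ (ℤ.- + b) ℤ-Ring.^ p ℤ.+ + b) where
  private
    d d′ : ℕ
    d = n ℕ.* k
    d′ = ℕDiv.quotient p∣d
    d≡ : d ≡ p ℕ.^ 1 ℕ.* d′
    d≡ = ≡.trans (ℕDiv.m∣n⇒n≡quotient*m p∣d) (≡.trans (ℕP.*-comm d′ p) (≡.cong (ℕ._* d′) (≡.sym (ℕP.*-identityʳ p))))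
    1≤d : 1 ℕ.≤ d
    1≤d = ℕP.*-mono-≤ 1≤n 1≤k
    1≤d′ : 1 ℕ.≤ d′
    1≤d′ = ℕP.n≢0⇒n>0 λ d′≡0 → ℕP.<⇒≢ 1≤d (≡.sym (≡.trans d≡ (≡.trans (≡.cong (p ℕ.^ 1 ℕ.*_) d′≡0) (ℕP.*-zeroʳ (p ℕ.^ 1)))))
    p≢0 : + p ≢ 0ℤ
    p≢0 ≡.refl = contradiction pr λ ()
    1<p : 1 ℕ.< p
    1<p = ℕ.nonTrivial⇒n>1 p {{prime⇒nonTrivial pr}}

  open Family n m b k using (F; F-monic)
  open ModPrime p pr
  open FermatModPrime p pr using (C-^ℤ)
  open AtPrime n m b k 1≤n 1≤k p pr using (module Ramified)
  open Ramified p∣m p∤b 1 d′ d≡ 1≤d′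
  open NumberFieldOf F (F-monic 1≤k)
  open IntegralClosure F (F-monic 1≤k) using (IsIntegral)
  open IntegralElements F (F-monic 1≤k) 1≤d using (quadratic-integral)

  private
    p∣r₀ : + p ∣ℤ r₀
    p∣r₀ = let t , e = ℤ-Ring.∣⇒∃ exceptional in t ℤ-Ring., ℤP.*-cancelʳ-≡ (t ℤ.* + p) r₀ (+ p) {{ℤ.≢-nonZero p≢0}}
      (≡.trans (ℤP.*-assoc t (+ p) (+ p)) (≡.trans e (≡.trans (≡.cong (λ j → (ℤ.- + b) ℤ-Ring.^ j ℤ.+ + b) (≡.sym (ℕP.*-identityʳ p))) (≡.sym r₀≡))))

    s′ : Poly
    s′ = C (proj₁ (ℤ-Ring.∣⇒∃ p∣r₀)) Zx.+ s

    F≋hu+p²s′ : F ≋ h Zx.* u Zx.+ C (+ p) Zx.* (s′ Zx.* C (+ p))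
    F≋hu+p²s′ = rearrange F h u (C (+ p)) s (C r₀) (C r₁) factorisation
        (Zx.trans (Zx.reflexive (≡.cong C (≡.sym (proj₂ (ℤ-Ring.∣⇒∃ p∣r₀))))) (C-* r₁ (+ p)))
      where
      r₁ = proj₁ (ℤ-Ring.∣⇒∃ p∣r₀)
      rearrange : ∀ f h u p s r r₁ → Zx.1# Zx.* f ≋ h Zx.* u Zx.+ Zx.- (p Zx.* Zx.- (r Zx.+ s Zx.* p)) → r ≋ r₁ Zx.* p →
                  f ≋ h Zx.* u Zx.+ p Zx.* ((r₁ Zx.+ s) Zx.* p)
      rearrange f h u p s r r₁ e er = lin₂ 1# p e er (solve 7 (λ f h u p s r r₁ →
        f :+ (con 1ℤ :* (h :* u :+ :- (p :* :- (r :+ s :* p))) :+ p :* (r₁ :* p))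
          := (h :* u :+ p :* ((r₁ :+ s) :* p)) :+ (con 1ℤ :* (con 1ℤ :* f) :+ p :* r)) refl f h u p s r r₁)
        where open Zx

    F≈hu : F Fx.≈ h Fx.* u
    F≈hu = Fx.trans (≋⇒≈ F≋hu+p²s′) (Fx.trans (Fx.+-congˡ {h Zx.* u} (∣⇒≈0 (Zx.x∣x*y (C (+ p)) (s′ Zx.* C (+ p))))) (Fx.+-identityʳ (h Zx.* u)))

    -- The exponent is p - 2, so that u ≡ h H: one factor h stays available to be joined with u.
    H : Poly
    H = h Fx.^ (p ∸ 2)

    u≈hH : u Fx.≈ h Fx.* H
    u≈hH = Fx.cancelˡ {h} (constant⇒nonZeroDivisor h h₀) (Fx.trans (Fx.sym F≈hu) (Fx.trans F≈h^q
      (Fx.reflexive (≡.cong (h Fx.^_) (≡.trans (ℕP.*-identityʳ p) (≡.sym (ℕP.m+[n∸m]≡n 1<p)))))))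

    v w : Poly
    v = proj₁ (Zx.∣⇒∃ (difference u≈hH))
    w = Zx.- (s′ Zx.* H)

    -- u² = u (u - h H) + H h u, where u - h H = p v and h u = F - p² s′; this is the origin of w =
    -- - s′ H.
    u²≈ : u Rx.* u Rx.≈ C (+ p) Rx.* (v Rx.* u) Rx.+ (C (+ p) Rx.* C (+ p)) Rx.* w
    u²≈ = Quotient.mod (H Zx., rearrange F h u (C (+ p)) s′ v H F≋hu+p²s′ (proj₂ (Zx.∣⇒∃ (difference u≈hH))))
      where
      rearrange : ∀ f h u p s v H → f ≋ h Zx.* u Zx.+ p Zx.* (s Zx.* p) → v Zx.* p ≋ u Zx.+ Zx.- (h Zx.* H) →
                  H Zx.* f ≋ u Zx.* u Zx.+ Zx.- (p Zx.* (v Zx.* u) Zx.+ (p Zx.* p) Zx.* Zx.- (s Zx.* H))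
      rearrange f h u p s v H ef ev = lin₂ H u ef ev (solve 7 (λ f h u p s v H →
        H :* f :+ (H :* (h :* u :+ p :* (s :* p)) :+ u :* (u :+ :- (h :* H)))
          := (u :* u :+ :- (p :* (v :* u) :+ (p :* p) :* :- (s :* H))) :+ (H :* f :+ u :* (v :* p))) refl f h u p s v H)
        where open Zx

    β : Qx.Poly
    β = Qx.C (proj₁ (/1-inverse p≢0)) Qx.* φ u

    pβ≈u : φ (C (+ p)) Kx.* β Kx.≈ φ u
    pβ≈u = ≋⇒≈K (Qx.coeffwise λ i → begin
      Qx.coeff (φ (C (+ p)) Qx.* β) i                 ≡⟨ coeff-C*ℚ ((+ p) /1) β i ⟩
      (+ p) /1 ℚ.* Qx.coeff β i                       ≡⟨ ≡.cong ((+ p) /1 ℚ.*_) (coeff-C*ℚ r (φ u) i) ⟩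
      (+ p) /1 ℚ.* (r ℚ.* Qx.coeff (φ u) i)           ≡⟨ ℚP.*-assoc ((+ p) /1) r (Qx.coeff (φ u) i) ⟨
      (+ p) /1 ℚ.* r ℚ.* Qx.coeff (φ u) i             ≡⟨ ≡.cong (ℚ._* Qx.coeff (φ u) i) (≡.trans (ℚP.*-comm ((+ p) /1) r) (proj₂ (/1-inverse p≢0))) ⟩
      ℚ.1ℚ ℚ.* Qx.coeff (φ u) i                       ≡⟨ ℚP.*-identityˡ _ ⟩
      Qx.coeff (φ u) i                                ∎)
      where
      open ≡.≡-Reasoning
      r = proj₁ (/1-inverse p≢0)

    β-integral : IsIntegral β
    β-integral = quadratic-integral β v w β²≈
      where
      π : Qx.Poly
      π = φ (C (+ p))
      φu² : φ u Kx.* φ u Kx.≈ φ (C (+ p)) Kx.* (φ v Kx.* φ u) Kx.+ (φ (C (+ p)) Kx.* φ (C (+ p))) Kx.* φ w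
      φu² = Kx.trans (Kx.sym (φ-*-K u u)) (Kx.trans (φ-cong-K u²≈) (≋⇒≈K (Qx.trans (φ-+ (C (+ p) Zx.* (v Zx.* u)) ((C (+ p) Zx.* C (+ p)) Zx.* w))
        (Qx.+-cong (Qx.trans (φ-* (C (+ p)) (v Zx.* u)) (Qx.*-congˡ {φ (C (+ p))} (φ-* v u)))
          (Qx.trans (φ-* (C (+ p) Zx.* C (+ p)) w) (Qx.*-congʳ {φ w} (φ-* (C (+ p)) (C (+ p)))))))))
      rearrange : ∀ π β U v w → π Kx.* β Kx.≈ U → U Kx.* U Kx.≈ π Kx.* (v Kx.* U) Kx.+ (π Kx.* π) Kx.* w →
                  π Kx.* (π Kx.* (β Kx.* β)) Kx.≈ π Kx.* (π Kx.* (v Kx.* β Kx.+ w))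
      rearrange π β U v w e e′ = lin₂ (π * β + U + - (π * v)) 1# e e′ (solve 5 (λ π β U v w → let k = π :* β :+ U :+ :- (π :* v) in
        π :* (π :* (β :* β)) :+ (k :* U :+ con 1ℤ :* (π :* (v :* U) :+ (π :* π) :* w))
          := π :* (π :* (v :* β :+ w)) :+ (k :* (π :* β) :+ con 1ℤ :* (U :* U))) refl π β U v w)
        where open Kx
      p²β²≈ : π Kx.* (π Kx.* (β Kx.* β)) Kx.≈ π Kx.* (π Kx.* (φ v Kx.* β Kx.+ φ w))
      p²β²≈ = rearrange π β (φ u) (φ v) (φ w) pβ≈u φu²
      β²≈ : β Kx.* β Kx.≈ φ v Kx.* β Kx.+ φ w
      β²≈ = constant-cancel {β Kx.* β} {φ v Kx.* β Kx.+ φ w} {+ p} p≢0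
        (constant-cancel {π Kx.* (β Kx.* β)} {π Kx.* (φ v Kx.* β Kx.+ φ w)} {+ p} p≢0 p²β²≈)

    u-low : DegreeBelow d u
    u-low = go (top-or-zero u)
      where
      h-top : HasTop h d′ 1ℤ
      h-top = ≡.subst (HasTop h d′) (ℤP.+-identityʳ 1ℤ) (hasTop-+ (hasTop-X^ d′) (degreeBelow⇒top (degreeBelow-mono 1≤d′ (proj₂ (hasTop-C (+ b))))))
      hu-top : HasTop (h Zx.* u) d 1ℤ
      hu-top = hasTop-resp (Zx.sym hu≋) (≡.subst (HasTop _ d) (ℤP.+-identityʳ 1ℤ) (hasTop-+ (hasTop-X^ d)
        (degreeBelow⇒top (degreeBelow-neg (degreeBelow-mono 1≤d (degreeBelow-resp (C-^ℤ (ℤ.- + b) q) (proj₂ (hasTop-C ((ℤ.- + b) ℤ-Ring.^ q)))))))))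
        where
        hu≋ : h Zx.* u ≋ X Zx.^ d Zx.+ Zx.- (C (ℤ.- + b) Zx.^ q)
        hu≋ = Zx.trans (Zx.*-comm h u) (Zx.trans (Zx.*-congˡ {u} (Zx.+-congˡ {Y} (Zx.sym (Zx.-‿involutive (C (+ b))))))
          (Zx.trans (proj₂ (Zx.∣⇒∃ u∣)) (Zx.+-congʳ {Zx.- (C (ℤ.- + b) Zx.^ q)} Y^q)))
      go : (u ≋ []) ⊎ (∃[ i ] ∃[ a ] a ≢ 0ℤ × HasTop u i a) → DegreeBelow d u
      go (inj₁ u≋0) = degreeBelow-resp (Zx.sym u≋0) (below λ _ _ → ≡.refl)
      go (inj₂ (i , a , a≢0 , top)) = degreeBelow-mono (ℕP.≤-trans (ℕP.+-monoˡ-≤ i 1≤d′) (ℕP.≤-reflexive d′+i≡d)) (proj₂ top)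
        where
        d′+i≡d : d′ ℕ.+ i ≡ d
        d′+i≡d = top-unique (λ a≡0 → a≢0 (≡.trans (≡.sym (ℤP.*-identityˡ a)) a≡0)) (λ ()) (hasTop-* h h-top top) hu-top

  -- If u(θ) / p = B(θ) with deg B < d, then u = p B already as polynomials, since u has degree
  -- below d as well. So F ≡ h u vanishes modulo p, although it is monic.
  not-maximal : ¬ (∀ α → IsIntegral α → ∃[ B ] DegreeBelow d B × α Kx.≈ φ B)
  not-maximal span = let B , low , β≈B = span β β-integral in
    p∤1 (≡.subst (+ p ∣ℤ_) (proj₁ (F-monic 1≤k)) (≈0⇒coeff (Fx.trans F≈hu (Fx.trans (Fx.*-congˡ {h} (u≈0 B low β≈B)) (Fx.zeroʳ h))) d))
    where
    p∤1 : ¬ (+ p ∣ℤ 1ℤ)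
    p∤1 d = contradiction (≡.subst Prime (ℕDiv.∣1⇒≡1 (∣ℤ⇒∣ d)) pr) ¬prime[1]
    u≈0 : ∀ B → DegreeBelow d B → β Kx.≈ φ B → u Fx.≈ []
    u≈0 B low β≈B = ∣⇒≈0 (Zx.∣ʳ-respʳ-≈ (Zx.sym (Zx.x-y≈0⇒x≈y u-pB≋0)) (Zx.x∣x*y (C (+ p)) B))
      where
      u≈pB : u Rx.≈ C (+ p) Rx.* B
      u≈pB = φ-injective-K (Kx.trans (Kx.sym pβ≈u) (Kx.trans (Kx.*-congˡ {φ (C (+ p))} β≈B) (Kx.sym (φ-*-K (C (+ p)) B))))
      u-pB≋0 : u Zx.+ Zx.- (C (+ p) Zx.* B) ≋ []
      u-pB≋0 = low-multiple⇒0 (F-monic 1≤k) (degreeBelow-+ u-low (degreeBelow-neg (degreeBelow-C* (+ p) low))) (Quotient.difference u≈pB)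


-- From the hypotheses to the local conditions at each prime

module Main (n : ℕ) (m : ℤ) (b k : ℕ) (3≤n : 3 ℕ.≤ n) (2≤b : 2 ℕ.≤ b) (2≤k : 2 ℕ.≤ k)
            (coprime : GCD.gcd b (∣ m ∣) ≡ 1) (b-squarefree : Squarefree b)
            (rad∣m : m ≡ 0ℤ [mod rad k ]) (𝒹-squarefree : Squarefree (𝒹 n m b)) where
  private
    1≤n : 1 ℕ.≤ n
    1≤n = ℕP.≤-trans (s≤s z≤n) 3≤n
    1≤k : 1 ℕ.≤ k
    1≤k = ℕP.≤-trans (s≤s z≤n) 2≤k
    1≤d : 1 ℕ.≤ n ℕ.* k
    1≤d = ℕP.*-mono-≤ 1≤n 1≤k

  open Family n m b k using (F; F-monic; F-constant)
  open IntegralClosure F (F-monic 1≤k)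
  open PowerBasis F (F-monic 1≤k) 1≤d

  p∣k⇒p∣m : ∀ {p} → Prime p → p ℕDiv.∣ k → + p ∣ℤ m
  p∣k⇒p∣m {p} pr p∣k = ∣⇒∣ℤ {+ p} (≡.subst (λ x → p ℕDiv.∣ ∣ x ∣) (ℤP.+-identityʳ m) (ℕDiv.∣-trans (∣rad pr 1≤k p∣k) rad∣m))

  p∣m⇒p∤b : ∀ {p} → Prime p → + p ∣ℤ m → ¬ (+ p ∣ℤ + b)
  p∣m⇒p∤b {p} pr p∣m p∣b = contradiction (≡.subst Prime
    (ℕDiv.∣1⇒≡1 (≡.subst (p ℕDiv.∣_) coprime (GCD.gcd-greatest (∣ℤ⇒∣ p∣b) (∣ℤ⇒∣ p∣m)))) pr) ¬prime[1]

  kgcd⇒m : ∀ {p} → Prime p → p ℕDiv.∣ k ℕ.* GCD.gcd n (∣ m ∣) → + p ∣ℤ m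
  kgcd⇒m {p} pr d = [ p∣k⇒p∣m pr , (λ e → ∣⇒∣ℤ (ℕDiv.∣-trans e (GCD.gcd[m,n]∣n n (∣ m ∣)))) ]′ (euclidsLemma k (GCD.gcd n (∣ m ∣)) pr d)

  kgcd⇒nk : ∀ {p} → Prime p → p ℕDiv.∣ k ℕ.* GCD.gcd n (∣ m ∣) → p ℕDiv.∣ n ℕ.* k
  kgcd⇒nk pr d = [ ℕDiv.∣n⇒∣m*n n , (λ e → ℕDiv.∣m⇒∣m*n k (ℕDiv.∣-trans e (GCD.gcd[m,n]∣m n (∣ m ∣)))) ]′
    (euclidsLemma k (GCD.gcd n (∣ m ∣)) pr d)

  -- For p dividing m, dividing k gcd(n, m) is the same as dividing nk, which decides whether F is a
  -- proper power of h modulo p.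
  nk⇒kgcd : ∀ {p} → Prime p → + p ∣ℤ m → p ℕDiv.∣ n ℕ.* k → p ℕDiv.∣ k ℕ.* GCD.gcd n (∣ m ∣)
  nk⇒kgcd pr p∣m d = [ (λ p∣n → ℕDiv.∣n⇒∣m*n k (GCD.gcd-greatest p∣n (∣ℤ⇒∣ p∣m))) , ℕDiv.∣m⇒∣m*n (GCD.gcd n (∣ m ∣)) ]′
    (euclidsLemma n k pr d)

  private
    prime-divisor : ∀ N → 2 ℕ.≤ N → ∃[ q ] Prime q × q ℕDiv.∣ N
    prime-divisor N@(suc _) 2≤N = go (PrimeFactorisation.factors fact) (PrimeFactorisation.isFactorisation fact) (PrimeFactorisation.factorsPrime fact)
      where
      fact = factorise N
      go : ∀ ps → N ≡ product ps → All Prime ps → ∃[ q ] Prime q × q ℕDiv.∣ N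
      go []       N≡1 _        = contradiction (≡.subst (2 ℕ.≤_) N≡1 2≤N) λ { (s≤s ()) }
      go (q ∷ ps) N≡  (qr ∷ _) = q , qr , ≡.subst (q ℕDiv.∣_) (≡.sym N≡) (ℕDiv.m∣m*n (product ps))

    eisensteinPrime : ∃[ q ] Prime q × q ℕDiv.∣ b
    eisensteinPrime = prime-divisor b 2≤b

    square∤b : ∀ {p} → Prime p → ¬ (p ℕ.* p ℕDiv.∣ b)
    square∤b {p} pr d = contradiction (≡.subst Prime (b-squarefree p d) pr) ¬prime[1]

    F-irreducible : ℚ[x].Irreducible (φ F)
    F-irreducible = let q , qr , q∣b = eisensteinPrime in irreducible q qr (∣⇒∣ℤ q∣b)
      where
      irreducible : ∀ q → Prime q → + q ∣ℤ + b → ℚ[x].Irreducible (φ F)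
      irreducible q qr q∣b = Eisenstein.irreducible F (F-monic 1≤k) 1≤d q qr
        (AtPrime.F≈X^d n m b k 1≤n 1≤k q qr q∣b)
        λ d → square∤b qr (≡.subst₂ ℕDiv._∣_ (ℤP.abs-* (+ q) (+ q)) ≡.refl (∣ℤ⇒∣ {+ q ℤ.* + q} {+ b}
          (≡.subst (+ q ℤ.* + q ∣ℤ_) (F-constant 1≤k 1≤n) d)))

    2-prime : Prime 2
    2-prime = Dec.toWitness {a? = prime? 2} _

  module _ (odd : ∀ p → Prime p → ¬ (2 ℕDiv.∣ p) → p ℕDiv.∣ k ℕ.* GCD.gcd n (∣ m ∣) → ¬ Wieferich b p)
           (even : 2 ℕDiv.∣ k ℕ.* GCD.gcd n (∣ m ∣) → + b ≡ 1ℤ [mod 4 ]) where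

    private
      not-exceptional : ∀ p (pr : Prime p) (p∤b : ¬ (+ p ∣ℤ + b)) → p ℕDiv.∣ k ℕ.* GCD.gcd n (∣ m ∣) →
                        ¬ WieferichCriterion.Exceptional p pr b p∤b
      not-exceptional p pr p∤b p∣kg exc = go (2 ℕDiv.∣? p)
        where
        open WieferichCriterion p pr b p∤b
        go : Dec (2 ℕDiv.∣ p) → ⊥
        go (no 2∤p)  = odd p pr 2∤p p∣kg (exceptional⇒wieferich 2∤p exc)
        go (yes 2∣p) = two-exceptional⇒ p≡2 exc (even (≡.subst (ℕDiv._∣ k ℕ.* GCD.gcd n (∣ m ∣)) p≡2 p∣kg))
          where
          p≡2 : p ≡ 2
          p≡2 = ≡.sym (prime∣prime 2-prime pr 2∣p)

      ramified : ∀ p (pr : Prime p) → + p ∣ℤ m → ¬ (+ p ∣ℤ + b) → AtPrime.Maximal n m b k 1≤n 1≤k p pr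
      ramified p pr p∣m p∤b = let e , d , d≡ , 1≤d′ , p∤d = primePowerPart pr (n ℕ.* k) 1≤d in go e d d≡ 1≤d′ p∤d
        where
        go : ∀ e d → n ℕ.* k ≡ p ℕ.^ e ℕ.* d → 1 ℕ.≤ d → ¬ (p ℕDiv.∣ d) → AtPrime.Maximal n m b k 1≤n 1≤k p pr
        go zero    d d≡ 1≤d′ p∤d = AtPrime.Ramified.maximal-tame n m b k 1≤n 1≤k p pr p∣m p∤b 0 d d≡ 1≤d′ (p∤d ∘ ∣ℤ⇒∣) ≡.refl
        go (suc e) d d≡ 1≤d′ p∤d = AtPrime.Ramified.maximal-wild n m b k 1≤n 1≤k p pr p∣m p∤b (suc e) d d≡ 1≤d′ (p∤d ∘ ∣ℤ⇒∣)
          λ p²∣ → not-exceptional p pr p∤b (nk⇒kgcd pr p∣m (≡.subst (p ℕDiv.∣_) (≡.sym (≡.trans d≡ (ℕP.*-assoc p (p ℕ.^ e) d))) (ℕDiv.m∣m*n (p ℕ.^ e ℕ.* d))))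
            (WieferichCriterion.exceptional-^ p pr b p∤b e p²∣)

      unramified : ∀ n (3≤n : 3 ℕ.≤ n) (1≤n : 1 ℕ.≤ n) p (pr : Prime p) → ¬ (+ p ∣ℤ m) → ¬ (+ p ∣ℤ + b) → ¬ (+ p ∣ℤ + k) →
                   ¬ (+ p ℤ.* + p ∣ℤ 𝒟 n m b) → AtPrime.Maximal n m b k 1≤n 1≤k p pr
      unramified (suc i) 3≤n (s≤s z≤n) p pr p∤m p∤b p∤k = UnramifiedPrime.maximal-unramified i m b k 1≤k p pr p∤m p∤b p∤k 3≤n

      maximal : ∀ p (pr : Prime p) → AtPrime.Maximal n m b k 1≤n 1≤k p pr
      maximal p pr = go (+ p ∣ℤ? + b) (+ p ∣ℤ? m)
        where
        go : Dec (+ p ∣ℤ + b) → Dec (+ p ∣ℤ m) → AtPrime.Maximal n m b k 1≤n 1≤k p pr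
        go (yes p∣b) _         = AtPrime.maximal-eisenstein n m b k 1≤n 1≤k p pr p∣b (square∤b pr)
        go (no p∤b)  (yes p∣m) = ramified p pr p∣m p∤b
        -- Here p does not divide k either, since every prime factor of k divides rad k and hence m.
        go (no p∤b)  (no p∤m)  = unramified n 3≤n 1≤n p pr p∤m p∤b (p∤m ∘ p∣k⇒p∣m pr ∘ ∣ℤ⇒∣)
          (square∤𝒟 n m b 𝒹-squarefree pr p∤b p∤m)

    monogenic : Monogenic F
    monogenic = record
      { degree      = n ℕ.* k
      ; monic       = hasTop⇒monicOfDegree (F-monic 1≤k)
      ; irreducible = F-irreducible
      ; powerBasis  = integralBasis (integral⇒integer maximal)
      }

  module _ (mono : Monogenic F) where

    private
      not-exceptional : ∀ p (pr : Prime p) → (p∣kg : p ℕDiv.∣ k ℕ.* GCD.gcd n (∣ m ∣)) →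
                        ¬ WieferichCriterion.Exceptional p pr b (p∣m⇒p∤b pr (kgcd⇒m pr p∣kg))
      not-exceptional p pr p∣kg exc = NonMaximal.not-maximal n m b k 1≤n 1≤k p pr (kgcd⇒m pr p∣kg)
        (p∣m⇒p∤b pr (kgcd⇒m pr p∣kg)) (kgcd⇒nk pr p∣kg) exc (monogenic⇒spanning mono)

    not-wieferich : ∀ p → Prime p → ¬ (2 ℕDiv.∣ p) → p ℕDiv.∣ k ℕ.* GCD.gcd n (∣ m ∣) → ¬ Wieferich b p
    not-wieferich p pr 2∤p p∣kg w = not-exceptional p pr p∣kg
      (WieferichCriterion.wieferich⇒exceptional p pr b (p∣m⇒p∤b pr (kgcd⇒m pr p∣kg)) 2∤p w)

    b≡1[mod4] : 2 ℕDiv.∣ k ℕ.* GCD.gcd n (∣ m ∣) → + b ≡ 1ℤ [mod 4 ]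
    b≡1[mod4] 2∣kg = Dec.decidable-stable (4 ℕDiv.∣? ∣ + b ℤ.- 1ℤ ∣) λ b≢1 → not-exceptional 2 2-prime 2∣kg
      (WieferichCriterion.two-exceptional⇐ 2 2-prime b (p∣m⇒p∤b 2-prime (kgcd⇒m 2-prime 2∣kg)) ≡.refl b≢1)

open import Data.Nat using (ℕ; _≤_; _*_)
open import Data.Nat.Divisibility using (_∣_)
open import Data.Nat.GCD using (gcd)
open import Data.Nat.Primality using (Prime)
open import Data.Integer using (ℤ; +_; ∣_∣; 0ℤ; 1ℤ)
open import Data.Product using (_×_)
open import Function.Bundles using (_⇔_)
open import Relation.Binary.PropositionalEquality using (_≡_)
open import Relation.Nullary using (¬_)

theorem1p5 : (n : ℕ) (m : ℤ) (b k : ℕ) →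
    3 ≤ n → 2 ≤ ∣ m ∣ → 2 ≤ b → 2 ≤ k →
    gcd b (∣ m ∣) ≡ 1 →
    Squarefree b →
    m ≡ 0ℤ [mod rad k ] →
    Squarefree (𝒹 n m b) →
    (∀ p (pr : Prime p) → p ∣ k → 𝔽[x].Irreducible p (g n b k p pr)) →
    Monogenic (ℱ n b m k)
    ⇔
    ( (∀ p → Prime p → ¬ (2 ∣ p) → p ∣ (k * gcd n (∣ m ∣)) → ¬ Wieferich b p)
    × (2 ∣ (k * gcd n (∣ m ∣)) → + b ≡ 1ℤ [mod 4 ]) )
theorem1p5 n m b k 3≤n _ 2≤b 2≤k coprime sqf rad∣m 𝒹-sqf _ = mk⇔
  (λ mono → not-wieferich mono , b≡1[mod4] mono)
  (λ (odd , even) → monogenic odd even)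
  where open Main n m b k 3≤n 2≤b 2≤k coprime sqf rad∣m 𝒹-sqf
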